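{- Let $\lambda\ge 0$, $\eta$ and $\alpha_1,\dots,\alpha_\lambda$ be integers with $0<\alpha_1<\cdots<\alpha_\lambda<\eta$ and $\alpha_i=\eta-\alpha_{\lambda+1-i}$ for $1\le i\le\lambda$, and let $k,r$ be integers with $k\ge r\ge\lambda\ge 0$ and $k>\lambda$. Then, as formal power series in $q$, \[ \sum_{n\ge0}\overline{B}_1(\alpha_1,\ldots,\alpha_\lambda;\eta,k,r;n)q^n=(-q^\eta;q^\eta)_\infty\sum_{n\ge0}B_0(\alpha_1,\ldots,\alpha_\lambda;\eta,k,r;n)q^n . \]
   Context: Notation: $(a;q)_\infty=\prod_{i\ge0}(1-aq^i)$. Overpartitions: an overpartition of $n$ is a partition of $n$ in which the first occurrence of a part size may be overlined (so overlined parts have distinct sizes). Parts are totally ordered by $1<\bar1<2<\bar2<3<\cdots$; an overpartition is written $\pi=(\pi_1,\dots,\pi_s)$ with $\pi_1\ge\cdots\ge\pi_s$ in this order, and all inequalities between parts (and expressions $x\pm\eta$) are taken in this order, where for a part $x$, $x\pm\eta$ denotes the part of size $|x|\pm\eta$ which is overlined iff $x$ is. For a part $x$, $[x/\eta]$ denotes $\lfloor |x|/\eta\rfloor$. $\overline{V}_\pi(N)$ is the number of overlined parts of $\pi$ that are $\le N$ (in this order). $\overline{B}_j(\alpha_1,\ldots,\alpha_\lambda;\eta,k,r;n)$ (for $j\in\{0,1\}$, $k\ge r\ge\lambda\ge0$, $k-1+j>\lambda$) is the number of overpartitions $\pi=(\pi_1,\dots,\pi_s)$ of $n$ such that: (1)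 every part has size $\equiv 0,\alpha_1,\ldots,\alpha_\lambda\pmod\eta$; (2) only parts whose size is a multiple of $\eta$ may be non-overlined; (3) $\pi_i\ge\pi_{i+k-1}+\eta$ whenever $i+k-1\le s$, with strict inequality if $\pi_i$ is non-overlined; (4) at most $r-1$ of the parts satisfy $\pi_i\le\eta$; (5) whenever $i+k-2\le s$ and $\pi_i\le\pi_{i+k-2}+\eta$ with strict inequality if $\pi_i$ is overlined, then $[\pi_i/\eta]+\cdots+[\pi_{i+k-2}/\eta]\equiv r-1+\overline{V}_\pi(\pi_i)\pmod{2-j}$. $B_j(\alpha_1,\ldots,\alpha_\lambda;\eta,k,r;n)$ (Bressoud) is the number of ordinary partitions $(\pi_1,\dots,\pi_s)$ of $n$ with $\pi_1\ge\cdots\ge\pi_s$ such that: (1) $\pi_i\equiv0,\alpha_1,\ldots,\alpha_\lambda\pmod\eta$; (2) only multiples of $\eta$ may be repeated; (3) $\pi_i\ge\pi_{i+k-1}+\eta$, with strict inequality if $\eta\mid\pi_i$; (4) at most $r-1$ of the $\pi_i$ are $\le\eta$; (5) if $\pi_i\le\pi_{i+k-2}+\eta$, with strict inequality if $\eta\nmid\pi_i$, then $\lfloor\pi_i/\eta\rfloor+\cdots+\lfloor\pi_{i+k-2}/\eta\rfloor\equiv r-1+V_\pi(\pi_i)\pmod{2-j}$, where $V_\pi(N)$ is the number of parts not exceeding $N$ that are not divisible by $\eta$.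
   Formalization: The condition k ≥ 2 is added: for k = 1, λ = 0, r = 1, condition (3) leaves only the empty partition on both sides, so the left side is 1 while the right side is (−q^η;q^η)_∞, and the stated identity fails. -}

module Defs where

open import Data.Nat using (ℕ; zero; suc; _+_; _*_; _∸_; NonZero; _≡ᵇ_; _<ᵇ_; _≤ᵇ_)
open import Data.Nat.DivMod using (_/_; _%_)
open import Data.Bool using (Bool; true; false; if_then_else_; _∧_; _∨_; not)
open import Data.List using (List; []; _∷_; map; length; take; drop; upTo; concatMap)
open import Data.Nat.ListAction using (sum)
open import Data.Bool.ListAction using (all; any)
open import Data.Maybe using (Maybe; just; nothing)
open import Data.Fin using (Fin; toℕ)
open import Data.Vec using (Vec; toList)

countᵇ : {A : Set} → (A → Bool) → List A → ℕ
countᵇ p []       = 0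
countᵇ p (x ∷ xs) = (if p x then 1 else 0) + countᵇ p xs

nth : {A : Set} → List A → ℕ → Maybe A
nth []       _       = nothing
nth (x ∷ xs) zero    = just x
nth (x ∷ xs) (suc i) = nth xs i

listsOfLength : {A : Set} → List A → ℕ → List (List A)
listsOfLength alph zero    = [] ∷ []
listsOfLength alph (suc l) = concatMap (λ a → map (a ∷_) (listsOfLength alph l)) alph

listsUpTo : {A : Set} → List A → ℕ → List (List A)
listsUpTo alph n = concatMap (listsOfLength alph) (upTo (suc n))

adjacentᵇ : {A : Set} → (A → A → Bool) → List A → Bool
adjacentᵇ R []           = true
adjacentᵇ R (x ∷ [])     = true
adjacentᵇ R (x ∷ y ∷ xs) = R x y ∧ adjacentᵇ R (y ∷ xs)

distinctᵇ : List ℕ → Bool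
distinctᵇ []       = true
distinctᵇ (x ∷ xs) = not (any (λ y → x ≡ᵇ y) xs) ∧ distinctᵇ xs

_≡[mod_]ᵇ_ : ℕ → (m : ℕ) → .{{NonZero m}} → ℕ → Bool
a ≡[mod m ]ᵇ b = (a % m) ≡ᵇ (b % m)

-- the modulus 2 - j for j ∈ {0,1}
modulus : Fin 2 → ℕ
modulus j = suc (1 ∸ toℕ j)

record Part : Set where
  constructor part
  field
    size : ℕ
    over : Bool
open Part public

-- the total order 1 < 1̄ < 2 < 2̄ < ⋯ : x ≤ y iff key x ≤ key y
key : Part → ℕ
key x = 2 * size x + (if over x then 1 else 0)

_≤ₚ_ : Part → Part → Bool
x ≤ₚ y = key x ≤ᵇ key y

_<ₚ_ : Part → Part → Bool
x <ₚ y = key x <ᵇ key y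

_+ₚ_ : Part → ℕ → Part
x +ₚ η = part (size x + η) (over x)

plain : ℕ → Part
plain η = part η false

isOverpartitionᵇ : ℕ → List Part → Bool
isOverpartitionᵇ n π =
  all (λ x → 1 ≤ᵇ size x) π
  ∧ adjacentᵇ (λ x y → y ≤ₚ x) π
  ∧ distinctᵇ (map size (filterᵇ π))
  ∧ (sum (map size π) ≡ᵇ n)
  where
  filterᵇ : List Part → List Part
  filterᵇ []       = []
  filterᵇ (x ∷ xs) = if over x then x ∷ filterᵇ xs else filterᵇ xs

partAlphabet : ℕ → List Part
partAlphabet n = concatMap (λ s → part (suc s) false ∷ part (suc s) true ∷ []) (upTo n)

allOverpartitions : ℕ → List (List Part)
allOverpartitions n = listsUpTo (partAlphabet n) n

Vbar : List Part → Part → ℕ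
Vbar π N = countᵇ (λ x → over x ∧ (x ≤ₚ N)) π

-- Conditions (1)–(5) defining B̄_j(α_1,…,α_λ; η, k, r; n).  Indices are 0-based:
-- position i here is π_{i+1} in the paper.
module _ {l : ℕ} (j : Fin 2) (α : Vec ℕ l) (η : ℕ) .{{_ : NonZero η}} (k r : ℕ) where

  residueOK : ℕ → Bool
  residueOK s = (s % η ≡ᵇ 0) ∨ any (λ a → s % η ≡ᵇ a) (toList α)

  flr : Part → ℕ
  flr x = size x / η

  cond1ᵇ : List Part → Bool
  cond1ᵇ π = all (λ x → residueOK (size x)) π

  cond2ᵇ : List Part → Bool
  cond2ᵇ π = all (λ x → over x ∨ (size x % η ≡ᵇ 0)) π

  cond3ᵇ : List Part → Bool
  cond3ᵇ π = all check (upTo (length π))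
    where
    check : ℕ → Bool
    check i with nth π i | nth π (i + (k ∸ 1))
    ... | just x | just y = if over x then (y +ₚ η) ≤ₚ x else (y +ₚ η) <ₚ x
    ... | _      | _      = true

  cond4ᵇ : List Part → Bool
  cond4ᵇ π = countᵇ (λ x → x ≤ₚ plain η) π <ᵇ r

  -- whenever i+k-2 ≤ s and π_i ≤ π_{i+k-2} + η (strict if π_i overlined),
  -- [π_i/η] + ⋯ + [π_{i+k-2}/η] ≡ r - 1 + V̄_π(π_i)  (mod 2-j);
  -- written as  (that sum) + 1 ≡ r + V̄_π(π_i)  to avoid truncated subtraction
  cond5ᵇ : List Part → Bool
  cond5ᵇ π = all check (upTo (length π))
    where
    check : ℕ → Bool
    check i with nth π i | nth π (i + (k ∸ 2))
    ... | just x | just y =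
          if (if over x then x <ₚ (y +ₚ η) else x ≤ₚ (y +ₚ η))
          then (sum (map flr (take (k ∸ 1) (drop i π))) + 1)
                 ≡[mod modulus j ]ᵇ (r + Vbar π x)
          else true
    ... | _      | _      = true

  validBbarᵇ : ℕ → List Part → Bool
  validBbarᵇ n π = isOverpartitionᵇ n π ∧ cond1ᵇ π ∧ cond2ᵇ π ∧ cond3ᵇ π ∧ cond4ᵇ π ∧ cond5ᵇ π

  Bbar : ℕ → ℕ
  Bbar n = countᵇ (validBbarᵇ n) (allOverpartitions n)

isPartitionᵇ : ℕ → List ℕ → Bool
isPartitionᵇ n π = all (λ x → 1 ≤ᵇ x) π ∧ adjacentᵇ (λ x y → y ≤ᵇ x) π ∧ (sum π ≡ᵇ n)

allPartitions : ℕ → List (List ℕ)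
allPartitions n = listsUpTo (map suc (upTo n)) n

module _ {l : ℕ} (j : Fin 2) (α : Vec ℕ l) (η : ℕ) .{{_ : NonZero η}} (k r : ℕ) where

  divη : ℕ → Bool
  divη x = x % η ≡ᵇ 0

  V : List ℕ → ℕ → ℕ
  V π N = countᵇ (λ x → (x ≤ᵇ N) ∧ not (divη x)) π

  pcond1ᵇ : List ℕ → Bool
  pcond1ᵇ π = all (λ x → divη x ∨ any (λ a → x % η ≡ᵇ a) (toList α)) π

  pcond2ᵇ : List ℕ → Bool
  pcond2ᵇ π = distinctᵇ (go π)
    where
    go : List ℕ → List ℕ
    go []       = []
    go (x ∷ xs) = if divη x then go xs else x ∷ go xs

  pcond3ᵇ : List ℕ → Bool
  pcond3ᵇ π = all check (upTo (length π))
    where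
    check : ℕ → Bool
    check i with nth π i | nth π (i + (k ∸ 1))
    ... | just x | just y = if divη x then y + η <ᵇ x else y + η ≤ᵇ x
    ... | _      | _      = true

  pcond4ᵇ : List ℕ → Bool
  pcond4ᵇ π = countᵇ (λ x → x ≤ᵇ η) π <ᵇ r

  pcond5ᵇ : List ℕ → Bool
  pcond5ᵇ π = all check (upTo (length π))
    where
    check : ℕ → Bool
    check i with nth π i | nth π (i + (k ∸ 2))
    ... | just x | just y =
          if (if divη x then x ≤ᵇ y + η else x <ᵇ y + η)
          then (sum (map (λ z → z / η) (take (k ∸ 1) (drop i π))) + 1)
                 ≡[mod modulus j ]ᵇ (r + V π x)
          else true
    ... | _      | _      = true

  validBᵇ : ℕ → List ℕ → Bool
  validBᵇ n π = isPartitionᵇ n π ∧ pcond1ᵇ π ∧ pcond2ᵇ π ∧ pcond3ᵇ π ∧ pcond4ᵇ π ∧ pcond5ᵇ π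

  B : ℕ → ℕ
  B n = countᵇ (validBᵇ n) (allPartitions n)

-- Formal power series with ℕ coefficients, as coefficient sequences

_⊛_ : (ℕ → ℕ) → (ℕ → ℕ) → ℕ → ℕ
(f ⊛ g) n = sum (map (λ m → f m * g (n ∸ m)) (upTo (suc n)))

-- coefficients of the polynomial ∏_{i=1}^{N} (1 + q^{η i})
finProd : ℕ → ℕ → ℕ → ℕ
finProd η zero    n = if n ≡ᵇ 0 then 1 else 0
finProd η (suc N) n =
  finProd η N n + (if η * suc N ≤ᵇ n then finProd η N (n ∸ η * suc N) else 0)

-- coefficients of (-q^η; q^η)_∞ = ∏_{i≥1} (1 + q^{η i}); for η ≥ 1 the
-- coefficient of q^n is already fixed by the factors with i ≤ n
negqProd : (η : ℕ) → .{{NonZero η}} → ℕ → ℕ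
negqProd η n = finProd η n n

{-# OPTIONS --safe #-}
module Submission where

-- Write an overpartition as a descending list, and call k − 1 consecutive parts a
-- band if their ends are as close as in condition (5).  Then B₀ counts the set X₀ of
-- the lists without overlined multiples of η whose bands are all even (satisfy (5)),
-- and B̄₁ drops both requirements.  There is a filtration X₀ ⊆ X₁ ⊆ … exhausting
-- B̄₁ in which the elements of X_N ∖ X_{N−1} of weight n + Nη correspond to the
-- elements of X_{N−1} of weight n; this gives the factor 1 + q^{Nη}.
-- To insert Nη, cut the list greedily from the top into bands and single parts and
-- move the bands one after the other: the last part of a band is raised by η and
-- becomes its first part.  After p moves, stop as soon as the overlined part
-- (N − p)η fits in; if p reaches N, nothing is inserted and the N-th band has become
-- odd.  The inverse reads the bands greedily from the bottom.  Since λ < k, bands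
-- that overlap have the same parity, so an odd band can always be moved back.

open import Defs
open import Data.Nat
open import Data.Nat.Properties
open import Data.Nat.DivMod using (_/_; _%_; m≡m%n+[m/n]*n; [m+n]%n≡m%n; /-monoˡ-≤; +-distrib-/-∣ʳ; n/n≡1; 0/n≡0; m/n*n≤m; m*n/n≡m; m/n≤m; m<n⇒m%n≡m; m<n⇒m/n≡0; n%n≡0; m*n%n≡0; n%1≡0)
open import Data.Nat.Divisibility using (∣-refl)
open import Data.Nat.ListAction using (sum)
open import Data.Nat.Solver using (module +-*-Solver)
open import Data.Bool using (Bool; true; false; if_then_else_; not; _∧_; _∨_; _xor_) renaming (T to isTrue)
open import Data.Bool.ListAction using (all; any)
open import Data.Bool.Properties using (not-involutive; not-distribˡ-xor; xor-same; xor-identityʳ) renaming (_≟_ to _≟ᵇ_)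
open import Data.Empty using (⊥; ⊥-elim)
open import Data.Fin using (Fin; opposite) renaming (_<_ to _<ᶠ_; zero to fzero; suc to fsuc)
open import Data.List using (List; []; _∷_; _++_; map; length; take; drop; replicate; upTo; applyUpTo; concatMap)
open import Data.List.Membership.Propositional using (_∈_; find; lose)
open import Data.List.Membership.Propositional.Properties using (∈-∃++; ∈-concatMap⁺; ∈-concatMap⁻; ∈-upTo⁺; ∈-map⁺; ∈-map⁻)
open import Data.List.Properties using (++-assoc; ++-identityʳ; ++-cancelˡ; length-++; length-map; length-replicate; map-++; map-applyUpTo; take-all; ∷-injective; ∷-injectiveˡ; ∷-injectiveʳ)
open import Data.List.Relation.Binary.Subset.Propositional using (_⊆_)
open import Data.List.Relation.Unary.All as All using (All; []; _∷_)
import Data.List.Relation.Unary.All.Properties as All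
open import Data.List.Relation.Unary.AllPairs as AllPairs using (AllPairs; []; _∷_)
import Data.List.Relation.Unary.AllPairs.Properties as AllPairs
open import Data.List.Relation.Unary.Any using (here; there)
open import Data.List.Relation.Unary.Linked using (Linked; []; [-]; _∷_)
open import Data.List.Relation.Unary.Linked.Properties using (Linked⇒AllPairs)
open import Data.List.Relation.Unary.Unique.Propositional using (Unique)
import Data.List.Relation.Unary.Unique.Propositional.Properties as Unique
open import Data.Maybe using (Maybe; just; nothing)
open import Data.Maybe.Properties using (just-injective)
open import Data.Product using (Σ; _,_; _×_; proj₁; proj₂; ∃; ∃-syntax)
open import Data.Sum using (_⊎_; inj₁; inj₂)
open import Data.Unit using (⊤; tt)
open import Data.Vec using (Vec; lookup; toList)
open import Data.Vec.Properties using (length-toList)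
open import Function using (_∘_; id)
open import Relation.Binary.PropositionalEquality
open import Relation.Nullary using (¬_; Dec; yes; no)
open import Relation.Nullary.Decidable using (does; _×-dec_)
open +-*-Solver using (solve; _:+_; _:=_; con)

-- The filtration is chosen so that N can be read off from the result of inserting Nη. Let o be the
-- largest overlined multiple of η and p the number of disjoint bands above it: the list lies in X_N
-- when its level o/η + p is at most N, and placing (N - p)η after p moves gives level exactly N.
-- Without such an o, membership in X_N asks that all bands below the first N greedy ones are even.
-- A move raises one quotient in its band by 1 and keeps all overlines, so it flips the parity of
-- that band; this is what takes the result out of X_(N-1) when nothing is inserted. The moves are
-- found from the top but undone from the bottom, so the proof hinges on both searches finding
-- equally many bands. The other obstacle is the lower end of the list. There k - r virtual parts 0
-- are appended, which makes (4) an instance of (3), and every band that reaches into them is even,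
-- its quotients and overlines adding up to exactly r - 1.

-- Counting finite sets through lists without repetition.

∈-remove : {A : Set} {v w : A} → ∀ ys {zs} → w ∈ ys ++ v ∷ zs → w ≢ v → w ∈ ys ++ zs
∈-remove []       (here e)  ne = ⊥-elim (ne e)
∈-remove []       (there p) ne = p
∈-remove (y ∷ ys) (here e)  ne = here e
∈-remove (y ∷ ys) (there p) ne = there (∈-remove ys p ne)

-- The pigeonhole principle; it serves to compare counts and, later, to bound the number of residues
-- within one η-interval.
unique-⊆⇒length≤ : {A : Set} {xs ys : List A} → Unique xs → xs ⊆ ys → length xs ≤ length ys
unique-⊆⇒length≤ {xs = []}     u h = z≤n
unique-⊆⇒length≤ {xs = x ∷ xs} (x∉ ∷ u) h with ∈-∃++ (h (here refl))
... | ys , zs , refl = begin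
  suc (length xs)           ≤⟨ s≤s
      (unique-⊆⇒length≤ u (λ p → ∈-remove ys (h (there p)) (λ e → All.lookup x∉ p (sym e)))) ⟩
  suc (length (ys ++ zs))   ≡⟨ cong suc (length-++ ys) ⟩
  suc (length ys + length zs) ≡⟨ sym (+-suc (length ys) (length zs)) ⟩
  length ys + suc (length zs) ≡⟨ sym (length-++ ys) ⟩
  length (ys ++ x ∷ zs)     ∎
  where open ≤-Reasoning

par : ℕ → Bool
par zero    = false
par (suc n) = not (par n)

par-+ : ∀ m n → par (m + n) ≡ par m xor par n
par-+ zero    n = refl
par-+ (suc m) n = trans (cong not (par-+ m n)) (not-distribˡ-xor (par m) (par n))

par-double : ∀ m n → par (n + (m + m)) ≡ par n
par-double m n = begin
  par (n + (m + m))              ≡⟨ par-+ n (m + m) ⟩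
  par n xor par (m + m)          ≡⟨ cong (par n xor_) (trans (par-+ m m) (xor-same (par m))) ⟩
  par n xor false                ≡⟨ xor-identityʳ (par n) ⟩
  par n                          ∎
  where open ≡-Reasoning

par-congˡ : ∀ c {a b} → par a ≡ par b → par (a + c) ≡ par (b + c)
par-congˡ c {a} {b} e = trans (par-+ a c) (trans (cong (_xor par c) e) (sym (par-+ b c)))

sel : {X : Set} → (X → Bool) → List X → List X
sel p []       = []
sel p (x ∷ xs) = if p x then x ∷ sel p xs else sel p xs

length-sel : {X : Set} (p : X → Bool) → ∀ xs → length (sel p xs) ≡ countᵇ p xs
length-sel p []       = refl
length-sel p (x ∷ xs) with p x
... | true  = cong suc (length-sel p xs)
... | false = length-sel p xs

∈-sel⁺ : {X : Set} (p : X → Bool) → ∀ {x} xs → x ∈ xs → p x ≡ true → x ∈ sel p xs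
∈-sel⁺ p (y ∷ xs) (here refl) e rewrite e = here refl
∈-sel⁺ p (y ∷ xs) (there h)   e with p y
... | true  = there (∈-sel⁺ p xs h e)
... | false = ∈-sel⁺ p xs h e

All-sel : {X : Set} (p : X → Bool) → ∀ xs → All (λ x → p x ≡ true) (sel p xs)
All-sel p [] = []
All-sel p (x ∷ xs) with p x in e
... | true  = e ∷ All-sel p xs
... | false = All-sel p xs

sel-All : {X : Set} {P : X → Set} (p : X → Bool) → ∀ xs → All P xs → All P (sel p xs)
sel-All p []       a       = []
sel-All p (x ∷ xs) (h ∷ a) with p x
... | true  = h ∷ sel-All p xs a
... | false = sel-All p xs a

unique-sel : {X : Set} (p : X → Bool) → ∀ xs → Unique xs → Unique (sel p xs)
unique-sel p []       u       = []
unique-sel p (x ∷ xs) (h ∷ u) with p x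
... | true  = sel-All p xs h ∷ unique-sel p xs u
... | false = unique-sel p xs u

module _ {X Y : Set} (R : X → Y → Set) where

  private
    images : ∀ (P : X → Set) (Q : Y → Set) → (∀ {x} → P x → ∃[ y ] (Q y × R x y)) →
             (∀ {x x′ y} → P x → P x′ → R x y → R x′ y → x ≡ x′) →
             ∀ xs → Unique xs → All P xs →
             ∃[ ys ] (length ys ≡ length xs × Unique ys × All Q ys ×
                 All (λ y → ∃[ x ] (x ∈ xs × P x × R x y)) ys)
    images P Q tot inj [] u a = [] , refl , [] , [] , []
    images P Q tot inj (x ∷ xs) (x∉ ∷ u) (p ∷ a) with tot p | images P Q tot inj xs u a
    ... | y , qy , ry | ys , l , uy , qs , rs =
      y ∷ ys , cong suc l ,
      All.map (λ { (x′ , x′∈ , p′ , r′) e → All.lookup x∉ x′∈ (inj p p′ (subst (R x) e ry) r′) }) rs ∷ uy ,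
      qy ∷ qs , (x , here refl , p , ry) ∷ All.map (λ { (x′ , x′∈ , z) → x′ , there x′∈ , z }) rs

  count-≤ : (p : X → Bool) (p′ : Y → Bool) → ∀ xs ys → Unique xs →
            (∀ {x} → p x ≡ true → ∃[ y ] ((y ∈ ys × p′ y ≡ true) × R x y)) →
            (∀ {x x′ y} → p x ≡ true → p x′ ≡ true → R x y → R x′ y → x ≡ x′) →
            countᵇ p xs ≤ countᵇ p′ ys
  count-≤ p p′ xs ys u tot inj with images (λ x → p x ≡ true) (λ y → y ∈ ys × p′ y ≡ true) tot inj
      (sel p xs) (unique-sel p xs u) (All-sel p xs)
  ... | zs , l , uz , qz , _ = begin
    countᵇ p xs          ≡⟨ sym (length-sel p xs) ⟩
    length (sel p xs)    ≡⟨ sym l ⟩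
    length zs            ≤⟨ unique-⊆⇒length≤ uz (λ z∈ → let q = All.lookup qz z∈ in ∈-sel⁺ p′ ys (proj₁ q) (proj₂ q)) ⟩
    length (sel p′ ys)   ≡⟨ length-sel p′ ys ⟩
    countᵇ p′ ys         ∎
    where open ≤-Reasoning

-- Stated for a relation because insertion is given by derivations of `TS` and not by a function.
-- Each of the two inequalities needs totality on one side and injectivity from that side.
count-bijection : {X Y : Set} (R : X → Y → Set) (p : X → Bool) (p′ : Y → Bool) → ∀ xs ys → Unique xs →
    Unique ys →
  (∀ {x} → p x ≡ true → ∃[ y ] ((y ∈ ys × p′ y ≡ true) × R x y)) →
  (∀ {y} → p′ y ≡ true → ∃[ x ] ((x ∈ xs × p x ≡ true) × R x y)) →
  (∀ {x x′ y} → p x ≡ true → p x′ ≡ true → R x y → R x′ y → x ≡ x′) →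
  (∀ {x y y′} → R x y → R x y′ → y ≡ y′) →
  countᵇ p xs ≡ countᵇ p′ ys
count-bijection R p p′ xs ys ux uy f g inj fun = ≤-antisym (count-≤ R p p′ xs ys ux f inj)
  (count-≤ (λ y x → R x y) p′ p ys xs uy g (λ _ _ → fun))

count-cong : {X : Set} {p p′ : X → Bool} → (∀ x → p x ≡ p′ x) → ∀ xs → countᵇ p xs ≡ countᵇ p′ xs
count-cong h []       = refl
count-cong h (x ∷ xs) = cong₂ (λ b n → (if b then 1 else 0) + n) (h x) (count-cong h xs)

count-none : {X : Set} {p : X → Bool} → (∀ x → p x ≡ false) → ∀ xs → countᵇ p xs ≡ 0
count-none h []       = refl
count-none h (x ∷ xs) rewrite h x = count-none h xs

count-split : {X : Set} {p p′ p″ : X → Bool} →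
              (∀ x → (if p x then 1 else 0) ≡ (if p′ x then 1 else 0) + (if p″ x then 1 else 0)) →
              ∀ xs → countᵇ p xs ≡ countᵇ p′ xs + countᵇ p″ xs
count-split h [] = refl
count-split {p = p} {p′} {p″} h (x ∷ xs) = trans (cong₂ _+_ (h x) (count-split {p = p} {p′} {p″} h xs))
  (solve 4 (λ a b c d → a :+ b :+ (c :+ d) := a :+ c :+ (b :+ d)) refl (if p′ x then 1 else 0)
      (if p″ x then 1 else 0) (countᵇ p′ xs) (countᵇ p″ xs))

unique-concatMap : {X Y : Set} (f : X → List Y) → ∀ xs → Unique xs → (∀ x → Unique (f x)) →
                   (∀ {x x′ y} → y ∈ f x → y ∈ f x′ → x ≡ x′) → Unique (concatMap f xs)
unique-concatMap f xs u uf dis = Unique.concat⁺ (All.map⁺ (All.universal uf xs))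
  (AllPairs.map⁺ (AllPairs.map (λ ne → λ { (a , b) → ne (dis a b) }) u))

∈-listsOfLength : {X : Set} (alph : List X) → ∀ xs → All (_∈ alph) xs → xs ∈ listsOfLength alph (length xs)
∈-listsOfLength alph []       a       = here refl
∈-listsOfLength alph (x ∷ xs) (h ∷ a) = ∈-concatMap⁺ (λ y → map (y ∷_) (listsOfLength alph (length xs)))
  (lose h (∈-map⁺ (x ∷_) (∈-listsOfLength alph xs a)))

length-listsOfLength : {X : Set} (alph : List X) → ∀ n {xs} → xs ∈ listsOfLength alph n → length xs ≡ n
length-listsOfLength alph zero    (here refl) = refl
length-listsOfLength alph (suc n) h with find (∈-concatMap⁻ (λ y → map (y ∷_) (listsOfLength alph n)) {xs =
    alph} h)
... | y , _ , h′ with ∈-map⁻ (y ∷_) h′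
...   | ys , h″ , refl = cong suc (length-listsOfLength alph n h″)

unique-listsOfLength : {X : Set} (alph : List X) → Unique alph → ∀ n → Unique (listsOfLength alph n)
unique-listsOfLength alph u zero    = [] ∷ []
unique-listsOfLength alph u (suc n) = unique-concatMap (λ y → map (y ∷_) (listsOfLength alph n)) alph u
  (λ y → Unique.map⁺ (λ e → proj₂ (∷-injective e)) (unique-listsOfLength alph u n))
  (λ {y} {y′} a b → heads a b)
  where
  heads : ∀ {y y′ v} → v ∈ map (y ∷_) (listsOfLength alph n) →
      v ∈ map (y′ ∷_) (listsOfLength alph n) → y ≡ y′
  heads {y} {y′} a b with ∈-map⁻ (y ∷_) a | ∈-map⁻ (y′ ∷_) b
  ... | _ , _ , e | _ , _ , e′ = proj₁ (∷-injective (trans (sym e) e′))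

unique-listsUpTo : {X : Set} (alph : List X) → Unique alph → ∀ n → Unique (listsUpTo alph n)
unique-listsUpTo alph u n = unique-concatMap (listsOfLength alph) (upTo (suc n)) (Unique.upTo⁺ (suc n))
    (unique-listsOfLength alph u)
  (λ {m} {m′} a b → trans (sym (length-listsOfLength alph m a)) (length-listsOfLength alph m′ b))

∈-listsUpTo : {X : Set} (alph : List X) → ∀ n xs → length xs ≤ n → All (_∈ alph) xs → xs ∈ listsUpTo alph n
∈-listsUpTo alph n xs h a = ∈-concatMap⁺ (listsOfLength alph)
    (lose (∈-upTo⁺ (s≤s h)) (∈-listsOfLength alph xs a))

unique-partAlphabet : ∀ n → Unique (partAlphabet n)
unique-partAlphabet n = unique-concatMap _ (upTo n) (Unique.upTo⁺ n) (λ s → ((λ ()) ∷ []) ∷ [] ∷ []) dis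
  where
  val : ∀ {s y} → y ∈ part (suc s) false ∷ part (suc s) true ∷ [] → size y ≡ suc s
  val (here refl)         = refl
  val (there (here refl)) = refl
  dis : ∀ {s s′ y} → y ∈ part (suc s) false ∷ part (suc s) true ∷ [] →
      y ∈ part (suc s′) false ∷ part (suc s′) true ∷ [] → s ≡ s′
  dis a b = suc-injective (trans (sym (val a)) (val b))

∈-partAlphabet : ∀ n x → 1 ≤ size x → size x ≤ n → x ∈ partAlphabet n
∈-partAlphabet n (part (suc s) b) h k = ∈-concatMap⁺ _ (lose (∈-upTo⁺ k) (pick b))
  where
  pick : ∀ b → part (suc s) b ∈ part (suc s) false ∷ part (suc s) true ∷ []
  pick false = here refl
  pick true  = there (here refl)

unique-sucs : ∀ n → Unique (map suc (upTo n))
unique-sucs n = Unique.map⁺ suc-injective (Unique.upTo⁺ n)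

∈-sucs : ∀ n x → 1 ≤ x → x ≤ n → x ∈ map suc (upTo n)
∈-sucs n (suc x) h k = ∈-map⁺ suc (∈-upTo⁺ k)

-- Power series and the product of the factors 1 + q^(ηi).

sums : (ℕ → ℕ) → ℕ → ℕ
sums h zero    = 0
sums h (suc n) = h 0 + sums (h ∘ suc) n

sum-upTo : ∀ (h : ℕ → ℕ) n → sum (map h (upTo n)) ≡ sums h n
sum-upTo h n = trans (cong sum (map-applyUpTo id h n)) (go h n)
  where
  go : ∀ h n → sum (applyUpTo h n) ≡ sums h n
  go h zero    = refl
  go h (suc n) = cong (h 0 +_) (go (h ∘ suc) n)

sums-cong : ∀ {h h′ : ℕ → ℕ} n → (∀ i → i < n → h i ≡ h′ i) → sums h n ≡ sums h′ n
sums-cong zero    e = refl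
sums-cong (suc n) e = cong₂ _+_ (e 0 (s≤s z≤n)) (sums-cong n (λ i h → e (suc i) (s≤s h)))

sums-zero : ∀ {h : ℕ → ℕ} n → (∀ i → i < n → h i ≡ 0) → sums h n ≡ 0
sums-zero zero    e = refl
sums-zero (suc n) e = cong₂ _+_ (e 0 (s≤s z≤n)) (sums-zero n (λ i h → e (suc i) (s≤s h)))

sums-+ : ∀ (h h′ : ℕ → ℕ) n → sums (λ i → h i + h′ i) n ≡ sums h n + sums h′ n
sums-+ h h′ zero    = refl
sums-+ h h′ (suc n) = trans (cong (h 0 + h′ 0 +_) (sums-+ (h ∘ suc) (h′ ∘ suc) n))
  (solve 4 (λ a b c d → a :+ b :+ (c :+ d) := a :+ c :+ (b :+ d)) refl (h 0) (h′ 0) (sums (h ∘ suc) n)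
      (sums (h′ ∘ suc) n))

sums-split : ∀ (h : ℕ → ℕ) a b → sums h (a + b) ≡ sums h a + sums (λ i → h (a + i)) b
sums-split h zero    b = refl
sums-split h (suc a) b = trans (cong (h 0 +_) (sums-split (h ∘ suc) a b)) (sym (+-assoc (h 0) _ _))

≤ᵇ-true : ∀ {m n} → m ≤ n → (m ≤ᵇ n) ≡ true
≤ᵇ-true {m} {n} h with m ≤ᵇ n | ≤⇒≤ᵇ h
... | true | _ = refl

≤ᵇ-false : ∀ {m n} → n < m → (m ≤ᵇ n) ≡ false
≤ᵇ-false {m} {n} h with m ≤ᵇ n in e
... | false = refl
... | true  = ⊥-elim (<-irrefl refl (≤-trans h (≤ᵇ⇒≤ m n (subst isTrue (sym e) tt))))

conv : (ℕ → ℕ) → (ℕ → ℕ) → ℕ → ℕ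
conv f g n = sums (λ m → f m * g (n ∸ m)) (suc n)

⊛-conv : ∀ f g n → (f ⊛ g) n ≡ conv f g n
⊛-conv f g n = sum-upTo _ (suc n)

shift : ℕ → (ℕ → ℕ) → ℕ → ℕ
shift c f n = if c ≤ᵇ n then f (n ∸ c) else 0

conv-shift : ∀ c f g n → conv (λ m → f m + shift c f m) g n ≡ conv f g n + shift c (conv f g) n
conv-shift c f g n = begin
  conv (λ m → f m + shift c f m) g
      n   ≡⟨ sums-cong (suc n) (λ i _ → *-distribʳ-+ (g (n ∸ i)) (f i) (shift c f i)) ⟩
  sums (λ m → f m * g (n ∸ m) + shift c f m * g (n ∸ m)) (suc n)
      ≡⟨ sums-+ (λ m → f m * g (n ∸ m)) (λ m → shift c f m * g (n ∸ m)) (suc n) ⟩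
  conv f g n + conv (shift c f) g n    ≡⟨ cong (conv f g n +_) shifted ⟩
  conv f g n + shift c (conv f g) n    ∎
  where
  open ≡-Reasoning
  shifted : conv (shift c f) g n ≡ shift c (conv f g) n
  shifted with c ≤? n
  ... | no ¬h rewrite ≤ᵇ-false (≰⇒> ¬h) =
      sums-zero (suc n) (λ i i<n → cong (λ b → (if b then f (i ∸ c) else 0) * g (n ∸ i))
      (≤ᵇ-false (≤-trans i<n (≰⇒> ¬h))))
  ... | yes h rewrite ≤ᵇ-true h = begin
    conv (shift c f) g n ≡⟨ cong (sums (λ m → shift c f m * g (n ∸ m)))
        (sym (trans (+-suc c (n ∸ c)) (cong suc (m+[n∸m]≡n h)))) ⟩
    sums (λ m → shift c f m * g (n ∸ m)) (c + suc (n ∸ c)) ≡⟨ sums-split _ c (suc (n ∸ c)) ⟩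
    sums (λ m → shift c f m * g (n ∸ m)) c + sums (λ i → shift c f (c + i) * g (n ∸ (c + i))) (suc (n ∸ c))
      ≡⟨ cong₂ _+_ (sums-zero c (λ i i<c →
          cong (λ b → (if b then f (i ∸ c) else 0) * g (n ∸ i)) (≤ᵇ-false i<c)))
                   (sums-cong (suc (n ∸ c)) (λ i _ →
                       cong₂ _*_ (trans (cong (λ b → if b then f (c + i ∸ c) else 0) (≤ᵇ-true (m≤m+n c i)))
                       (cong f (m+n∸m≡n c i))) (cong g (sym (∸-+-assoc n c i))))) ⟩
    conv f g (n ∸ c) ∎

-- A factor 1 + q^(ηi) with i > m has its nonconstant term in degree ηi > m, as η ≥ 1.
finProd-stable : ∀ η .{{_ : NonZero η}} d m → finProd η (d + m) m ≡ finProd η m m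
finProd-stable η zero    m = refl
finProd-stable η (suc d) m rewrite ≤ᵇ-false {η * suc (d + m)} {m}
    (≤-trans (s≤s (m≤n+m m d)) (m≤n*m (suc (d + m)) η)) =
  trans (+-identityʳ _) (finProd-stable η d m)

-- The recurrence multiplies the generating function of `C N` by 1 + q^(η(N+1)). Its diagonal is the
-- limit, since the later factors do not reach degree n.
product-series : ∀ η .{{_ : NonZero η}} (C : ℕ → ℕ → ℕ) →
  (∀ N n → C (suc N) n ≡ C N n + shift (η * suc N) (C N) n) → ∀ n → C n n ≡ (negqProd η ⊛ C 0) n
product-series η C rec n = begin
  C n n                         ≡⟨ partial n n ⟩
  conv (finProd η n) (C 0) n    ≡⟨ sums-cong (suc n) (λ i i<n →
      cong (_* C 0 (n ∸ i)) (trans (cong (λ k → finProd η k i) (sym (m∸n+n≡m (s≤s⁻¹ i<n))))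
      (finProd-stable η (n ∸ i) i))) ⟩
  conv (negqProd η) (C 0) n     ≡⟨ sym (⊛-conv (negqProd η) (C 0) n) ⟩
  (negqProd η ⊛ C 0) n          ∎
  where
  open ≡-Reasoning
  partial : ∀ N n → C N n ≡ conv (finProd η N) (C 0) n
  partial zero    n = sym (trans (cong (C 0 n + 0 +_) (sums-zero n (λ i _ → refl)))
      (trans (+-identityʳ _) (+-identityʳ _)))
  partial (suc N) n = begin
    C (suc N) n                                              ≡⟨ rec N n ⟩
    C N n + shift (η * suc N) (C N)
        n                        ≡⟨ cong₂ _+_ (partial N n)
        (cong (λ v → if η * suc N ≤ᵇ n then v else 0) (partial N (n ∸ η * suc N))) ⟩
    conv (finProd η N) (C 0) n + shift (η * suc N) (conv (finProd η N) (C 0)) n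
        ≡⟨ sym (conv-shift (η * suc N) (finProd η N) (C 0) n) ⟩
    conv (finProd η (suc N)) (C 0) n                         ∎

-- Boolean tests and propositions.

isTrue⇒ : ∀ {b} → isTrue b → b ≡ true
isTrue⇒ {true} _ = refl

⇒isTrue : ∀ {b} → b ≡ true → isTrue b
⇒isTrue refl = tt

∧-true⁻ : ∀ a {b} → a ∧ b ≡ true → a ≡ true × b ≡ true
∧-true⁻ true e = refl , e

∧-true⁺ : ∀ {a b} → a ≡ true → b ≡ true → a ∧ b ≡ true
∧-true⁺ refl e = e

∨-true⁻ : ∀ a {b} → a ∨ b ≡ true → a ≡ true ⊎ b ≡ true
∨-true⁻ true  e = inj₁ refl
∨-true⁻ false e = inj₂ e

∨-true⁺ʳ : ∀ a {b} → b ≡ true → a ∨ b ≡ true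
∨-true⁺ʳ true  e = refl
∨-true⁺ʳ false e = e

≤ᵇ⁻ : ∀ m n → (m ≤ᵇ n) ≡ true → m ≤ n
≤ᵇ⁻ m n e = ≤ᵇ⇒≤ m n (⇒isTrue e)

<ᵇ⁻ : ∀ m n → (m <ᵇ n) ≡ true → m < n
<ᵇ⁻ m n e = <ᵇ⇒< m n (⇒isTrue e)

<ᵇ⁺ : ∀ {m n} → m < n → (m <ᵇ n) ≡ true
<ᵇ⁺ h = isTrue⇒ (<⇒<ᵇ h)

≡ᵇ⁻ : ∀ m n → (m ≡ᵇ n) ≡ true → m ≡ n
≡ᵇ⁻ m n e = ≡ᵇ⇒≡ m n (⇒isTrue e)

≡ᵇ⁺ : ∀ {m n} → m ≡ n → (m ≡ᵇ n) ≡ true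
≡ᵇ⁺ {m} {n} e = isTrue⇒ (≡⇒≡ᵇ m n e)

all⁻ : {X : Set} (p : X → Bool) → ∀ xs → all p xs ≡ true → All (λ x → p x ≡ true) xs
all⁻ p []       e = []
all⁻ p (x ∷ xs) e with ∧-true⁻ (p x) e
... | a , b = a ∷ all⁻ p xs b

all⁺ : {X : Set} (p : X → Bool) → ∀ xs → All (λ x → p x ≡ true) xs → all p xs ≡ true
all⁺ p []       []      = refl
all⁺ p (x ∷ xs) (h ∷ a) = ∧-true⁺ h (all⁺ p xs a)

any-≡⁻ : ∀ m xs → any (λ a → m ≡ᵇ a) xs ≡ true → m ∈ xs
any-≡⁻ m (x ∷ xs) e with ∨-true⁻ (m ≡ᵇ x) e
... | inj₁ h = here (≡ᵇ⁻ m x h)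
... | inj₂ h = there (any-≡⁻ m xs h)

any-≡⁺ : ∀ m xs → m ∈ xs → any (λ a → m ≡ᵇ a) xs ≡ true
any-≡⁺ m (x ∷ xs) (here refl) rewrite ≡ᵇ⁺ {m} {m} refl = refl
any-≡⁺ m (x ∷ xs) (there h) = ∨-true⁺ʳ (m ≡ᵇ x) (any-≡⁺ m xs h)

half-≤ : ∀ a b → 2 * a ≤ 2 * b + 1 → a ≤ b
half-≤ a b h = s≤s⁻¹ (*-cancelˡ-< 2 a (suc b)
    (≤-trans (s≤s h) (≤-reflexive (solve 1 (λ b →
    con 1 :+ (b :+ (b :+ con 0) :+ con 1) := con 1 :+ b :+ (con 1 :+ b :+ con 0)) refl b))))

overs : List Part → List Part
overs []       = []
overs (x ∷ xs) = if over x then x ∷ overs xs else overs xs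

-- The anonymous filter inside isOverpartitionᵇ, captured by unification.
overpartition-spec : Σ (ℕ → Part → List Part → List Part) λ f →
  (∀ n x xs → isOverpartitionᵇ n (x ∷ xs) ≡ (all (λ x → 1 ≤ᵇ size x) (x ∷ xs)
    ∧ adjacentᵇ (λ x y → y ≤ₚ x) (x ∷ xs)
    ∧ distinctᵇ (map size (if over x then x ∷ f n x xs else f n x xs))
    ∧ (sum (map size (x ∷ xs)) ≡ᵇ n)))
  × (∀ n x → f n x [] ≡ [])
  × (∀ n x y ys → f n x (y ∷ ys) ≡ (if over y then y ∷ f n x ys else f n x ys))
overpartition-spec = _ , (λ n x xs → refl) , (λ n x → refl) , λ n x y ys → refl

overpartition≡ : ∀ n π → isOverpartitionᵇ n π ≡ (all (λ x → 1 ≤ᵇ size x) π ∧ adjacentᵇ (λ x y → y ≤ₚ x) π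
                 ∧ distinctᵇ (map size (overs π)) ∧ (sum (map size π) ≡ᵇ n))
overpartition≡ n []       = refl
overpartition≡ n (x ∷ xs) with overpartition-spec
... | f , e , e[] , e∷ = trans (e n x xs)
    (cong (λ l → all (λ x → 1 ≤ᵇ size x) (x ∷ xs) ∧ adjacentᵇ (λ x y → y ≤ₚ x) (x ∷ xs)
    ∧ distinctᵇ (map size (if over x then x ∷ l else l)) ∧ (sum (map size (x ∷ xs)) ≡ᵇ n)) (go xs))
  where
  go : ∀ ys → f n x ys ≡ overs ys
  go []       = e[] n x
  go (y ∷ ys) = trans (e∷ n x y ys) (cong (λ l → if over y then y ∷ l else l) (go ys))

-- The order of parts and the gap condition, with q = k - 2.

module Blocks (η : ℕ) .{{η≢0 : NonZero η}} (q : ℕ) where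

  ov pl : Part → ℕ
  ov x = if over x then 1 else 0
  pl x = if over x then 0 else 1

  pl+ov : ∀ x → pl x + ov x ≡ 1
  pl+ov (part _ false) = refl
  pl+ov (part _ true)  = refl

  ov≤1 : ∀ x → ov x ≤ 1
  ov≤1 (part _ false) = z≤n
  ov≤1 (part _ true)  = ≤-refl

  pl≤1 : ∀ x → pl x ≤ 1
  pl≤1 (part _ false) = ≤-refl
  pl≤1 (part _ true)  = z≤n

  1≤η : 1 ≤ η
  1≤η = >-nonZero⁻¹ η

  infix 4 _≽_

  -- x ≥ y in the order of parts, and x, y are not the same overlined part.
  _≽_ : Part → Part → Set
  x ≽ y = size y + ov y ≤ size x

  ≽⇒≥ : ∀ x y → x ≽ y → size y ≤ size x
  ≽⇒≥ x y = m+n≤o⇒m≤o (size y)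

  ≽-trans : ∀ {x y z} → x ≽ y → y ≽ z → x ≽ z
  ≽-trans {x} {y} p r = ≤-trans r (≽⇒≥ x y p)

  -- Condition (3) for parts x, y at distance k − 1; a band is a run of k − 1 parts
  -- whose first and last part violate Gap.
  Gap : Part → Part → Set
  Gap x y = size y + η + pl x ≤ size x

  gap? : ∀ x y → Dec (Gap x y)
  gap? x y = _ ≤? _

  up down : Part → Part
  up x = x +ₚ η
  down x = part (size x ∸ η) (over x)

  -- Since pl x + ov x = 1, the negation of `Gap x y` is the inequality `up y ≽ x`. So a run is a
  -- band exactly when its last part, raised by η, may be put in front of it; this is why a band can
  -- be moved at all.
  ¬gap⇒up : ∀ x y → ¬ Gap x y → up y ≽ x
  ¬gap⇒up (part s false) y h = subst (_≤ _) (sym (+-identityʳ s))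
    (s≤s⁻¹ (subst (s <_) (+-comm _ 1) (≰⇒> h)))
  ¬gap⇒up (part s true) y h = subst₂ _≤_ (+-comm 1 s) (+-identityʳ _) (≰⇒> h)

  -- Exactly one of pl x and ov x is 1, so one of the two bounds on x is strict, whichever kind of
  -- part x is.
  gap-squeeze : ∀ x {y z} → y + η + pl x ≤ size x → size x + ov x ≤ z + η → suc y ≤ z
  gap-squeeze x {y} {z} p r = +-cancelʳ-≤ η (suc y) z (begin
    suc y + η             ≡⟨ solve 2 (λ y n → con 1 :+ y :+ n := y :+ n :+ con 1) refl y η ⟩
    y + η + 1             ≡⟨ cong (y + η +_) (sym (pl+ov x)) ⟩
    y + η + (pl x + ov x) ≡⟨ sym (+-assoc (y + η) _ _) ⟩
    y + η + pl x + ov x   ≤⟨ +-monoˡ-≤ (ov x) p ⟩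
    size x + ov x         ≤⟨ r ⟩
    z + η                 ∎)
    where open ≤-Reasoning

  up⇒¬gap : ∀ x y → up y ≽ x → ¬ Gap x y
  up⇒¬gap x y p g = <-irrefl refl (gap-squeeze x g p)

  -- For k = 2 every part is a band by itself; this excludes single segments when q = 0.
  ¬gap-self : ∀ x → ¬ Gap x x
  ¬gap-self x g = <-irrefl refl (≤-trans (≤-trans (m<m+n (size x) 1≤η) (m≤m+n _ (pl x))) g)

  -- `Gap x y` depends on y only through its size and survives when y shrinks. Two lists can
  -- therefore be compared through such predicates alone.
  Anti : (Part → Set) → Set
  Anti P = ∀ {y y′} → size y′ ≤ size y → P y → P y′

  gap-anti : ∀ x → Anti (Gap x)
  gap-anti x {y} {y′} p = ≤-trans (+-monoˡ-≤ (pl x) (+-monoˡ-≤ η p))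

  gap⇒+η≤ : ∀ x y → Gap x y → size y + η ≤ size x
  gap⇒+η≤ x y = m+n≤o⇒m≤o (size y + η)

  at : {A : Set} → ℕ → List A → (A → Set) → Set
  at _       []       P = ⊤
  at zero    (x ∷ xs) P = P x
  at (suc i) (x ∷ xs) P = at i xs P

  at-map : {A : Set} {P R : A → Set} → ∀ i xs → (∀ {x} → P x → R x) → at i xs P → at i xs R
  at-map i       []       f _ = tt
  at-map zero    (x ∷ xs) f p = f p
  at-map (suc i) (x ∷ xs) f p = at-map i xs f p

  at→ : {A : Set} {P : A → Set} → ∀ as {xs} i {n} → length as + i ≡ n → at n (as ++ xs) P → at i xs P
  at→ []       i refl p = p
  at→ (a ∷ as) i refl p = at→ as i refl p

  at← : {A : Set} {P : A → Set} → ∀ as {xs} i {n} → length as + i ≡ n → at i xs P → at n (as ++ xs) P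
  at← []       i refl p = p
  at← (a ∷ as) i refl p = at← as i refl p

  last : Part → List Part → Part
  last x []       = x
  last x (y ∷ ys) = last y ys

  at-last : {P : Part → Set} → ∀ x as {R} → at (length as) (x ∷ as ++ R) P → P (last x as)
  at-last x []       p = p
  at-last x (a ∷ as) p = at-last a as p

  last-at : {P : Part → Set} → ∀ x as {R} → P (last x as) → at (length as) (x ∷ as ++ R) P
  last-at x []       p = p
  last-at x (a ∷ as) p = last-at a as p

  -- Distance k - 1 = q + 1 from x is index q in the tail.
  W : List Part → Set
  W []       = ⊤
  W (x ∷ xs) = at 0 xs (x ≽_) × at q xs (Gap x) × W xs

  Chain : List Part → Set
  Chain []       = ⊤
  Chain (x ∷ xs) = at 0 xs (x ≽_) × Chain xs

  W-++ʳ : ∀ xs {ys} → W (xs ++ ys) → W ys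
  W-++ʳ []       w = w
  W-++ʳ (x ∷ xs) w = W-++ʳ xs (proj₂ (proj₂ w))

  W-last : ∀ x as {z R} → W (x ∷ as ++ z ∷ R) → last x as ≽ z
  W-last x []       w = proj₁ w
  W-last x (a ∷ as) w = W-last a as (proj₂ (proj₂ w))

  -- A segmentation cuts a list into single parts and blocks.  In blk b as the
  -- part b is the moved one: the block reads as ++ [ down b ] before and b ∷ as
  -- after the move.
  data Seg : Set where
    one : Part → Seg
    blk : Part → List Part → Seg

  rotT flatT : List Seg → List Part → List Part
  rotT []             τ = τ
  rotT (one x ∷ S)    τ = x ∷ rotT S τ
  rotT (blk b as ∷ S) τ = b ∷ as ++ rotT S τ

  flatT []             φ = φ
  flatT (one x ∷ S)    φ = x ∷ flatT S φ
  flatT (blk b as ∷ S) φ = as ++ down b ∷ flatT S φ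

  #blk : List Seg → ℕ
  #blk []             = 0
  #blk (one _ ∷ S)    = #blk S
  #blk (blk _ _ ∷ S)  = suc (#blk S)

  -- The band condition in the form of `¬gap⇒up`, with b the raised last part; for q = 0 the first
  -- part of the band is `down b` itself.
  TopBand : List Part → Part → Set
  TopBand as b = at 0 (as ++ down b ∷ []) (b ≽_)

  -- Top-greedy segmentations of the list before the move.
  Top : List Seg → List Part → Set
  Top []             φ = ⊤
  Top (one x ∷ S)    φ = at q (x ∷ flatT S φ) (Gap x) × Top S φ
  Top (blk b as ∷ S) φ = length as ≡ q × η ≤ size b × TopBand as b × Top S φ

  Big : ℕ → List Seg → Set
  Big B []             = ⊤
  Big B (one x ∷ S)    = B < size x × Big B S
  Big B (blk b as ∷ S) = B < size (down b) × Big B S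

  -- Moving bands: validity after the move.

  -- Whether a part is put between the moved segments and the rest. Of its size the move uses only
  -- the bound B, which `Big B` places below all segments.
  data Mode (B : ℕ) : List Part → List Part → Set where
    same : ∀ {φ} → Mode B φ φ
    ins  : ∀ {o φ} → size o ≤ B → Mode B φ (o ∷ φ)

  -- Says that the part of ρ at index i + 1 is no larger than the part of φ at index i. The
  -- quantifier over predicates also covers absent parts: if φ ends before index i, the false
  -- predicate shows that ρ ends before index i + 1.
  Dom : List Part → List Part → Set₁
  Dom φ ρ = ∀ i (P : Part → Set) → Anti P → at i φ P → at (suc i) ρ P

  dom-same : ∀ φ → W φ → Dom φ φ
  dom-same []          w i       P anti p = tt
  dom-same (x ∷ φ)     w zero    P anti p = at-map 0 φ (λ {y} h → anti (≽⇒≥ x y h) p) (proj₁ w)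
  dom-same (x ∷ φ)     w (suc i) P anti p = dom-same φ (proj₂ (proj₂ w)) i P anti p

  dom-mode : ∀ {B φ τ} → Mode B φ τ → W τ → Dom φ τ
  dom-mode same    w = dom-same _ w
  dom-mode (ins _) w = λ i P anti p → p

  down+η : ∀ b → η ≤ size b → size (down b) + η ≡ size b
  down+η b h = m∸n+n≡m h

  -- The part below the block is at distance k - 1 from the first part a, so a has a gap to it,
  -- while b ≽ a because the block is a band.
  next-small : ∀ as b {φ} → length as ≡ q → η ≤ size b → TopBand as b → W (as ++ down b ∷ φ) →
               at 0 φ (λ y → suc (size y) ≤ size (down b))
  next-small [] b {φ} refl η≤b tb w =
    at-map 0 φ (λ {y} g → ≤-trans (≤-trans (≤-reflexive (+-comm 1 (size y))) (+-monoʳ-≤ (size y) 1≤η))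
        (gap⇒+η≤ (down b) y g)) (proj₁ (proj₂ w))
  next-small (a ∷ as) b {φ} refl η≤b tb w =
    at-map 0 φ (λ g → gap-squeeze a g (≤-trans tb (≤-reflexive (sym (down+η b η≤b)))))
      (at→ as {down b ∷ φ} 1 (+-comm (length as) 1) (proj₁ (proj₂ w)))

  suc⇒+pl : ∀ b {y z} → suc y ≤ z → y + pl b ≤ z
  suc⇒+pl b {y} h = ≤-trans (+-monoʳ-≤ y (pl≤1 b)) (≤-trans (≤-reflexive (+-comm y 1)) h)

  head-blk : ∀ S b as {B φ τ} → Mode B φ τ → Top S φ → B < size (down b) →
             length as ≡ q → η ≤ size b → TopBand as b → W (as ++ down b ∷ flatT S φ) →
             at 0 (rotT S τ) (λ y → size y + pl b ≤ size (down b))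
  head-blk [] b as {φ = φ} same top big len η≤b tb w =
    at-map 0 φ (suc⇒+pl b) (next-small as b len η≤b tb w)
  head-blk [] b as (ins o≤B) top big len η≤b tb w = suc⇒+pl b (≤-trans (s≤s o≤B) big)
  head-blk (one c ∷ S) b as m top big len η≤b tb w = suc⇒+pl b (next-small as b len η≤b tb w)
  head-blk (blk b′ as′ ∷ S) b as {φ = φ} m (len′ , η≤b′ , _) big len η≤b tb w =
    subst (λ s → s + pl b ≤ size (down b)) (down+η b′ η≤b′)
      (at→ as′ {down b′ ∷ flatT S φ} 0 (trans (+-identityʳ _) len′) (proj₁ (proj₂ (W-++ʳ as w))))

  -- x and the front `as` are q + 1 parts that form no band, so x is at least η above the last of
  -- them, and that part stands directly above `down b`.
  gap-last⇒≽ : ∀ x b as {R} → length as ≡ q → η ≤ size b → at q (x ∷ as ++ R) (Gap x) →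
               W (as ++ down b ∷ R) → x ≽ b
  gap-last⇒≽ x b [] refl η≤b g w = ⊥-elim (¬gap-self x g)
  gap-last⇒≽ x b (a ∷ as) {R} refl η≤b g w = begin
    size b + ov b                 ≡⟨ cong (_+ ov b) (sym (down+η b η≤b)) ⟩
    size (down b) + η + ov b      ≡⟨ solve 3 (λ d n o → d :+ n :+ o := d :+ o :+ n) refl (size (down b)) η
        (ov b) ⟩
    size (down b) + ov b + η      ≤⟨ +-monoˡ-≤ η (W-last a as w) ⟩
    size (last a as) + η          ≤⟨ gap⇒+η≤ x (last a as) (at-last a as g) ⟩
    size x                        ∎
    where open ≤-Reasoning

  head-one : ∀ S x {B φ τ} → Mode B φ τ → Top S φ → B < size x → at q (x ∷ flatT S φ) (Gap x) →
             W (x ∷ flatT S φ) → at 0 (rotT S τ) (x ≽_)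
  head-one [] x same top big g w = proj₁ w
  head-one [] x (ins {o} o≤B) top big g w =
    ≤-trans (+-monoʳ-≤ (size o) (ov≤1 o))
        (≤-trans (≤-reflexive (+-comm (size o) 1)) (≤-trans (s≤s o≤B) big))
  head-one (one c ∷ S) x m top big g w = proj₁ w
  head-one (blk b as ∷ S) x {φ = φ} m (len , η≤b , _) big g w = gap-last⇒≽ x b as len η≤b
    (at-cut as len g) (proj₂ (proj₂ w))
    where
    at-cut : {P : Part → Set} → ∀ as {c R} → length as ≡ q → at q (x ∷ as ++ c ∷ R) P → at q (x ∷ as ++ R) P
    at-cut as refl p = last-at x as (at-last x as p)

  dom-blk : ∀ as {z φ ρ} → at 0 ρ (λ y → size y ≤ size z) → Dom φ ρ →
            ∀ i (P : Part → Set) → Anti P → at i (as ++ z ∷ φ) P → at i (as ++ ρ) P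
  dom-blk []       {ρ = ρ} h dom zero    P anti p = at-map 0 ρ (λ k → anti k p) h
  dom-blk []       h dom (suc i) P anti p = dom i P anti p
  dom-blk (a ∷ as) h dom zero    P anti p = p
  dom-blk (a ∷ as) h dom (suc i) P anti p = dom-blk as h dom i P anti p

  -- A window that starts in the front of the block reaches index j of φ before the move and index j
  -- + 1 of ρ after it, which is the shift controlled by `Dom`.
  W-inner : ∀ as j {z φ ρ} → length as + j ≡ q → at 0 ρ (λ y → size y + pl z ≤ size z) → Dom φ ρ →
            W ρ → W (as ++ z ∷ φ) → W (as ++ ρ)
  W-inner [] j e κ dom wρ w = wρ
  W-inner (a ∷ as) j {z} {φ} {ρ} e κ dom wρ (s , g , w) =
    hd as s , at← as {ρ} (suc j) e′
        (dom j (Gap a) (λ {y} {y′} → gap-anti a {y} {y′}) (at→ as {z ∷ φ} (suc j) e′ g)) ,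
        W-inner as (suc j) e′ κ dom wρ w
    where
    e′ : length as + suc j ≡ q
    e′ = trans (+-suc (length as) j) e
    open ≤-Reasoning
    hd : ∀ as → at 0 (as ++ z ∷ φ) (a ≽_) → at 0 (as ++ ρ) (a ≽_)
    hd (_ ∷ _) p = p
    hd [] p = at-map 0 ρ (λ {y} k → begin
      size y + ov y            ≤⟨ +-monoʳ-≤ (size y) (≤-trans (ov≤1 y) (≤-reflexive (sym (pl+ov z)))) ⟩
      size y + (pl z + ov z)   ≡⟨ sym (+-assoc (size y) _ _) ⟩
      size y + pl z + ov z     ≤⟨ +-monoˡ-≤ (ov z) k ⟩
      size z + ov z            ≤⟨ p ⟩
      size a                   ∎) κ

  -- A single part starts no band, so its gap holds already at distance q; this pays for the shift
  -- by one place that the moved blocks below it cause. Hence `Dom` has to be carried through the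
  -- induction.
  fwd : ∀ S {B φ τ} → Mode B φ τ → Top S φ → Big B S → W τ → W (flatT S φ) →
        W (rotT S τ) × Dom (flatT S φ) (rotT S τ)
  fwd [] m top big wτ w = wτ , dom-mode m wτ
  fwd (one x ∷ S) {φ = φ} {τ} m (g , top) (bx , big) wτ w with fwd S m top big wτ (proj₂ (proj₂ w))
  ... | wρ , dom = (hd , nb q g , wρ) , dom′
    where
    hd : at 0 (rotT S τ) (x ≽_)
    hd = head-one S x m top bx g w
    nb : ∀ n → at n (x ∷ flatT S φ) (Gap x) → at n (rotT S τ) (Gap x)
    nb zero    p = ⊥-elim (¬gap-self x p)
    nb (suc n) p = dom n (Gap x) (λ {y} {y′} → gap-anti x {y} {y′}) p
    dom′ : Dom (x ∷ flatT S φ) (x ∷ rotT S τ)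
    dom′ zero    P anti p = at-map 0 (rotT S τ) (λ {y} k → anti (≽⇒≥ x y k) p) hd
    dom′ (suc i) P anti p = dom i P anti p
  fwd (blk b as ∷ S) {φ = φ} {τ} m (len , η≤b , tb , top) (bz , big) wτ w
    with fwd S m top big wτ (proj₂ (proj₂ (W-++ʳ as w)))
  ... | wρ , dom = (hd as tb , at← as {rotT S τ} 0 (trans (+-identityʳ _) len)
      (at-map 0 (rotT S τ) (λ {y} → gp {y}) κ) , W-inner as 0 (trans (+-identityʳ _) len) κ dom wρ w) , dom′
    where
    κ : at 0 (rotT S τ) (λ y → size y + pl b ≤ size (down b))
    κ = head-blk S b as m top bz len η≤b tb w
    open ≤-Reasoning
    gp : ∀ {y} → size y + pl b ≤ size (down b) → Gap b y
    gp {y} k = begin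
      size y + η + pl b     ≡⟨ solve 3 (λ y n p → y :+ n :+ p := y :+ p :+ n) refl (size y) η (pl b) ⟩
      size y + pl b + η     ≤⟨ +-monoˡ-≤ η k ⟩
      size (down b) + η     ≡⟨ down+η b η≤b ⟩
      size b                ∎
    hd : ∀ as → TopBand as b → at 0 (as ++ rotT S τ) (b ≽_)
    hd (_ ∷ _) p = p
    hd [] p = at-map 0 (rotT S τ) (λ {y} k → begin
      size y + ov y         ≤⟨ +-mono-≤ (m+n≤o⇒m≤o (size y) k) (≤-trans (ov≤1 y) 1≤η) ⟩
      size (down b) + η     ≡⟨ down+η b η≤b ⟩
      size b                ∎) κ
    dom′ : Dom (as ++ down b ∷ flatT S φ) (b ∷ as ++ rotT S τ)
    dom′ = dom-blk as (at-map 0 (rotT S τ) (λ {y} → m+n≤o⇒m≤o (size y)) κ) dom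

  -- Segmentations found greedily from the bottom.

  atS : ℕ → List Seg → (Part → Set) → Set
  atS _       []             P = ⊤
  atS _       (blk _ _ ∷ S)  P = ⊤
  atS zero    (one x ∷ S)    P = P x
  atS (suc i) (one x ∷ S)    P = atS i S P

  atS→ : {P : Part → Set} → ∀ as {S} i {n} → length as + i ≡ n → atS n (map one as ++ S) P → atS i S P
  atS→ []       i refl p = p
  atS→ (a ∷ as) i refl p = atS→ as i refl p

  atS← : {P : Part → Set} → ∀ as {S} i {n} → length as + i ≡ n → atS i S P → atS n (map one as ++ S) P
  atS← []       i refl p = p
  atS← (a ∷ as) i refl p = atS← as i refl p

  Inner : List Part → List Seg → Set
  Inner []       S = ⊤
  Inner (a ∷ as) S = atS q (one a ∷ map one as ++ S) (Gap a) × Inner as S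

  -- Bottom-greedy segmentations of the list after the move: no run of singles,
  -- possibly starting inside a block, contains a band.
  BG : List Seg → Set
  BG []             = ⊤
  BG (one x ∷ S)    = atS q (one x ∷ S) (Gap x) × BG S
  BG (blk b as ∷ S) = length as ≡ q × up (last b as) ≽ b × Inner as S × BG S

  spanS : ℕ → List Seg → Maybe (List Part × List Seg)
  spanS zero    S             = just ([] , S)
  spanS (suc n) []            = nothing
  spanS (suc n) (blk _ _ ∷ S) = nothing
  spanS (suc n) (one x ∷ S) with spanS n S
  ... | nothing       = nothing
  ... | just (cs , R) = just (x ∷ cs , R)

  spanS-map : ∀ cs S → spanS (length cs) (map one cs ++ S) ≡ just (cs , S)
  spanS-map []       S = refl
  spanS-map (c ∷ cs) S rewrite spanS-map cs S = refl

  spanS-just : ∀ n S {cs R} → spanS n S ≡ just (cs , R) → S ≡ map one cs ++ R × length cs ≡ n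
  spanS-just zero    S             refl = refl , refl
  spanS-just (suc n) (one x ∷ S) e with spanS n S in e′
  spanS-just (suc n) (one x ∷ S) refl | just (cs , R) with spanS-just n S e′
  ... | refl , refl = refl , refl

  spanS-nothing : {P : Part → Set} → ∀ n x S → spanS n S ≡ nothing → atS n (one x ∷ S) P
  spanS-nothing (suc n) x []            e = tt
  spanS-nothing (suc n) x (blk _ _ ∷ S) e = tt
  spanS-nothing (suc n) x (one y ∷ S)   e with spanS n S in e′
  ... | nothing = spanS-nothing n y S e′

  atS-last : {P : Part → Set} → ∀ x as {S} → atS (length as) (one x ∷ map one as ++ S) P → P (last x as)
  atS-last x []       p = p
  atS-last x (a ∷ as) p = atS-last a as p

  last-atS : {P : Part → Set} → ∀ x as {S} → P (last x as) → atS (length as) (one x ∷ map one as ++ S) P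
  last-atS x []       p = p
  last-atS x (a ∷ as) p = last-atS a as p

  push : Part → List Seg → List Seg
  push x T with spanS q T
  ... | nothing       = one x ∷ T
  ... | just (cs , R) with gap? x (last x cs)
  ...   | yes _ = one x ∷ T
  ...   | no  _ = blk x cs ∷ R

  bseg : List Part → List Seg
  bseg []       = []
  bseg (x ∷ xs) = push x (bseg xs)

  BG-split : ∀ cs {R} → BG (map one cs ++ R) → Inner cs R × BG R
  BG-split []       bg = tt , bg
  BG-split (c ∷ cs) (g , bg) with BG-split cs bg
  ... | i , r = (g , i) , r

  push-BG : ∀ x T → BG T → BG (push x T)
  push-BG x T bg with spanS q T in e
  ... | nothing       = spanS-nothing q x T e , bg
  ... | just (cs , R) with spanS-just q T e
  ...   | refl , refl with gap? x (last x cs)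
  ...     | yes g = last-atS x cs g , bg
  ...     | no ¬g = refl , ¬gap⇒up x (last x cs) ¬g , BG-split cs bg

  bseg-BG : ∀ xs → BG (bseg xs)
  bseg-BG []       = tt
  bseg-BG (x ∷ xs) = push-BG x (bseg xs) (bseg-BG xs)

  rotT-map : ∀ cs R τ → rotT (map one cs ++ R) τ ≡ cs ++ rotT R τ
  rotT-map []       R τ = refl
  rotT-map (c ∷ cs) R τ = cong (c ∷_) (rotT-map cs R τ)

  push-rot : ∀ x T τ → rotT (push x T) τ ≡ x ∷ rotT T τ
  push-rot x T τ with spanS q T in e
  ... | nothing       = refl
  ... | just (cs , R) with spanS-just q T e
  ...   | refl , refl with gap? x (last x cs)
  ...     | yes g = refl
  ...     | no ¬g = cong (x ∷_) (sym (rotT-map cs R τ))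

  bseg-rot : ∀ xs τ → rotT (bseg xs) τ ≡ xs ++ τ
  bseg-rot []       τ = refl
  bseg-rot (x ∷ xs) τ = trans (push-rot x (bseg xs) τ) (cong (x ∷_) (bseg-rot xs τ))

  push-one : ∀ x T → atS q (one x ∷ T) (Gap x) → push x T ≡ one x ∷ T
  push-one x T g with spanS q T in e
  ... | nothing       = refl
  ... | just (cs , R) with spanS-just q T e
  ...   | refl , refl with gap? x (last x cs)
  ...     | yes _ = refl
  ...     | no ¬g = ⊥-elim (¬g (atS-last x cs g))

  push-blk : ∀ b as S → length as ≡ q → up (last b as) ≽ b → push b (map one as ++ S) ≡ blk b as ∷ S
  push-blk b as S refl band rewrite spanS-map as S with gap? b (last b as)
  ... | yes g = ⊥-elim (up⇒¬gap b (last b as) band g)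
  ... | no _  = refl

  bseg-Inner : ∀ as xs S → bseg xs ≡ S → Inner as S → bseg (as ++ xs) ≡ map one as ++ S
  bseg-Inner []       xs S e inn = e
  bseg-Inner (a ∷ as) xs S e (g , inn) rewrite bseg-Inner as xs S e inn = push-one a _ g

  -- A bottom-greedy segmentation is determined by its list, so the inverse can recover the moved
  -- blocks.
  BG-bseg : ∀ S R τ → BG (S ++ R) → bseg τ ≡ R → bseg (rotT S τ) ≡ S ++ R
  BG-bseg []             R τ bg e = e
  BG-bseg (one x ∷ S)    R τ (g , bg) e rewrite BG-bseg S R τ bg e = push-one x (S ++ R) g
  BG-bseg (blk b as ∷ S) R τ (len , band , inn , bg) e
    rewrite bseg-Inner as (rotT S τ) (S ++ R) (BG-bseg S R τ bg e) inn = push-blk b as (S ++ R) len band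

  -- Undoing the moves.

  at-pred : ∀ x φ → W (x ∷ φ) → ∀ i (P : Part → Set) → Anti P → at i (x ∷ φ) P → at i φ P
  at-pred x []      w i       P anti p = tt
  at-pred x (y ∷ φ) w zero    P anti p = anti (≽⇒≥ x y (proj₁ w)) p
  at-pred x (y ∷ φ) w (suc i) P anti p = at-pred y φ (proj₂ (proj₂ w)) i P anti p

  Below : List Part → List Part → Set₁
  Below ρ φ = ∀ i (P : Part → Set) → Anti P → at i ρ P → at i φ P

  -- The tails t ∷ τ (after the move) and φ (before it), with what the segments
  -- preceding them need.
  record Tails (t : Part) (τ φ : List Part) : Set₁ where
    field
      valid : W φ
      shiftAt : ∀ i (P : Part → Set) → i < q → at i τ P → at i φ P
      head≽ : at 0 φ (t ≽_)
      below : Below (t ∷ τ) φ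
      far   : at q φ (λ y → size y + η ≤ size t)

  ≽-down : ∀ b → η ≤ size b → b ≽ down b
  ≽-down b η≤b = ≤-trans (+-monoʳ-≤ (size (down b)) (≤-trans (ov≤1 b) 1≤η)) (≤-reflexive (down+η b η≤b))

  gap⇒κ : ∀ b y → Gap b y → size y + pl b ≤ size (down b)
  gap⇒κ b y g = m+n≤o⇒m≤o∸n (size y + pl b)
    (≤-trans (≤-reflexive (solve 3 (λ y n p → y :+ p :+ n := y :+ n :+ p) refl (size y) η (pl b))) g)

  at-rotT : ∀ S {t τ} {P : Part → Set} → at 0 (rotT S (t ∷ τ)) P → ∃ P
  at-rotT []            p = _ , p
  at-rotT (one x ∷ S)   p = _ , p
  at-rotT (blk b _ ∷ S) p = _ , p

  at-front : {P : Part → Set} → ∀ as {xs ys} i → i < length as → at i (as ++ xs) P → at i (as ++ ys) P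
  at-front (a ∷ as) zero    h       p = p
  at-front (a ∷ as) (suc i) (s≤s h) p = at-front as i h p

  -- If S does not start with i + 1 singles, then a moved block, or else `t`, has put one extra part
  -- in front, and index i + 1 after the move is index i before it. The bound i < q keeps the index
  -- within the front of that block.
  unshift : ∀ S {t τ φ} → Tails t τ φ → ∀ i (P : Part → Set) → BG S → i < q → atS i S P →
            at (suc i) (rotT S (t ∷ τ)) P → at i (flatT S φ) P
  unshift []             T i       P bg i<q a p = Tails.shiftAt T i P i<q p
  unshift (one x ∷ S)    T zero    P bg i<q a p = a
  unshift (one x ∷ S)    T (suc i) P bg i<q a p = unshift S T i P (proj₂ bg) (<-trans (n<1+n i) i<q) a p
  unshift (blk b as ∷ S) T i       P (refl , _) i<q a p = at-front as i i<q p

  below-blk : ∀ x as {z φ ρ} → W (x ∷ as ++ ρ) → size z ≤ size (last x as) → Below ρ φ →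
              Below (x ∷ as ++ ρ) (as ++ z ∷ φ)
  below-blk x []       w h bel zero    P anti p = anti h p
  below-blk x []       w h bel (suc i) P anti p = bel i P anti p
  below-blk x (a ∷ as) w h bel zero    P anti p = anti (≽⇒≥ x a (proj₁ w)) p
  below-blk x (a ∷ as) w h bel (suc i) P anti p = below-blk a as (proj₂ (proj₂ w)) h bel i P anti p

  InnerGap : List Part → List Part → Set
  InnerGap []       R = ⊤
  InnerGap (a ∷ as) R = at q (as ++ R) (Gap a) × InnerGap as R

  W-unrot : ∀ x as {z φ ρ} → W (x ∷ as ++ ρ) → last x as ≽ z → InnerGap as (z ∷ φ) → W (z ∷ φ) →
      W (as ++ z ∷ φ)
  W-unrot x []       w h ig wz = wz
  W-unrot x (a ∷ []) {z} w h (g , ig) wz = h , g , wz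
  W-unrot x (a ∷ a′ ∷ as) w h (g , ig) wz =
    proj₁ (proj₂ (proj₂ w)) , g , W-unrot a (a′ ∷ as) (proj₂ (proj₂ w)) h ig wz

  up≽⇒≽down : ∀ x b → η ≤ size b → up x ≽ b → x ≽ down b
  up≽⇒≽down x b η≤b h = +-cancelʳ-≤ η _ _ (≤-trans (≤-reflexive (trans
    (solve 3 (λ d o n → d :+ o :+ n := d :+ n :+ o) refl (size (down b)) (ov b) η)
    (cong (_+ ov b) (down+η b η≤b)))) h)

  topBand : ∀ b as {ρ} → η ≤ size b → W (b ∷ as ++ ρ) → TopBand as b
  topBand b []       η≤b w = ≽-down b η≤b
  topBand b (_ ∷ _)  η≤b w = proj₁ w

  record Back (S : List Seg) (t : Part) (τ φ : List Part) : Set₁ where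
    field
      valid : W (flatT S φ)
      top   : Top S φ
      below : Below (rotT S (t ∷ τ)) (flatT S φ)

  module _ {t : Part} {τ φ : List Part} (T : Tails t τ φ) where
    open Back

    η≤-blk : ∀ b as S → length as ≡ q → W (b ∷ as ++ rotT S (t ∷ τ)) → η ≤ size b
    η≤-blk b as S len w = m+n≤o⇒n≤o (size y) (gap⇒+η≤ b y g)
      where
      pr : ∃ (Gap b)
      pr = at-rotT S (at→ as {rotT S (t ∷ τ)} 0 (trans (+-identityʳ _) len) (proj₁ (proj₂ w)))
      y : Part
      y = proj₁ pr
      g : Gap b y
      g = proj₂ pr

    bwd-head : ∀ S x → BG S → W (x ∷ rotT S (t ∷ τ)) → at 0 (flatT S φ) (x ≽_)
    bwd-head [] x bg w = at-map 0 φ (λ {y} → ≽-trans {x} {t} {y} (proj₁ w)) (Tails.head≽ T)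
    bwd-head (one c ∷ S) x bg w = proj₁ w
    bwd-head (blk b [] ∷ S) x (len , _) w =
        ≽-trans {x} {b} {down b} (proj₁ w) (≽-down b (η≤-blk b [] S len (proj₂ (proj₂ w))))
    bwd-head (blk b (a ∷ as) ∷ S) x bg w = ≽-trans {x} {b} {a} (proj₁ w) (proj₁ (proj₂ (proj₂ w)))

    -- Serves to compare `down b` with the part at distance k - 1 below it, by way of the head u of
    -- the list after the move.
    bwd-far : ∀ S → BG S → W (rotT S (t ∷ τ)) → Top S φ →
        at 0 (rotT S (t ∷ τ)) (λ u → at q (flatT S φ) (λ y → size y + η ≤ size u))
    bwd-far [] bg w top = Tails.far T
    bwd-far (one c ∷ S) bg w (g , _) = at-map q (c ∷ flatT S φ) (λ {y} → gap⇒+η≤ c y) g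
    bwd-far (blk b as ∷ S) (len , _) w (_ , η≤b , _) =
      at← as {down b ∷ flatT S φ} 0 (trans (+-identityʳ _) len) (≤-reflexive (down+η b η≤b))

    bwd-z≽ : ∀ S b as → BG S → length as ≡ q → Inner as S → W (b ∷ as ++ rotT S (t ∷ τ)) → Top S φ →
        η ≤ size b →
             at 0 (rotT S (t ∷ τ)) (λ y → size y + pl b ≤ size (down b)) → at 0 (flatT S φ) (down b ≽_)
    bwd-z≽ [] b as bg len inn w top η≤b κ =
      at-map 0 φ (λ {y} h → ≤-trans h (m+n≤o⇒m≤o (size t) κ)) (Tails.head≽ T)
    bwd-z≽ (one c ∷ S) b [] (g , _) refl inn w top η≤b κ = ⊥-elim (¬gap-self c g)
    -- The run from a to c has q + 1 parts and is no band by bottom-greediness, so a has a gap to c;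
    -- with b ≽ a this puts c strictly below `down b`.
    bwd-z≽ (one c ∷ S) b (a ∷ as) bg refl (g , _) w top η≤b κ =
      ≤-trans (+-monoʳ-≤ (size c) (ov≤1 c)) (≤-trans (≤-reflexive (+-comm (size c) 1))
        (gap-squeeze a (atS→ as {one c ∷ S} 0 (+-identityʳ _) g)
            (≤-trans (proj₁ w) (≤-reflexive (sym (down+η b η≤b))))))
    bwd-z≽ (blk b′ [] ∷ S) b as bg len inn w (_ , η≤b′ , _) η≤b κ =
      ≤-trans (≽-down b′ η≤b′) (m+n≤o⇒m≤o (size b′) κ)
    bwd-z≽ (blk b′ (a ∷ as′) ∷ S) b as bg len inn w (_ , _ , tb , _) η≤b κ =
      ≤-trans tb (m+n≤o⇒m≤o (size b′) κ)

    bwd-inner : ∀ S as z j → BG S → length as + j ≡ q → Inner as S → W (as ++ rotT S (t ∷ τ)) →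
        InnerGap as (z ∷ flatT S φ)
    bwd-inner S []       z j bg e inn w = tt
    bwd-inner S (a ∷ as) z j bg e (g , inn) w =
      at← as {z ∷ flatT S φ} (suc j) e′
        (unshift S T j (Gap a) bg (subst (j <_) e (s≤s (m≤n+m j (length as))))
          (atS→ as j refl (subst (λ n → atS n (one a ∷ map one as ++ S) (Gap a)) (sym e) g))
          (at→ as {rotT S (t ∷ τ)} (suc j) e′ (proj₁ (proj₂ w)))) ,
      bwd-inner S as z (suc j) bg e′ inn (proj₂ (proj₂ w))
      where
      e′ : length as + suc j ≡ q
      e′ = trans (+-suc (length as) j) e

    -- `Below` takes the place of `Dom`: undoing moves raises no index, so the gaps of singles at
    -- distance q + 1 persist. Their gaps at distance q, needed for `Top`, come from `unshift`.
    bwd : ∀ S → BG S → W (rotT S (t ∷ τ)) → Back S t τ φ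
    bwd [] bg w .valid = Tails.valid T
    bwd [] bg w .top   = tt
    bwd [] bg w .below = Tails.below T
    bwd (one x ∷ S) (g , bg) w = record { valid =
        bwd-head S x bg w , below bk q (Gap x) (λ {y} {y′} → gap-anti x {y} {y′}) (proj₁ (proj₂ w)) ,
        valid bk ; top = nb q ≤-refl g (proj₁ (proj₂ w)) , top bk ; below = bel }
      where
      bk : Back S t τ φ
      bk = bwd S bg (proj₂ (proj₂ w))
      nb : ∀ n → n ≤ q → atS n (one x ∷ S) (Gap x) → at n (rotT S (t ∷ τ)) (Gap x) →
          at n (x ∷ flatT S φ) (Gap x)
      nb zero    h a p = a
      nb (suc n) h a p = unshift S T n (Gap x) bg h a p
      bel : Below (x ∷ rotT S (t ∷ τ)) (x ∷ flatT S φ)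
      bel zero    P anti p = p
      bel (suc i) P anti p = below bk i P anti p
    bwd (blk b as ∷ S) (len , band , inn , bg) w = record
      { valid = W-unrot b as w h (bwd-inner S as (down b) 0 bg (trans (+-identityʳ _) len) inn
          (proj₂ (proj₂ w)))
                  (bwd-z≽ S b as bg len inn w (top bk) η≤b κ , zgap , valid bk)
      ; top = len , η≤b , topBand b as η≤b w , top bk
      ; below = below-blk b as w (≽⇒≥ (last b as) (down b) h) (below bk) }
      where
      bk : Back S t τ φ
      bk = bwd S bg (W-++ʳ as (proj₂ (proj₂ w)))
      η≤b : η ≤ size b
      η≤b = η≤-blk b as S len w
      h : last b as ≽ down b
      h = up≽⇒≽down (last b as) b η≤b band
      κ : at 0 (rotT S (t ∷ τ)) (λ y → size y + pl b ≤ size (down b))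
      κ = at-map 0 (rotT S (t ∷ τ)) (λ {y} → gap⇒κ b y)
          (at→ as {rotT S (t ∷ τ)} 0 (trans (+-identityʳ _) len) (proj₁ (proj₂ w)))
      both : ∀ ρ {F : Part → Set} → at 0 ρ (λ y → size y + pl b ≤ size (down b)) → at 0 ρ F →
          at 0 ρ (λ y → size y + pl b ≤ size (down b) × F y)
      both []      _ _ = tt
      both (_ ∷ _) p r = p , r
      zgap : at q (flatT S φ) (Gap (down b))
      zgap with at-rotT S (both (rotT S (t ∷ τ)) κ (bwd-far S bg (W-++ʳ as (proj₂ (proj₂ w))) (top bk)))
      ... | u , k , f = at-map q (flatT S φ) (λ {y} e → ≤-trans (+-monoˡ-≤ (pl b) e) k) f

  tails-ins : ∀ o φ → W (o ∷ φ) → Tails o φ φ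
  tails-ins o φ w = record
    { valid = proj₂ (proj₂ w) ; shiftAt = λ i P _ p → p ; head≽ = proj₁ w ; below = at-pred o φ w
    ; far = at-map q φ (λ {y} → gap⇒+η≤ o y) (proj₁ (proj₂ w)) }

  -- Lets a block play the role of the inserted part: the blocks above it are undone with its raised
  -- part b as the separator.
  tails-blk : ∀ b as L → length as ≡ q → η ≤ size b → up (last b as) ≽ b → W (b ∷ as ++ L) →
              InnerGap as (down b ∷ L) → at q L (Gap (down b)) → at 0 L (down b ≽_) →
                  Tails b (as ++ L) (as ++ down b ∷ L)
  tails-blk b as L len η≤b band w ig g h = record
    { valid = W-unrot b as w l≽ ig (h , g , W-++ʳ as (proj₂ (proj₂ w)))
    ; shiftAt = λ i P i<q p → at-front as i (subst (i <_) (sym len) i<q) p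
    ; head≽ = hd as (topBand b as η≤b w)
    ; below = below-blk b as w (≽⇒≥ (last b as) (down b) l≽) (λ i P anti p → p)
    ; far = at← as {down b ∷ L} 0 (trans (+-identityʳ _) len) (≤-reflexive (down+η b η≤b)) }
    where
    l≽ : last b as ≽ down b
    l≽ = up≽⇒≽down (last b as) b η≤b band
    hd : ∀ as → TopBand as b → at 0 (as ++ down b ∷ L) (b ≽_)
    hd []      p = p
    hd (_ ∷ _) p = p

  -- Bands found greedily from the top.

  farBandᵇ : Part → Maybe Part → Bool
  farBandᵇ x nothing  = false
  farBandᵇ x (just y) with gap? x y
  ... | yes _ = false
  ... | no  _ = true

  bandᵇ : Part → List Part → Bool
  bandᵇ x xs = farBandᵇ x (nth (x ∷ xs) q)

  at-nth : {A : Set} {P : A → Set} → ∀ i xs → (∀ {y} → nth xs i ≡ just y → P y) → at i xs P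
  at-nth i       []       f = tt
  at-nth zero    (x ∷ xs) f = f refl
  at-nth (suc i) (x ∷ xs) f = at-nth i xs f

  nth-at : {A : Set} {P : A → Set} → ∀ i xs {y} → at i xs P → nth xs i ≡ just y → P y
  nth-at zero    (x ∷ xs) p refl = p
  nth-at (suc i) (x ∷ xs) p e    = nth-at i xs p e

  nth-split : {A : Set} → ∀ i (xs : List A) {y} → nth xs i ≡ just y →
              ∃[ as ] ∃[ R ] (xs ≡ as ++ y ∷ R × length as ≡ i)
  nth-split zero    (x ∷ xs) refl = [] , xs , refl , refl
  nth-split (suc i) (x ∷ xs) e with nth-split i xs e
  ... | as , R , refl , refl = x ∷ as , R , refl , refl

  nth-mid : {A : Set} → ∀ as {y : A} {R} → nth (as ++ y ∷ R) (length as) ≡ just y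
  nth-mid []       = refl
  nth-mid (a ∷ as) = nth-mid as

  nth-++ : {A : Set} → ∀ i (xs ys : List A) → i < length xs → nth (xs ++ ys) i ≡ nth xs i
  nth-++ zero    (x ∷ xs) ys h       = refl
  nth-++ (suc i) (x ∷ xs) ys (s≤s h) = nth-++ i xs ys h

  nth-just⇒< : {A : Set} → ∀ i (xs : List A) {y} → nth xs i ≡ just y → i < length xs
  nth-just⇒< zero    (x ∷ xs) e = s≤s z≤n
  nth-just⇒< (suc i) (x ∷ xs) e = s≤s (nth-just⇒< i xs e)

  gap⇒noband : ∀ x xs → at q (x ∷ xs) (Gap x) → bandᵇ x xs ≡ false
  gap⇒noband x xs g with nth (x ∷ xs) q in e
  ... | nothing = refl
  ... | just y with gap? x y
  ...   | yes _ = refl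
  ...   | no ¬g = ⊥-elim (¬g (nth-at q (x ∷ xs) g e))

  record BandAt (x : Part) (xs : List Part) : Set where
    constructor mkBand
    field
      front : List Part
      end   : Part
      rest  : List Part
      eq    : x ∷ xs ≡ front ++ end ∷ rest
      len   : length front ≡ q
      ¬gap  : ¬ Gap x end

  bandAt⇒band : ∀ x xs → BandAt x xs → bandᵇ x xs ≡ true
  bandAt⇒band x xs (mkBand as z R eq refl ¬g) rewrite eq | nth-mid as {z} {R} with gap? x z
  ... | yes g = ⊥-elim (¬g g)
  ... | no _  = refl

  data BandView (x : Part) (xs : List Part) : Bool → Set where
    noband : at q (x ∷ xs) (Gap x) → BandView x xs false
    band   : BandAt x xs → BandView x xs true

  bview : ∀ x xs → BandView x xs (bandᵇ x xs)
  bview x xs with nth (x ∷ xs) q in e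
  ... | nothing = noband (at-nth q (x ∷ xs) (λ e′ → ⊥-elim (nj (trans (sym e) e′))))
    where
    nj : ∀ {y : Part} → ¬ nothing ≡ just y
    nj ()
  ... | just y with gap? x y
  ...   | yes g = noband (at-nth q (x ∷ xs) (λ e′ → subst (Gap x) (ji (trans (sym e) e′)) g))
    where
    ji : ∀ {y z : Part} → just y ≡ just z → y ≡ z
    ji refl = refl
  ...   | no ¬g with nth-split q (x ∷ xs) e
  ...     | as , R , eq , len = band (mkBand as y R eq len ¬g)

  band⇒bandAt : ∀ x xs → bandᵇ x xs ≡ true → BandAt x xs
  band⇒bandAt x xs e with bandᵇ x xs | bview x xs
  band⇒bandAt x xs refl | .true | band b = b

  band-len : ∀ x xs → BandAt x xs → q ≤ length xs
  band-len x xs (mkBand [] z R eq refl ¬g) = z≤n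
  band-len x xs (mkBand (a ∷ as) z R refl refl ¬g) =
    subst (suc (length as) ≤_) (sym (length-++ as))
        (≤-trans (≤-reflexive (+-comm 1 _)) (+-monoʳ-≤ (length as) (s≤s z≤n)))

  bandAt-++ : ∀ x xs ys → BandAt x xs → BandAt x (xs ++ ys)
  bandAt-++ x xs ys (mkBand as z R eq len ¬g) =
    mkBand as z (R ++ ys) (trans (cong (_++ ys) eq) (++-assoc as (z ∷ R) ys)) len ¬g

  band-++ : ∀ x xs ys → q ≤ length xs → bandᵇ x (xs ++ ys) ≡ bandᵇ x xs
  band-++ x xs ys h = cong (farBandᵇ x) (nth-++ q (x ∷ xs) ys (s≤s h))

  -- The number of disjoint bands found greedily from the top, after skipping s parts.
  T : ℕ → List Part → ℕ
  T s       []       = 0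
  T (suc s) (x ∷ xs) = T s xs
  T zero    (x ∷ xs) = if bandᵇ x xs then suc (T q xs) else T 0 xs

  -- What is left below the first N of these bands.
  tl : ℕ → ℕ → List Part → List Part
  tl N       s       []       = []
  tl N       (suc s) (x ∷ xs) = tl N s xs
  tl zero    zero    (x ∷ xs) = x ∷ xs
  tl (suc N) zero    (x ∷ xs) = if bandᵇ x xs then tl N q xs else tl (suc N) 0 xs

  T-noband : ∀ x xs → at q (x ∷ xs) (Gap x) → T 0 (x ∷ xs) ≡ T 0 xs
  T-noband x xs g rewrite gap⇒noband x xs g = refl

  tl-noband : ∀ N x xs → at q (x ∷ xs) (Gap x) → tl (suc N) 0 (x ∷ xs) ≡ tl (suc N) 0 xs
  tl-noband N x xs g rewrite gap⇒noband x xs g = refl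

  T-skip : ∀ as s {R} → T (length as + s) (as ++ R) ≡ T s R
  T-skip []       s = refl
  T-skip (a ∷ as) s = T-skip as s

  tl-skip : ∀ N as s {R} → tl N (length as + s) (as ++ R) ≡ tl N s R
  tl-skip N []       s = refl
  tl-skip N (a ∷ as) s = tl-skip N as s

  HeadBand : List Part → Part → Set
  HeadBand as z = at 0 (as ++ z ∷ []) (λ x → ¬ Gap x z)

  T-band : ∀ as z R → length as ≡ q → HeadBand as z → T 0 (as ++ z ∷ R) ≡ suc (T 0 R)
  T-band [] z R refl hb rewrite bandAt⇒band z R (mkBand [] z R refl refl hb) = refl
  T-band (a ∷ as) z R refl hb rewrite bandAt⇒band a (as ++ z ∷ R) (mkBand (a ∷ as) z R refl refl hb) =
    cong suc (trans (cong (λ n → T n (as ++ z ∷ R)) (+-comm 1 (length as))) (T-skip as 1))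

  tl-band : ∀ N as z R → length as ≡ q → HeadBand as z → tl (suc N) 0 (as ++ z ∷ R) ≡ tl N 0 R
  tl-band N [] z R refl hb rewrite bandAt⇒band z R (mkBand [] z R refl refl hb) = refl
  tl-band N (a ∷ as) z R refl hb rewrite bandAt⇒band a (as ++ z ∷ R) (mkBand (a ∷ as) z R refl refl hb) =
    trans (cong (λ n → tl N n (as ++ z ∷ R)) (+-comm 1 (length as))) (tl-skip N as 1)

  topBand⇒headBand : ∀ as b → η ≤ size b → TopBand as b → HeadBand as (down b)
  topBand⇒headBand as b η≤b tb = at-map 0 (as ++ down b ∷ [])
    (λ {a} h → up⇒¬gap a (down b) (≤-trans h (≤-reflexive (sym (down+η b η≤b))))) tb

  T-top : ∀ S φ → Top S φ → T 0 (flatT S φ) ≡ #blk S + T 0 φ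
  T-top [] φ top = refl
  T-top (one x ∷ S) φ (g , top) = trans (T-noband x _ g) (T-top S φ top)
  T-top (blk b as ∷ S) φ (len , η≤b , tb , top) =
    trans (T-band as (down b) _ len (topBand⇒headBand as b η≤b tb)) (cong suc (T-top S φ top))

  -- Proved together with `T-bounded-drop`: a later start never helps the search, and a delay of at
  -- most q + 1 parts costs at most one band, as a band has q + 1 parts.
  T-antitone-suc : ∀ s xs → T (suc s) xs ≤ T s xs
  T-bounded-drop : ∀ j xs → j ≤ suc q → T 0 xs ≤ suc (T j xs)
  T-antitone : ∀ d s xs → T (d + s) xs ≤ T s xs

  T-antitone zero    s xs = ≤-refl
  T-antitone (suc d) s xs = ≤-trans (T-antitone-suc (d + s) xs) (T-antitone d s xs)

  T-antitone-suc s       []       = z≤n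
  T-antitone-suc (suc s) (x ∷ xs) = T-antitone-suc s xs
  T-antitone-suc zero    (x ∷ xs) with bandᵇ x xs
  ... | true  = T-bounded-drop q xs (n≤1+n q)
  ... | false = ≤-refl

  T-bounded-drop zero    xs       h = n≤1+n _
  T-bounded-drop (suc j) []       h = z≤n
  T-bounded-drop (suc j) (x ∷ xs) (s≤s h) with bandᵇ x xs
  ... | true  = s≤s (subst (λ n → T n xs ≤ T j xs) (m∸n+n≡m h) (T-antitone (q ∸ j) j xs))
  ... | false = T-bounded-drop j xs (≤-trans h (n≤1+n q))

  -- The number of blocks of S that start at list position s or later.
  cnt : ℕ → List Seg → ℕ
  cnt zero    S              = #blk S
  cnt (suc s) []             = 0
  cnt (suc s) (one x ∷ S)    = cnt s S
  cnt (suc s) (blk b as ∷ S) = cnt (s ∸ q) S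

  cnt-0 : ∀ S → cnt 0 S ≡ #blk S
  cnt-0 []            = refl
  cnt-0 (one _ ∷ _)   = refl
  cnt-0 (blk _ _ ∷ _) = refl

  cnt≤#blk : ∀ s S → cnt s S ≤ #blk S
  cnt≤#blk zero    S              = ≤-refl
  cnt≤#blk (suc s) []             = z≤n
  cnt≤#blk (suc s) (one x ∷ S)    = cnt≤#blk s S
  cnt≤#blk (suc s) (blk b as ∷ S) = ≤-trans (cnt≤#blk (s ∸ q) S) (n≤1+n _)

  cnt-map : ∀ as s S → cnt s (map one as ++ S) ≡ cnt (s ∸ length as) S
  cnt-map []       s       S = refl
  cnt-map (a ∷ as) zero    S = trans (sym (cnt-0 (map one as ++ S)))
      (trans (cnt-map as 0 S) (cong (λ n → cnt n S) (0∸n≡0 (length as))))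
  cnt-map (a ∷ as) (suc s) S = cnt-map as s S

  -- By bottom-greediness a band that starts at x cannot consist of singles only. Some block starts
  -- within it, and skipping the band loses this block.
  cnt<#blk : ∀ {P : Part → Set} n x S → atS n (one x ∷ S) P → ¬ at n (x ∷ rotT S []) P →
      suc (cnt n S) ≤ #blk S
  cnt<#blk zero    x S              a ¬p = ⊥-elim (¬p a)
  cnt<#blk (suc n) x []             a ¬p = ⊥-elim (¬p tt)
  cnt<#blk (suc n) x (one y ∷ S)    a ¬p = cnt<#blk n y S a ¬p
  cnt<#blk (suc n) x (blk b as ∷ S) a ¬p = s≤s (cnt≤#blk (n ∸ q) S)

  T≤-one : ∀ x S → atS q (one x ∷ S) (Gap x) → (∀ s → T s (rotT S []) ≤ cnt s S) →
           ∀ s → T s (x ∷ rotT S []) ≤ cnt s (one x ∷ S)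
  T≤-one x S g ih (suc s) = ih s
  T≤-one x S g ih zero with bandᵇ x (rotT S []) | bview x (rotT S [])
  ... | .false | noband _ = ≤-trans (ih 0) (≤-reflexive (cnt-0 S))
  ... | .true  | band (mkBand as z R eq len ¬g) = ≤-trans (s≤s (ih q)) (cnt<#blk q x S g
    (λ p → ¬g (at→ as {z ∷ R} 0 (trans (+-identityʳ _) len) (subst (λ l → at q l (Gap x)) eq p))))

  rotBand : ∀ b as R → length as ≡ q → up (last b as) ≽ b → BandAt b (as ++ R)
  rotBand b as R refl h with unsnoc b as
    where
    unsnoc : ∀ b as → ∃[ fs ] (∀ R → b ∷ as ++ R ≡ fs ++ last b as ∷ R) × length fs ≡ length as
    unsnoc b []       = [] , (λ R → refl) , refl
    unsnoc b (a ∷ as) with unsnoc a as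
    ... | fs , e , l = b ∷ fs , (λ R → cong (b ∷_) (e R)) , cong suc l
  ... | fs , e , l = mkBand fs (last b as) R (e R) l (up⇒¬gap b (last b as) h)

  T-rotBand : ∀ b as R → length as ≡ q → up (last b as) ≽ b → T 0 (b ∷ as ++ R) ≡ suc (T 0 R)
  T-rotBand b as R refl h rewrite bandAt⇒band b (as ++ R) (rotBand b as R refl h) =
    cong suc (trans (cong (λ n → T n (as ++ R)) (sym (+-identityʳ _))) (T-skip as 0))

  -- Each band that the search from the top finds uses up a block, by `cnt<#blk`. All offsets s are
  -- needed because the search may resume inside a block.
  T≤cnt : ∀ S → BG S → ∀ s → T s (rotT S []) ≤ cnt s S
  T≤-inner : ∀ as S → Inner as S → (∀ s → T s (rotT S []) ≤ cnt s S) →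
             ∀ s → T s (rotT (map one as ++ S) []) ≤ cnt s (map one as ++ S)
  T≤-inner []       S inn       ih = ih
  T≤-inner (a ∷ as) S (g , inn) ih = T≤-one a (map one as ++ S) g (T≤-inner as S inn ih)

  T≤cnt [] bg s = z≤n
  T≤cnt (one x ∷ S) (g , bg) = T≤-one x S g (T≤cnt S bg)
  T≤cnt (blk b as ∷ S) (len , h , inn , bg) zero =
    ≤-trans (≤-reflexive (T-rotBand b as _ len h)) (s≤s (≤-trans (T≤cnt S bg 0) (≤-reflexive (cnt-0 S))))
  T≤cnt (blk b as ∷ S) (refl , h , inn , bg) (suc s) =
    subst₂ _≤_ (cong (T s) (rotT-map as S [])) (cnt-map as s S) (T≤-inner as S inn (T≤cnt S bg) s)

  #blk≤T : ∀ S → BG S → #blk S ≤ T 0 (rotT S [])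
  #blk≤T [] bg = z≤n
  #blk≤T (one x ∷ S) (g , bg) = ≤-trans (#blk≤T S bg) (T-antitone-suc 0 (x ∷ rotT S []))
  #blk≤T (blk b as ∷ S) (len , h , inn , bg) =
    ≤-trans (s≤s (#blk≤T S bg)) (≤-reflexive (sym (T-rotBand b as _ len h)))

  -- The two greedy searches agree in number, so the number of moves made is visible in the list
  -- after the moves.
  T-rot : ∀ S → BG S → T 0 (rotT S []) ≡ #blk S
  T-rot S bg = ≤-antisym (≤-trans (T≤cnt S bg 0) (≤-reflexive (cnt-0 S))) (#blk≤T S bg)

  -- What remains below the first N bands.

  Suf : List Part → List Part → Set
  Suf ys xs = ∃[ pre ] (xs ≡ pre ++ ys)

  suf-refl : ∀ xs → Suf xs xs
  suf-refl xs = [] , refl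

  suf-∷ : ∀ {ys xs} x → Suf ys xs → Suf ys (x ∷ xs)
  suf-∷ x (pre , e) = x ∷ pre , cong (x ∷_) e

  tl-suf : ∀ N s xs → Suf (tl N s xs) xs
  tl-suf N       s       []       = suf-refl []
  tl-suf N       (suc s) (x ∷ xs) = suf-∷ x (tl-suf N s xs)
  tl-suf zero    zero    (x ∷ xs) = suf-refl _
  tl-suf (suc N) zero    (x ∷ xs) with bandᵇ x xs
  ... | true  = suf-∷ x (tl-suf N q xs)
  ... | false = suf-∷ x (tl-suf (suc N) 0 xs)

  T-pos⇒len : ∀ s xs → 1 ≤ T s xs → suc q ≤ length xs
  T-pos⇒len (suc s) (x ∷ xs) h = ≤-trans (T-pos⇒len s xs h) (n≤1+n _)
  T-pos⇒len zero    (x ∷ xs) h with bandᵇ x xs | bview x xs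
  ... | .true  | band b   = s≤s (band-len x xs b)
  ... | .false | noband _ = ≤-trans (T-pos⇒len 0 xs h) (n≤1+n _)

  tl-++ : ∀ N s P Q → N ≤ T s P → s ≤ length P → tl N s (P ++ Q) ≡ tl N s P ++ Q
  tl-++ zero    zero    []      []      h k = refl
  tl-++ zero    zero    []      (_ ∷ _) h k = refl
  tl-++ N       (suc s) (p ∷ P) Q h (s≤s k) = tl-++ N s P Q h k
  tl-++ zero    zero    (p ∷ P) Q h k = refl
  tl-++ (suc N) zero    (p ∷ P) Q h k with bandᵇ p P in eb | bview p P
  ... | .true | band b rewrite bandAt⇒band p (P ++ Q) (bandAt-++ p P Q b) =
      tl-++ N q P Q (s≤s⁻¹ h) (band-len p P b)
  ... | .false | noband _ rewrite trans
      (band-++ p P Q (≤-trans (n≤1+n q) (T-pos⇒len 0 P (≤-trans (s≤s z≤n) h)))) eb =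
    tl-++ (suc N) 0 P Q h z≤n

  tl-skips : ∀ N s P {b Q} → length P < s → Suf (tl N s (P ++ b ∷ Q)) Q
  tl-skips N (suc s) []      h       = tl-suf N s _
  tl-skips N (suc s) (p ∷ P) (s≤s h) = tl-skips N s P h

  -- P alone has fewer than N bands, so the search must have passed b before it stops.
  tl-past : ∀ N s P {b Q} → T s P < N → Suf (tl N s (P ++ b ∷ Q)) Q
  tl-past (suc N) zero [] {b} {Q} h with bandᵇ b Q
  ... | true  = tl-suf N q Q
  ... | false = tl-suf (suc N) 0 Q
  tl-past N       (suc s) []      h = tl-suf N s _
  tl-past N       (suc s) (p ∷ P) h = tl-past N s P h
  tl-past (suc N) zero    (p ∷ P) {b} {Q} h with q ≤? length P
  ... | yes k rewrite band-++ p P (b ∷ Q) k with bandᵇ p P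
  ...   | true  = tl-past N q P (s≤s⁻¹ h)
  ...   | false = tl-past (suc N) 0 P h
  tl-past (suc N) zero    (p ∷ P) {b} {Q} h | no ¬k with bandᵇ p (P ++ b ∷ Q)
  ... | true  = tl-skips N q P (≰⇒> ¬k)
  ... | false with bandᵇ p P | bview p P
  ...   | .true  | band e   = ⊥-elim (¬k (band-len p P e))
  ...   | .false | noband _ = tl-past (suc N) 0 P h

  flatT-suf : ∀ S φ → Suf φ (flatT S φ)
  flatT-suf [] φ = suf-refl φ
  flatT-suf (one x ∷ S) φ = suf-∷ x (flatT-suf S φ)
  flatT-suf (blk b as ∷ S) φ with flatT-suf S φ
  ... | pre , e = as ++ down b ∷ pre ,
      trans (cong (λ l → as ++ down b ∷ l) e) (sym (++-assoc as (down b ∷ pre) φ))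

  tl-zero : ∀ xs → tl 0 0 xs ≡ xs
  tl-zero []      = refl
  tl-zero (_ ∷ _) = refl

  tl-top-suf : ∀ S φ → Top S φ → Suf φ (tl (#blk S) 0 (flatT S φ))
  tl-top-suf [] φ top = subst (Suf φ) (sym (tl-zero φ)) (suf-refl φ)
  tl-top-suf (one x ∷ S) φ (g , top) with #blk S in e
  ... | zero  = suf-∷ x (flatT-suf S φ)
  ... | suc N = subst (Suf φ) (sym (tl-noband N x (flatT S φ) g))
      (subst (λ n → Suf φ (tl n 0 (flatT S φ))) e (tl-top-suf S φ top))
  tl-top-suf (blk b as ∷ S) φ (len , η≤b , tb , top) =
    subst (Suf φ) (sym (tl-band (#blk S) as (down b) (flatT S φ) len (topBand⇒headBand as b η≤b tb)))
        (tl-top-suf S φ top)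

  T-tl : ∀ M s xs → T s xs ≤ M → T 0 (tl M s xs) ≡ 0
  T-tl M       s       []       h = refl
  T-tl M       (suc s) (x ∷ xs) h = T-tl M s xs h
  T-tl zero    zero    (x ∷ xs) h = n≤0⇒n≡0 h
  T-tl (suc M) zero    (x ∷ xs) h with bandᵇ x xs
  ... | true  = T-tl M q xs (s≤s⁻¹ h)
  ... | false = T-tl (suc M) 0 xs h

  T≤length : ∀ s xs → T s xs ≤ length xs
  T≤length s       []       = z≤n
  T≤length (suc s) (x ∷ xs) = ≤-trans (T≤length s xs) (n≤1+n _)
  T≤length zero    (x ∷ xs) with bandᵇ x xs
  ... | true  = s≤s (T≤length q xs)
  ... | false = ≤-trans (T≤length 0 xs) (n≤1+n _)

  tl-long : ∀ N s xs → length xs ≤ N → tl N s xs ≡ []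
  tl-long N       s       []       h = refl
  tl-long N       (suc s) (x ∷ xs) h = tl-long N s xs (≤-trans (n≤1+n _) h)
  tl-long (suc N) zero    (x ∷ xs) h with bandᵇ x xs
  ... | true  = tl-long N q xs (s≤s⁻¹ h)
  ... | false = tl-long (suc N) 0 xs (≤-trans (n≤1+n _) h)

  All> : ℕ → List Part → Set
  All> c []       = ⊤
  All> c (x ∷ xs) = c < size x × All> c xs

  -- A part directly above a band is at distance k - 1 from the end of the band, hence at least η
  -- larger. So every band found below z adds η to the lower bound c.
  size-bound′ : ∀ c z ys R → W (z ∷ ys ++ R) → All> c (z ∷ ys) → ∀ s →
      at s (z ∷ ys) (λ w → T s ys * η + c < size w)
  size-bound′ c z [] R w (cz , _) zero = cz
  size-bound′ c z [] R w (cz , _) (suc s) = tt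
  size-bound′ c z (y ∷ ys) R w (cz , cys) (suc s) = size-bound′ c y ys R (proj₂ (proj₂ w)) cys s
  size-bound′ c z (y ∷ ys) R w (cz , cys) zero with bandᵇ y ys | bview y ys
  ... | .false | noband _ = ≤-trans (size-bound′ c y ys R (proj₂ (proj₂ w)) cys 0) (≽⇒≥ z y (proj₁ w))
  ... | .true  | band (mkBand as e R′ eq refl _) = begin-strict
    η + T q ys * η + c     ≡⟨ solve 3 (λ n t c → n :+ t :+ c := t :+ c :+ n) refl η (T q ys * η) c ⟩
    T q ys * η + c + η     <⟨ +-monoˡ-< η
        (at→ as {e ∷ R′} 0 (+-identityʳ _)
        (subst (λ l → at q l _) eq (size-bound′ c y ys R (proj₂ (proj₂ w)) cys q))) ⟩
    size e + η             ≤⟨ gap⇒+η≤ z e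
        (at→ as {e ∷ R′ ++ R} 0 (+-identityʳ _)
        (subst (λ l → at q l (Gap z)) (trans (cong (_++ R) eq) (++-assoc as (e ∷ R′) R))
        (proj₁ (proj₂ w)))) ⟩
    size z                 ∎
    where open ≤-Reasoning

  size-bound : ∀ c z ys R → W (z ∷ ys ++ R) → All> c (z ∷ ys) → T 0 ys * η + c < size z
  size-bound c z ys R w a = size-bound′ c z ys R w a 0

  -- The order conditions and condition (3) as Boolean tests.

  Ord : Part → Part → Set
  Ord x y = size y ≤ size x × (size y ≡ size x → over y ≡ true → over x ≡ true)

  Adjacent : List Part → Set
  Adjacent []       = ⊤
  Adjacent (x ∷ xs) = at 0 xs (Ord x) × Adjacent xs

  adjacent⇒chain : ∀ xs → Adjacent xs → distinctᵇ (map size (overs xs)) ≡ true → Chain xs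
  adjacent⇒chain []           a d = tt
  adjacent⇒chain (x ∷ [])     a d = tt , tt
  adjacent⇒chain (x ∷ y ∷ xs) ((h , k) , a) d =
      x≽y (over y) refl , adjacent⇒chain (y ∷ xs) a (tail (over x) refl)
    where
    tail : ∀ b → over x ≡ b → distinctᵇ (map size (overs (y ∷ xs))) ≡ true
    tail false e = subst (λ b → distinctᵇ (map size (if b then x ∷ overs (y ∷ xs) else overs (y ∷ xs))) ≡
        true) e d
    tail true  e = proj₂ (∧-true⁻ (not (any (λ y → size x ≡ᵇ y) (map size (overs (y ∷ xs)))))
      (subst (λ b → distinctᵇ (map size (if b then x ∷ overs (y ∷ xs) else overs (y ∷ xs))) ≡ true) e d))
    x≽y : ∀ c → over y ≡ c → size y + (if c then 1 else 0) ≤ size x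
    x≽y false e′ = subst (_≤ size x) (sym (+-identityʳ _)) h
    x≽y true  e′ with m≤n⇒m<n∨m≡n h
    ... | inj₁ lt = subst (_≤ size x) (+-comm 1 (size y)) lt
    ... | inj₂ eq = ⊥-elim (dup (subst₂ (λ b c →
        distinctᵇ (map size (if b then x ∷ (if c then y ∷ overs xs else overs xs) else
        (if c then y ∷ overs xs else overs xs))) ≡ true) (k eq e′) e′ d))
      where
      dup : ¬ distinctᵇ (size x ∷ size y ∷ map size (overs xs)) ≡ true
      dup d rewrite ≡ᵇ⁺ {size x} {size y} (sym eq) with d
      ... | ()

  chain⇒below : ∀ x xs → Chain (x ∷ xs) → All (λ u → x ≽ u) xs
  chain⇒below x []       c = []
  chain⇒below x (y ∷ xs) (h , c) = h ∷ All.map (λ {u} k → ≽-trans {x} {y} {u} h k) (chain⇒below y xs c)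

  not-any : ∀ m xs → All (λ u → over u ≡ true → size u < m) xs →
      any (λ y → m ≡ᵇ y) (map size (overs xs)) ≡ false
  not-any m []       a       = refl
  not-any m (x ∷ xs) (h ∷ a) = go (over x) refl
    where
    go : ∀ b → over x ≡ b → any (λ y → m ≡ᵇ y) (map size (if b then x ∷ overs xs else overs xs)) ≡ false
    go false e = not-any m xs a
    go true  e with m ≡ᵇ size x in eq
    ... | false = not-any m xs a
    ... | true  = ⊥-elim (<-irrefl (sym (≡ᵇ⁻ m (size x) eq)) (h e))

  over⇒< : ∀ x u → x ≽ u → over u ≡ true → size u < size x
  over⇒< x u h e = ≤-trans (≤-reflexive
      (trans (+-comm 1 (size u)) (cong (λ b → size u + (if b then 1 else 0)) (sym e)))) h

  chain⇒distinct : ∀ xs → Chain xs → distinctᵇ (map size (overs xs)) ≡ true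
  chain⇒distinct []       c = refl
  chain⇒distinct (x ∷ xs) c = go (over x)
    where
    go : ∀ b → distinctᵇ (map size (if b then x ∷ overs xs else overs xs)) ≡ true
    go false = chain⇒distinct xs (proj₂ c)
    go true  = ∧-true⁺ (cong not (not-any (size x) xs (All.map (λ {u} → over⇒< x u) (chain⇒below x xs c))))
        (chain⇒distinct xs (proj₂ c))

  key-adjacent⁻ : ∀ xs → adjacentᵇ (λ x y → y ≤ₚ x) xs ≡ true → Adjacent xs
  key-adjacent⁻ []           e = tt
  key-adjacent⁻ (x ∷ [])     e = tt , tt
  key-adjacent⁻ (x ∷ y ∷ xs) e = (h , k (over x) refl) , key-adjacent⁻ (y ∷ xs) (proj₂ (∧-true⁻ (y ≤ₚ x) e))
    where
    ky : key y ≤ key x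
    ky = ≤ᵇ⁻ (key y) (key x) (proj₁ (∧-true⁻ (y ≤ₚ x) e))
    h : size y ≤ size x
    h = half-≤ (size y) (size x) (≤-trans (m≤m+n _ (ov y)) (≤-trans ky (+-monoʳ-≤ (2 * size x) (ov≤1 x))))
    k : ∀ b → over x ≡ b → size y ≡ size x → over y ≡ true → over x ≡ true
    k true  ex eq o = ex
    k false ex eq o = ⊥-elim (<-irrefl refl (≤-trans (≤-reflexive (+-comm 1 _))
      (subst₂ (λ u v → 2 * size y + (if u then 1 else 0) ≤ v) o
          (trans (cong₂ (λ s b → 2 * s + (if b then 1 else 0)) (sym eq) ex) (+-identityʳ _)) ky)))

  key-adjacent⁺ : ∀ xs → Chain xs → adjacentᵇ (λ x y → y ≤ₚ x) xs ≡ true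
  key-adjacent⁺ []           c = refl
  key-adjacent⁺ (x ∷ [])     c = refl
  key-adjacent⁺ (x ∷ y ∷ xs) (h , c) = ∧-true⁺ (≤ᵇ-true (begin
    2 * size y + ov y          ≤⟨ +-monoʳ-≤ (2 * size y) (m≤n*m (ov y) 2) ⟩
    2 * size y + 2 * ov y      ≡⟨ sym (*-distribˡ-+ 2 (size y) (ov y)) ⟩
    2 * (size y + ov y)        ≤⟨ *-monoʳ-≤ 2 h ⟩
    2 * size x                 ≤⟨ m≤m+n _ (ov x) ⟩
    key x                      ∎)) (key-adjacent⁺ (y ∷ xs) c)
    where open ≤-Reasoning

  gapᵇ : Part → Part → Bool
  gapᵇ x y = if over x then (y +ₚ η) ≤ₚ x else (y +ₚ η) <ₚ x

  gapᵇ⁻ : ∀ x y → gapᵇ x y ≡ true → Gap x y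
  gapᵇ⁻ (part s true)  y e = subst (_≤ s) (sym (+-identityʳ _))
      (half-≤ (size y + η) s (≤-trans (m≤m+n _ (ov y)) (≤ᵇ⁻ (key (up y)) (2 * s + 1) e)))
  gapᵇ⁻ (part s false) y e = subst (_≤ s) (+-comm 1 _)
      (*-cancelˡ-< 2 (size y + η) s (≤-trans (s≤s (m≤m+n _ (ov y)))
      (≤-trans (<ᵇ⁻ (key (up y)) (2 * s + 0) e) (≤-reflexive (+-identityʳ _)))))

  gapᵇ⁺ : ∀ x y → Gap x y → gapᵇ x y ≡ true
  gapᵇ⁺ (part s true)  y g = ≤ᵇ-true (+-mono-≤ (*-monoʳ-≤ 2 (subst (_≤ s) (+-identityʳ _) g)) (ov≤1 y))
  gapᵇ⁺ (part s false) y g = <ᵇ⁺ (begin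
    suc (2 * (size y + η) + ov y)   ≤⟨ s≤s (+-monoʳ-≤ (2 * (size y + η)) (ov≤1 y)) ⟩
    suc (2 * (size y + η) + 1)      ≡⟨ solve 1 (λ a →
        con 1 :+ (a :+ (a :+ con 0) :+ con 1) := a :+ con 1 :+ (a :+ con 1 :+ con 0)) refl (size y + η) ⟩
    2 * (size y + η + 1)            ≤⟨ *-monoʳ-≤ 2 g ⟩
    2 * s                           ≡⟨ sym (+-identityʳ _) ⟩
    2 * s + 0                       ∎)
    where open ≤-Reasoning

  small⁻ : ∀ x → (x ≤ₚ plain η) ≡ true → size x + ov x ≤ η
  small⁻ (part s true)  e = subst (_≤ η) (+-comm 1 s)
      (*-cancelˡ-< 2 s η (≤-trans (≤-reflexive (+-comm 1 _))
      (≤-trans (≤ᵇ⁻ (2 * s + 1) (2 * η + 0) e) (≤-reflexive (+-identityʳ _)))))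
  small⁻ (part s false) e = subst (_≤ η) (sym (+-identityʳ s))
      (half-≤ s η (≤-trans (≤-trans (m≤m+n _ 0) (≤ᵇ⁻ (2 * s + 0) (2 * η + 0) e)) (+-monoʳ-≤ (2 * η) z≤n)))

  small⁺ : ∀ x → size x + ov x ≤ η → (x ≤ₚ plain η) ≡ true
  small⁺ x h = ≤ᵇ-true (begin
    2 * size x + ov x          ≤⟨ +-monoʳ-≤ (2 * size x) (m≤n*m (ov x) 2) ⟩
    2 * size x + 2 * ov x      ≡⟨ sym (*-distribˡ-+ 2 (size x) (ov x)) ⟩
    2 * (size x + ov x)        ≤⟨ *-monoʳ-≤ 2 h ⟩
    2 * η                      ≡⟨ sym (+-identityʳ _) ⟩
    2 * η + 0                  ∎)
    where open ≤-Reasoning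

  Windows : List Part → Set
  Windows π = ∀ i {x y} → nth π i ≡ just x → nth π (i + suc q) ≡ just y → Gap x y

  windows⇒W : ∀ π → Chain π → Windows π → W π
  windows⇒W []       c g = tt
  windows⇒W (x ∷ xs) (h , c) g = h , at-nth q xs (λ e → g 0 refl e) , windows⇒W xs c (λ i → g (suc i))

  W⇒windows : ∀ π → W π → Windows π
  W⇒windows (x ∷ xs) (_ , g , w) zero    refl e = nth-at q xs g e
  W⇒windows (x ∷ xs) (_ , g , w) (suc i) e e′ = W⇒windows xs w i e e′

  W⇒chain : ∀ π → W π → Chain π
  W⇒chain []       w = tt
  W⇒chain (x ∷ xs) (h , _ , w) = h , W⇒chain xs w

-- Parity of overlapping and adjacent bands.

module Bijection (η : ℕ) .{{η≢0 : NonZero η}} (q : ℕ) (A : List ℕ) (|A|≤ : length A ≤ suc q)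
                 (r : ℕ) (1≤r : 1 ≤ r) (r≤k : r ≤ suc (suc q)) where
  open Blocks η q

  F : Part → ℕ
  F x = size x / η

  sumF #ov : List Part → ℕ
  sumF []       = 0
  sumF (x ∷ xs) = F x + sumF xs
  #ov []       = 0
  #ov (x ∷ xs) = ov x + #ov xs

  record Free (x : Part) : Set where
    constructor mkFree
    field
      over⇒ : over x ≡ true → size x % η ∈ A × size x % η ≢ 0
      plain⇒ : over x ≡ false → size x % η ≡ 0

  free-up : ∀ {x} → Free x → Free (up x)
  free-up {x} (mkFree o p) = mkFree (λ e → subst (λ m → m ∈ A × m ≢ 0) (sym h) (o e)) (λ e → trans h (p e))
    where
    h : (size x + η) % η ≡ size x % η
    h = [m+n]%n≡m%n (size x) η

  F-up : ∀ x → F (up x) ≡ suc (F x)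
  F-up x = trans (+-distrib-/-∣ʳ (size x) ∣-refl) (trans (cong (F x +_) (n/n≡1 η)) (+-comm (F x) 1))

  chain-last : ∀ y Q x → Chain (y ∷ Q ++ x ∷ []) → size x ≤ size y
  chain-last y []      x (h , _) = ≽⇒≥ y x h
  chain-last y (u ∷ Q) x (h , c) = ≤-trans (chain-last u Q x c) (≽⇒≥ y u h)

  chain-between : ∀ y Q x → Chain (y ∷ Q ++ x ∷ []) →
      All (λ u → size x ≤ size u × size u ≤ size y) (y ∷ Q ++ x ∷ [])
  chain-between y []      x (h , _) = (≽⇒≥ y x h , ≤-refl) ∷ (≤-refl , ≽⇒≥ y x h) ∷ []
  chain-between y (u ∷ Q) x (h , c) = (chain-last y (u ∷ Q) x (h , c) , ≤-refl) ∷
    All.map (λ { (a , b) → a , ≤-trans b (≽⇒≥ y u h) }) (chain-between u Q x c)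

  -- A multiple of η is the least element of its η-interval, so nothing above a nonmultiple x in the
  -- same interval is one.
  F-nonmultiple : ∀ x u → size x % η ≢ 0 → size x ≤ size u → F u ≡ F x → size u % η ≢ 0
  F-nonmultiple x u ne x≤u e z = ne (n≤0⇒n≡0 (+-cancelʳ-≤ (F x * η) _ _ (begin
    size x % η + F x * η  ≡⟨ sym (m≡m%n+[m/n]*n (size x) η) ⟩
    size x                ≤⟨ x≤u ⟩
    size u                ≡⟨ m≡m%n+[m/n]*n (size u) η ⟩
    size u % η + F u * η  ≡⟨ cong₂ (λ a b → a + b * η) z e ⟩
    F x * η               ∎)))
    where open ≤-Reasoning

  res : Part → ℕ
  res u = size u % η

  res-decreasing : ∀ X L → Chain L → All (λ u → over u ≡ true × F u ≡ X) L → Linked _>_ (map res L)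
  res-decreasing X []           c a = []
  res-decreasing X (u ∷ [])     c a = [-]
  res-decreasing X (u ∷ v ∷ L) (h , c) ((ou , fu) ∷ (ov′ , fv) ∷ a) =
      +-cancelʳ-< (X * η) (res v) (res u) (begin-strict
      res v + X * η    ≡⟨ cong (λ X → res v + X * η) (sym fv) ⟩
      res v + F v * η  ≡⟨ sym (m≡m%n+[m/n]*n (size v) η) ⟩
      size v           <⟨ ≤-trans (≤-reflexive
          (trans (+-comm 1 (size v)) (cong (size v +_) (sym (cong (λ b → if b then 1 else 0) ov′))))) h ⟩
      size u           ≡⟨ m≡m%n+[m/n]*n (size u) η ⟩
      res u + F u * η  ≡⟨ cong (λ X → res u + X * η) fu ⟩
      res u + X * η    ∎) ∷ res-decreasing X (v ∷ L) c ((ov′ , fv) ∷ a)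
    where open ≤-Reasoning

  module _ (x y : Part) (Q : List Part) (len : length Q ≡ q) (c : Chain (up (up y) ∷ Q ++ x ∷ []))
      (g : Gap x y)
           (fx : Free x) (fy : Free y) (fQ : All Free Q) where
    open ≤-Reasoning

    private
      y″ : Part
      y″ = up (up y)
      L : List Part
      L = y″ ∷ Q ++ x ∷ []

    F-y″ : F y″ ≡ suc (suc (F y))
    F-y″ = trans (F-up (up y)) (cong suc (F-up y))

    -- x is a multiple of η above y + η, which forces its quotient beyond that of y + η; the chain
    -- from y + 2η down to x bounds it from above.
    plain-pair : over x ≡ false → F x ≡ suc (suc (F y))
    plain-pair eo = ≤-antisym Fx≤ Fx≥
      where
      Fx≤ : F x ≤ suc (suc (F y))
      Fx≤ = ≤-trans (/-monoˡ-≤ η (chain-last y″ Q x c)) (≤-reflexive F-y″)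
      x≡ : size x ≡ F x * η
      x≡ = trans (m≡m%n+[m/n]*n (size x) η) (cong (_+ F x * η) (Free.plain⇒ fx eo))
      Fx≥ : suc (suc (F y)) ≤ F x
      Fx≥ = ≰⇒> (λ h → <-irrefl refl (begin-strict
        size x             ≡⟨ x≡ ⟩
        F x * η            ≤⟨ *-monoˡ-≤ η (≤-trans h (≤-reflexive (sym (F-up y)))) ⟩
        F (up y) * η       ≤⟨ m/n*n≤m (size y + η) η ⟩
        size y + η         <⟨ ≤-trans (≤-reflexive (+-comm 1 _))
            (subst (λ b → size y + η + (if b then 0 else 1) ≤ size x) eo g) ⟩
        size x             ∎))

    -- If x and y + 2η lay in the same η-interval, the k parts of the chain would
    -- have k distinct residues among the λ < k allowed ones.
    over-pair : over x ≡ true → F x ≡ suc (F y)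
    over-pair eo = ≤-antisym (s≤s⁻¹ (≰⇒> not2)) Fx≥
      where
      Fx≥ : suc (F y) ≤ F x
      Fx≥ = ≤-trans (≤-reflexive (sym (F-up y))) (/-monoˡ-≤ η (gap⇒+η≤ x y g))
      fL : All Free L
      fL = free-up (free-up fy) ∷ All.++⁺ fQ (fx ∷ [])
      not2 : ¬ suc (suc (F y)) ≤ F x
      not2 h = <-irrefl refl (begin-strict
        suc q                          <⟨ n<1+n _ ⟩
        suc (suc q)                    ≡⟨ cong suc (trans (+-comm 1 q) (cong (_+ 1) (sym len))) ⟩
        suc (length Q + 1)             ≡⟨ cong suc (sym (length-++ Q)) ⟩
        length L                       ≡⟨ sym (length-map res L) ⟩
        length (map res L)             ≤⟨ unique-⊆⇒length≤ uniq sub ⟩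
        length A                       ≤⟨ |A|≤ ⟩
        suc q                          ∎)
        where
        Fu : ∀ {u} → size x ≤ size u × size u ≤ size y″ → F u ≡ F x
        Fu (a , b) = ≤-antisym (≤-trans (/-monoˡ-≤ η b) (≤-trans (≤-reflexive F-y″) h)) (/-monoˡ-≤ η a)
        ovr : ∀ {u} → Free u × (size x ≤ size u × size u ≤ size y″) → (over u ≡ true × F u ≡ F x) ×
            res u ∈ A
        ovr {u} (f , b) with over u in eu
        ... | true  = (refl , Fu {u} b) , proj₁ (Free.over⇒ f eu)
        ... | false = ⊥-elim (F-nonmultiple x u (proj₂ (Free.over⇒ fx eo)) (proj₁ b) (Fu {u} b)
            (Free.plain⇒ f eu))
        both : All (λ u → (over u ≡ true × F u ≡ F x) × res u ∈ A) L
        both = All.map ovr (All.zip (fL , chain-between y″ Q x c))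
        uniq : Unique (map res L)
        uniq = AllPairs.map (λ h e → <-irrefl (sym e) h)
            (Linked⇒AllPairs (λ a b → <-trans b a) (res-decreasing (F x) L c (All.map proj₁ both)))
        sub : map res L ⊆ A
        sub = All.lookup (All.map⁺ (All.map proj₂ both))

    pair-parity : par (F x) ≡ par (F y + ov x)
    pair-parity = go (over x) refl
      where
      go : ∀ b → over x ≡ b → par (F x) ≡ par (F y + (if b then 1 else 0))
      go false e = trans (cong par (plain-pair e))
          (trans (not-involutive (par (F y))) (cong par (sym (+-identityʳ (F y)))))
      go true  e = cong par (trans (over-pair e) (+-comm 1 (F y)))

  up² : Part → Part
  up² = up ∘ up

  Gaps : List Part → List Part → Set
  Gaps []       _        = ⊤
  Gaps (x ∷ xs) []       = ⊤
  Gaps (x ∷ xs) (y ∷ ys) = Gap x y × Gaps xs ys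

  chain-cut : ∀ P x {R} → Chain (P ++ x ∷ R) → Chain (P ++ x ∷ [])
  chain-cut []          x (h , c) = tt , tt
  chain-cut (p ∷ [])    x (h , c) = h , tt , tt
  chain-cut (p ∷ u ∷ P) x (h , c) = h , chain-cut (u ∷ P) x c

  -- For each pair x, y the k parts from y + 2η down to x run through the raised rest of `ys`, then
  -- M, which collects the members of `xs` already treated.
  gaps-parity : ∀ xs ys M → length xs ≡ length ys → length ys + length M ≡ suc q →
                Chain (map up² ys ++ M ++ xs) → Gaps xs ys → All Free xs → All Free ys → All Free M →
                par (sumF xs) ≡ par (sumF ys + #ov xs)
  gaps-parity [] [] M el len c gs fx fy fM = refl
  gaps-parity (x ∷ xs) (y ∷ ys) M el len c (g , gs) (fx ∷ fxs) (fy ∷ fys) fM =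
    begin
      par (F x + sumF xs)                         ≡⟨ par-+ (F x) _ ⟩
      par (F x) xor par (sumF xs)                 ≡⟨ cong₂ _xor_ hd tl′ ⟩
      par (F y + ov x) xor par (sumF ys + #ov xs) ≡⟨ sym (par-+ (F y + ov x) _) ⟩
      par (F y + ov x + (sumF ys + #ov xs))       ≡⟨ cong par
          (solve 4 (λ a b c d → a :+ b :+ (c :+ d) := a :+ c :+ (b :+ d)) refl (F y) (ov x) (sumF ys)
          (#ov xs)) ⟩
      par (F y + sumF ys + (ov x + #ov xs))       ∎
    where
    open ≡-Reasoning
    c1 : Chain (up² y ∷ (map up² ys ++ M) ++ x ∷ xs)
    c1 = subst Chain (cong (up² y ∷_) (sym (++-assoc (map up² ys) M (x ∷ xs)))) c
    hd : par (F x) ≡ par (F y + ov x)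
    hd = pair-parity x y (map up² ys ++ M)
      (trans (length-++ (map up² ys)) (trans (cong (_+ length M) (length-map up² ys)) (suc-injective len)))
      (chain-cut (up² y ∷ map up² ys ++ M) x c1) g fx fy
          (All.++⁺ (All.map⁺ (All.map (free-up ∘ free-up) fys)) fM)
    tl′ : par (sumF xs) ≡ par (sumF ys + #ov xs)
    tl′ = gaps-parity xs ys (M ++ x ∷ []) (suc-injective el)
      (trans (cong (length ys +_) (trans (length-++ M) (+-comm (length M) 1)))
          (trans (+-suc (length ys) (length M)) len))
      (subst Chain (cong (map up² ys ++_) (sym (++-assoc M (x ∷ []) xs))) (proj₂ c)) gs fxs fys
          (All.++⁺ fM (fx ∷ []))

  -- Modulo 2 the count of overlined parts in (5) may change sides. The overlined parts not
  -- exceeding the head of a suffix are those of the suffix, so the parity of a band depends on the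
  -- suffix alone.
  mass : List Part → ℕ
  mass xs = sumF (take (suc q) xs) + #ov xs

  Ev : List Part → Set
  Ev xs = par (mass xs) ≡ par (suc r)

  AE : List Part → Set
  AE []       = ⊤
  AE (x ∷ xs) = (BandAt x xs → Ev (x ∷ xs)) × AE xs

  sumF-++ : ∀ xs ys → sumF (xs ++ ys) ≡ sumF xs + sumF ys
  sumF-++ []       ys = refl
  sumF-++ (x ∷ xs) ys = trans (cong (F x +_) (sumF-++ xs ys)) (sym (+-assoc (F x) _ _))

  #ov-++ : ∀ xs ys → #ov (xs ++ ys) ≡ #ov xs + #ov ys
  #ov-++ []       ys = refl
  #ov-++ (x ∷ xs) ys = trans (cong (ov x +_) (#ov-++ xs ys)) (sym (+-assoc (ov x) _ _))

  take-length : {B : Set} → ∀ (xs ys : List B) {n} → length xs ≡ n → take n (xs ++ ys) ≡ xs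
  take-length []       ys refl = refl
  take-length (x ∷ xs) ys refl = cong (x ∷_) (take-length xs ys refl)

  mass-++ : ∀ Bs R → length Bs ≡ suc q → mass (Bs ++ R) ≡ sumF Bs + (#ov Bs + #ov R)
  mass-++ Bs R len = cong₂ _+_ (cong sumF (take-length Bs R len)) (#ov-++ Bs R)

  W⇒chainˡ : ∀ xs {R} → W (xs ++ R) → Chain xs
  W⇒chainˡ []           w = tt
  W⇒chainˡ (x ∷ [])     w = tt , tt
  W⇒chainˡ (x ∷ y ∷ xs) w = proj₁ w , W⇒chainˡ (y ∷ xs) (proj₂ (proj₂ w))

  up-mono : ∀ {x y} → x ≽ y → up x ≽ up y
  up-mono {x} {y} h = ≤-trans (≤-reflexive (solve 3 (λ a b c → a :+ b :+ c := a :+ c :+ b) refl (size y) η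
      (ov y))) (+-monoˡ-≤ η h)

  chain-up : ∀ xs → Chain xs → Chain (map up xs)
  chain-up []           c = tt
  chain-up (x ∷ [])     c = tt , tt
  chain-up (x ∷ y ∷ xs) (h , c) = up-mono {x} {y} h , chain-up (y ∷ xs) c

  map-up² : ∀ xs → map up (map up xs) ≡ map up² xs
  map-up² []       = refl
  map-up² (x ∷ xs) = cong (up² x ∷_) (map-up² xs)

  last-map : ∀ (f : Part → Part) x xs → last (f x) (map f xs) ≡ f (last x xs)
  last-map f x []       = refl
  last-map f x (y ∷ xs) = last-map f y xs

  chain-++ : ∀ x xs ys → Chain (x ∷ xs) → at 0 ys (last x xs ≽_) → Chain ys → Chain (x ∷ xs ++ ys)
  chain-++ x []       ys c h d = h , d
  chain-++ x (y ∷ xs) ys c h d = proj₁ c , chain-++ y xs ys (proj₂ c) h d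

  W⇒gaps : ∀ xs mid ys {R} → length xs ≡ length ys → length xs + length mid ≡ suc q →
      W (xs ++ mid ++ ys ++ R) → Gaps xs ys
  W⇒gaps []       mid ys e len w = tt
  W⇒gaps (x ∷ xs) mid (y ∷ ys) {R} e len w =
    at→ (xs ++ mid) {y ∷ ys ++ R} 0 (trans (+-identityʳ _) (trans (length-++ xs) (suc-injective len)))
      (subst (λ l → at q l (Gap x)) (sym (++-assoc xs mid (y ∷ ys ++ R))) (proj₁ (proj₂ w))) ,
    W⇒gaps xs (mid ++ y ∷ []) ys (suc-injective e)
      (trans (cong (length xs +_) (trans (length-++ mid) (+-comm (length mid) 1)))
          (trans (+-suc (length xs) (length mid)) len))
      (subst W (cong (xs ++_) (sym (++-assoc mid (y ∷ []) (ys ++ R)))) (proj₂ (proj₂ w)))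

  -- The common part `mid` adds the same to both windows. The overlined parts of `xs` enter twice,
  -- through `gaps-parity` and through `#ov`, and cancel modulo 2.
  window-parity : ∀ xs mid ys R → length xs ≡ length ys → length xs + length mid ≡ suc q →
      W (xs ++ mid ++ ys ++ R) →
                  Chain (map up² ys ++ map up mid ++ xs) → All Free xs → All Free mid → All Free ys →
                  par (mass (xs ++ mid ++ ys ++ R)) ≡ par (mass (mid ++ ys ++ R))
  window-parity xs mid ys R e len w c fx fm fy = begin
    par (mass (xs ++ mid ++ ys ++ R))     ≡⟨ cong par m1 ⟩
    par (sumF xs + c1)                    ≡⟨ par-congˡ c1 {sumF xs} {sumF ys + #ov xs}
        (gaps-parity xs ys (map up mid) e (trans (cong₂ _+_ (sym e) (length-map up mid)) len) c
        (W⇒gaps xs mid ys e len w) fx fy (All.map⁺ (All.map free-up fm))) ⟩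
    par (sumF ys + #ov xs + c1)           ≡⟨ cong par
        (solve 4 (λ a b c d → a :+ b :+ (c :+ b :+ d) := c :+ a :+ d :+ (b :+ b)) refl (sumF ys) (#ov xs)
        (sumF mid) (#ov (mid ++ ys ++ R))) ⟩
    par (sumF mid + sumF ys + #ov (mid ++ ys ++ R) + (#ov xs + #ov xs))
        ≡⟨ par-double (#ov xs) (sumF mid + sumF ys + #ov (mid ++ ys ++ R)) ⟩
    par (sumF mid + sumF ys + #ov (mid ++ ys ++ R)) ≡⟨ cong par (sym m2) ⟩
    par (mass (mid ++ ys ++ R))           ∎
    where
    open ≡-Reasoning
    c1 : ℕ
    c1 = sumF mid + #ov xs + #ov (mid ++ ys ++ R)
    m1 : mass (xs ++ mid ++ ys ++ R) ≡ sumF xs + c1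
    m1 = trans (cong₂ _+_ (trans (cong (sumF ∘ take (suc q)) (sym (++-assoc xs mid (ys ++ R))))
        (trans (cong sumF (take-length (xs ++ mid) (ys ++ R) (trans (length-++ xs) len)))
            (sumF-++ xs mid))) (#ov-++ xs (mid ++ ys ++ R)))
      (solve 4 (λ a b c d → a :+ b :+ (c :+ d) := a :+ (b :+ c :+ d)) refl (sumF xs) (sumF mid) (#ov xs)
          (#ov (mid ++ ys ++ R)))
    m2 : mass (mid ++ ys ++ R) ≡ sumF mid + sumF ys + #ov (mid ++ ys ++ R)
    m2 = cong (_+ #ov (mid ++ ys ++ R)) (trans (cong (sumF ∘ take (suc q)) (sym (++-assoc mid ys R)))
        (trans (cong sumF (take-length (mid ++ ys) R
            (trans (length-++ mid) (trans (+-comm (length mid) _)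
            (trans (cong (_+ length mid) (sym e)) len))))) (sumF-++ mid ys)))

  -- The chain is the lower part raised twice, the common part raised once, then the upper part; its
  -- two joints are the band conditions of the two windows.
  overlap-parity : ∀ x xs c mid y ys R → length xs ≡ length ys → length xs + suc (length mid) ≡ q →
                   W (x ∷ xs ++ c ∷ mid ++ y ∷ ys ++ R) → up (last c mid) ≽ x → up (last y ys) ≽ c →
                   All Free (x ∷ xs) → All Free (c ∷ mid) → All Free (y ∷ ys) →
                   par (mass (x ∷ xs ++ c ∷ mid ++ y ∷ ys ++ R)) ≡ par (mass (c ∷ mid ++ y ∷ ys ++ R))
  overlap-parity x xs c mid y ys R e len w b1 b2 =
      window-parity (x ∷ xs) (c ∷ mid) (y ∷ ys) R (cong suc e) (cong suc len) w
    (chain-++ (up² y) (map up² ys) (map up (c ∷ mid) ++ x ∷ xs)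
      (subst Chain (map-up² (y ∷ ys))
          (chain-up (map up (y ∷ ys)) (chain-up (y ∷ ys)
          (W⇒chainˡ (y ∷ ys) (W-++ʳ (c ∷ mid) (W-++ʳ (x ∷ xs) w))))))
      (subst (_≽ up c) (sym (last-map up² y ys)) (up-mono {up (last y ys)} {c} b2))
      (chain-++ (up c) (map up mid) (x ∷ xs) (chain-up (c ∷ mid) (W⇒chainˡ (c ∷ mid) (W-++ʳ (x ∷ xs) w)))
        (subst (_≽ x) (sym (last-map up c mid)) b1) (W⇒chainˡ (x ∷ xs) w)))

  -- Without a common part the chain has one joint, the assumption that the last part raised by 2η
  -- reaches x.
  adjacent-parity : ∀ x xs y ys R → length xs ≡ q → length ys ≡ q → W (x ∷ xs ++ y ∷ ys ++ R) →
      up² (last y ys) ≽ x →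
                    All Free (x ∷ xs) → All Free (y ∷ ys) →
                    par (mass (x ∷ xs ++ y ∷ ys ++ R)) ≡ par (mass (y ∷ ys ++ R))
  adjacent-parity x xs y ys R e e′ w b fx fy =
      window-parity (x ∷ xs) [] (y ∷ ys) R (cong suc (trans e (sym e′)))
      (trans (+-identityʳ _) (cong suc e)) w
    (chain-++ (up² y) (map up² ys) (x ∷ xs)
      (subst Chain (map-up² (y ∷ ys))
          (chain-up (map up (y ∷ ys)) (chain-up (y ∷ ys) (W⇒chainˡ (y ∷ ys) (W-++ʳ (x ∷ xs) w)))))
      (subst (_≽ x) (sym (last-map up² y ys)) b) (W⇒chainˡ (x ∷ xs) w)) fx [] fy

  bandAt⇒up : ∀ b bs R → length bs ≡ q → BandAt b (bs ++ R) → up (last b bs) ≽ b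
  bandAt⇒up b bs R len (mkBand as z R′ eq len′ ¬g) =
      subst (λ l → up l ≽ b) (sym (go b bs as eq (trans len (sym len′)))) (¬gap⇒up b z ¬g)
    where
    go : ∀ b bs as → b ∷ bs ++ R ≡ as ++ z ∷ R′ → length bs ≡ length as → last b bs ≡ z
    go b []        []       refl _ = refl
    go b (b′ ∷ bs) (a ∷ as) e    l = go b′ bs as (proj₂ (∷-injective e)) (suc-injective l)

  split-at : {B : Set} → ∀ n (L : List B) → n ≤ length L → ∃[ ys ] ∃[ R ] (L ≡ ys ++ R × length ys ≡ n)
  split-at zero    L       h = [] , L , refl , refl
  split-at (suc n) (x ∷ L) (s≤s h) with split-at n L h
  ... | ys , R , refl , refl = x ∷ ys , R , refl , refl

  last-++ : ∀ x xs y ys → last x (xs ++ y ∷ ys) ≡ last y ys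
  last-++ x []        y ys = refl
  last-++ x (x′ ∷ xs) y ys = last-++ x′ xs y ys

  AE-suf : ∀ pre ys → AE (pre ++ ys) → AE ys
  AE-suf []        ys ae = ae
  AE-suf (p ∷ pre) ys ae = AE-suf pre ys (proj₂ ae)

  Suf-AE : ∀ {ys xs} → Suf ys xs → AE xs → AE ys
  Suf-AE {ys} (pre , refl) ae = AE-suf pre ys ae

  at-++⁻ : {P : Part → Set} → ∀ i xs Z → at i (xs ++ Z) P → at i xs P
  at-++⁻ i       []       Z p = tt
  at-++⁻ zero    (x ∷ xs) Z p = p
  at-++⁻ (suc i) (x ∷ xs) Z p = at-++⁻ i xs Z p

  W-front : ∀ xs Z → W (xs ++ Z) → W xs
  W-front []       Z w = tt
  W-front (x ∷ xs) Z (a , g , w) = at-++⁻ 0 xs Z a , at-++⁻ q xs Z g , W-front xs Z w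

  -- Every band that starts inside an even band overlaps it and inherits its parity.
  AE-block : ∀ b bs L → length bs ≡ q → up (last b bs) ≽ b → W (b ∷ bs ++ L) → All Free (b ∷ bs ++ L) →
             Ev (b ∷ bs ++ L) → AE L → AE (bs ++ L)
  AE-block b bs L len bd w f ev ae = loop [] bs refl
    where
    loop : ∀ P Qs → bs ≡ P ++ Qs → AE (Qs ++ L)
    loop P [] e = ae
    loop P (c ∷ Qs) refl = here′ , loop (P ++ c ∷ []) Qs (sym (++-assoc P (c ∷ []) Qs))
      where
      lenE : suc (length P) + length Qs ≡ q
      lenE = trans (sym (+-suc (length P) (length Qs))) (trans (sym (length-++ P)) len)
      here′ : BandAt c (Qs ++ L) → Ev (c ∷ Qs ++ L)
      here′ bc with split-at (suc (length P)) L
          (+-cancelˡ-≤ (length Qs) _ _ (≤-trans (≤-reflexive (trans (+-comm (length Qs) _) lenE))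
          (≤-trans (band-len c (Qs ++ L) bc) (≤-reflexive (length-++ Qs)))))
      ... | y ∷ ys , R , refl , ly =
          trans (sym (overlap-parity b P c Qs y ys R (sym (suc-injective ly))
          (trans (+-suc (length P) (length Qs)) lenE)
              (subst W (cong (b ∷_) (++-assoc P (c ∷ Qs) (y ∷ ys ++ R))) w)
              (subst (λ l → up l ≽ b) (last-++ b P c Qs) bd)
              (subst (λ l → up l ≽ c) (last-++ c Qs y ys)
                  (bandAt⇒up c (Qs ++ y ∷ ys) R lenQ (subst (BandAt c) (sym (++-assoc Qs (y ∷ ys) R)) bc)))
              f1 f2 f3))
            (trans (cong (λ l → par (mass (b ∷ l))) (sym (++-assoc P (c ∷ Qs) (y ∷ ys ++ R)))) ev)
        where
        lenQ : length (Qs ++ y ∷ ys) ≡ q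
        lenQ = trans (length-++ Qs) (trans (cong (length Qs +_) ly) (trans (+-comm (length Qs) _) lenE))
        f′ : All Free (b ∷ P ++ c ∷ Qs ++ y ∷ ys ++ R)
        f′ = subst (All Free) (cong (b ∷_) (++-assoc P (c ∷ Qs) (y ∷ ys ++ R))) f
        f1 : All Free (b ∷ P)
        f1 = All.++⁻ˡ (b ∷ P) f′
        f2 : All Free (c ∷ Qs)
        f2 = All.++⁻ˡ (c ∷ Qs) (All.++⁻ʳ (b ∷ P) f′)
        f3 : All Free (y ∷ ys)
        f3 = All.++⁻ˡ (y ∷ ys) (All.++⁻ʳ (c ∷ Qs) (All.++⁻ʳ (b ∷ P) f′))

  T≡0⇒noband : ∀ y Y → T 0 (y ∷ Y) ≡ 0 → ¬ BandAt y Y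
  T≡0⇒noband y Y e bd rewrite bandAt⇒band y Y bd with e
  ... | ()

  T≡0-tail : ∀ y Y → T 0 (y ∷ Y) ≡ 0 → T 0 Y ≡ 0
  T≡0-tail y Y e = n≤0⇒n≡0 (≤-trans (T-antitone-suc 0 (y ∷ Y)) (≤-reflexive e))

  T≡0⇒AE : ∀ xs → T 0 xs ≡ 0 → AE xs
  T≡0⇒AE []       e = tt
  T≡0⇒AE (x ∷ xs) e = (λ bd → ⊥-elim (T≡0⇒noband x xs e bd)) , T≡0⇒AE xs (T≡0-tail x xs e)

  bandAt-restrict : ∀ y Y R → q ≤ length Y → BandAt y (Y ++ R) → BandAt y Y
  bandAt-restrict y Y R h bd = band⇒bandAt y Y (trans (sym (band-++ y Y R h)) (bandAt⇒band y (Y ++ R) bd))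

  -- Y contains no band, so a band that starts in Y reaches b and overlaps the block.
  AE-before-block : ∀ Y b bs L → T 0 Y ≡ 0 → length bs ≡ q → up (last b bs) ≽ b → W (Y ++ b ∷ bs ++ L) →
                    All Free (Y ++ b ∷ bs ++ L) → Ev (b ∷ bs ++ L) → AE (b ∷ bs ++ L) →
                        AE (Y ++ b ∷ bs ++ L)
  AE-before-block []      b bs L t0 len bd w f ev ae = ae
  AE-before-block (y ∷ Y) b bs L t0 len bd w f ev ae =
    here′ , AE-before-block Y b bs L (T≡0-tail y Y t0) len bd (proj₂ (proj₂ w)) (All.tail f) ev ae
    where
    here′ : BandAt y (Y ++ b ∷ bs ++ L) → Ev (y ∷ Y ++ b ∷ bs ++ L)
    here′ bc with q ≤? length Y
    ... | yes h = ⊥-elim (T≡0⇒noband y Y t0 (bandAt-restrict y Y (b ∷ bs ++ L) h bc))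
    -- A band of q + 1 parts from y contains y, Y and b, hence this many further parts of the block.
    ... | no ¬h with split-at (q ∸ suc (length Y)) bs
        (≤-trans (m∸n≤m q (suc (length Y))) (≤-reflexive (sym len)))
    ...   | ms , [] , refl , lm = ⊥-elim
        (<-irrefl (trans (sym lm) (trans (cong length (sym (++-identityʳ ms))) len))
        (∸-monoʳ-< (s≤s z≤n) (≰⇒> ¬h)))
    ...   | ms , c ∷ cs , refl , lm =
        trans (cong par (cong (λ l → mass (y ∷ Y ++ b ∷ l)) (++-assoc ms (c ∷ cs) L)))
             (trans (overlap-parity y Y b ms c cs L lcs lY (subst W eqL w)
               (subst (λ l → up l ≽ y) (last-++ y Y b ms)
                   (bandAt⇒up y (Y ++ b ∷ ms) (c ∷ cs ++ L) (trans (length-++ Y) lY)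
                  (subst (BandAt y) (trans (cong (λ l → Y ++ b ∷ l) (++-assoc ms (c ∷ cs) L))
                      (sym (++-assoc Y (b ∷ ms) (c ∷ cs ++ L)))) bc)))
               (subst (λ l → up l ≽ b) (last-++ b ms c cs) bd)
               (All.++⁻ˡ (y ∷ Y) f′) (All.++⁻ˡ (b ∷ ms) (All.++⁻ʳ (y ∷ Y) f′))
                   (All.++⁻ˡ (c ∷ cs) (All.++⁻ʳ (b ∷ ms) (All.++⁻ʳ (y ∷ Y) f′))))
             (trans (cong par (cong (λ l → mass (b ∷ l)) (sym (++-assoc ms (c ∷ cs) L)))) ev))
      where
      eqL : y ∷ Y ++ b ∷ (ms ++ c ∷ cs) ++ L ≡ y ∷ Y ++ b ∷ ms ++ c ∷ cs ++ L
      eqL = cong (λ l → y ∷ Y ++ b ∷ l) (++-assoc ms (c ∷ cs) L)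
      f′ : All Free (y ∷ Y ++ b ∷ ms ++ c ∷ cs ++ L)
      f′ = subst (All Free) eqL f
      lY : length Y + suc (length ms) ≡ q
      lY = trans (+-suc (length Y) (length ms)) (trans (cong (suc (length Y) +_) lm) (m+[n∸m]≡n (≰⇒> ¬h)))
      lcs : length Y ≡ length cs
      lcs = sym (suc-injective (+-cancelˡ-≡ (length ms) _ _
          (trans (sym (length-++ ms)) (trans len
          (trans (sym lY) (trans (+-suc (length Y) (length ms)) (+-comm (suc (length Y)) (length ms))))))))

  AE-tl-top : ∀ S φ → Top S φ → AE φ → AE (tl (#blk S) 0 (flatT S φ))
  AE-tl-top [] φ top ae = subst AE (sym (tl-zero φ)) ae
  AE-tl-top (blk b as ∷ S) φ (len , η≤b , tb , top) ae =
    subst AE (sym (tl-band (#blk S) as (down b) (flatT S φ) len (topBand⇒headBand as b η≤b tb)))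
        (AE-tl-top S φ top ae)
  AE-tl-top (one x ∷ S) φ (g , top) ae with #blk S in e | AE-tl-top S φ top ae
  ... | zero  | ih = (λ bd → ⊥-elim (noBand bd)) , subst AE (tl-zero (flatT S φ)) ih
    where
    noBand : ¬ BandAt x (flatT S φ)
    noBand bd with trans (sym (gap⇒noband x (flatT S φ) g)) (bandAt⇒band x (flatT S φ) bd)
    ... | ()
  ... | suc N | ih = subst AE (sym (tl-noband N x (flatT S φ) g)) ih

  -- The lower end: virtual zeros and condition (4).

  zero₀ : Part
  zero₀ = part 0 false

  -- Virtual parts of size 0: condition (4) becomes condition (3) for xs ++ Z.
  Z : List Part
  Z = replicate (suc (suc q) ∸ r) zero₀

  free-zero : Free zero₀
  free-zero = mkFree (λ ()) (λ _ → m<n⇒m%n≡m 1≤η)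

  at-replicate : {P : Part → Set} → ∀ i n → i < n → at i (replicate n zero₀) P → P zero₀
  at-replicate zero    (suc n) h       p = p
  at-replicate (suc i) (suc n) (s≤s h) p = at-replicate i n h p

  nth-replicate : ∀ i n {y} → nth (replicate n zero₀) i ≡ just y → y ≡ zero₀
  nth-replicate zero    (suc n) refl = refl
  nth-replicate (suc i) (suc n) e    = nth-replicate i n e

  #ov-Z : ∀ n → #ov (replicate n zero₀) ≡ 0
  #ov-Z zero    = refl
  #ov-Z (suc n) = #ov-Z n

  sumF-Z : ∀ n → sumF (replicate n zero₀) ≡ 0
  sumF-Z zero    = refl
  sumF-Z (suc n) = trans (cong (_+ sumF (replicate n zero₀)) (0/n≡0 η)) (sumF-Z n)

  all-Z : {P : Part → Set} → P zero₀ → All P Z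
  all-Z p = All.replicate⁺ _ p

  take-++ˡ : ∀ n (xs ys : List Part) → n ≤ length xs → take n (xs ++ ys) ≡ take n xs
  take-++ˡ zero    xs       ys h       = refl
  take-++ˡ (suc n) (x ∷ xs) ys (s≤s h) = cong (x ∷_) (take-++ˡ n xs ys h)

  mass-Z : ∀ xs → suc q ≤ length xs → mass (xs ++ Z) ≡ mass xs
  mass-Z xs h = cong₂ _+_ (cong sumF (take-++ˡ (suc q) xs Z h))
    (trans (#ov-++ xs Z) (trans (cong (#ov xs +_) (#ov-Z (suc (suc q) ∸ r))) (+-identityʳ _)))

  Pos : Part → Set
  Pos x = 1 ≤ size x

  unit : ∀ u → Free u → Pos u → size u ≤ η → F u + ov u ≡ 1
  unit u f p h = go (over u) refl
    where
    F0 : size u < η → F u ≡ 0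
    F0 h = m<n⇒m/n≡0 h
    go : ∀ b → over u ≡ b → F u + (if b then 1 else 0) ≡ 1
    go true  e = cong (_+ 1) (F0 (≤∧≢⇒< h (λ s → proj₂ (Free.over⇒ f e) (trans (cong (_% η) s) (n%n≡0 η)))))
    go false e with m≤n⇒m<n∨m≡n h
    ... | inj₁ s = ⊥-elim (<-irrefl (sym (trans (sym (m<n⇒m%n≡m s)) (Free.plain⇒ f e))) p)
    ... | inj₂ s = trans (+-identityʳ _) (trans (cong (_/ η) s) (n/n≡1 η))

  units : ∀ xs → All Free xs → All Pos xs → All (λ u → size u ≤ η) xs → sumF xs + #ov xs ≡ length xs
  units [] f p h = refl
  units (x ∷ xs) (f ∷ fs) (p ∷ ps) (h ∷ hs) =
    trans (solve 4 (λ a b c d → a :+ b :+ (c :+ d) := a :+ c :+ (b :+ d)) refl (F x) (sumF xs) (ov x)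
        (#ov xs))
      (cong₂ _+_ (unit x f p h) (units xs fs ps hs))

  W⇒≤head : ∀ x xs → W (x ∷ xs) → All (λ u → size u ≤ size x) (x ∷ xs)
  W⇒≤head x []       w = ≤-refl ∷ []
  W⇒≤head x (y ∷ xs) w = ≤-refl ∷ All.map (λ h → ≤-trans h (≽⇒≥ x y (proj₁ w)))
      (W⇒≤head y xs (proj₂ (proj₂ w)))

  |Z| : length Z + r ≡ suc (suc q)
  |Z| = trans (cong (_+ r) (length-replicate _)) (m∸n+n≡m r≤k)

  -- A part not above the plain part η has no gap to 0, so the last zero is less than k - 1 places
  -- below it. With k - r zeros this is exactly the bound of (4).
  small-count : ∀ e xs → W (e ∷ xs ++ Z) → All Pos xs → size e + ov e ≤ η → suc (length xs) < r
  small-count e xs w ps h = ≰⇒> λ r≤ → bad r≤ (q <? length xs)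
    where
    bad : r ≤ suc (length xs) → Dec (q < length xs) → ⊥
    bad r≤ (yes k) with split-at q xs (<⇒≤ k)
    ... | as , [] , refl , refl = <-irrefl (trans (sym (+-identityʳ _)) (sym (length-++ as))) k
    ... | as , y ∷ R , refl , refl =
        <-irrefl refl (≤-trans (s≤s (m+n≤o⇒m≤o (size e) h))
        (≤-trans (+-monoˡ-≤ η (All.head (All.++⁻ʳ as ps)))
           (gap⇒+η≤ e y (at→ as {y ∷ R ++ Z} 0 (+-identityʳ _)
               (subst (λ l → at q l (Gap e)) (++-assoc as (y ∷ R) Z) (proj₁ (proj₂ w)))))))
    bad r≤ (no ¬k) = up⇒¬gap e zero₀ h (at-replicate (q ∸ length xs) (suc (suc q) ∸ r) lt
      (at→ xs {Z} (q ∸ length xs) (m+[n∸m]≡n (≮⇒≥ ¬k)) (proj₁ (proj₂ w))))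
      where
      lt : q ∸ length xs < suc (suc q) ∸ r
      lt = m+n≤o⇒m≤o∸n (suc (q ∸ length xs)) (s≤s (≤-trans (+-monoʳ-≤ (q ∸ length xs) r≤)
        (≤-reflexive (trans (+-suc _ _) (cong suc (m∸n+n≡m (≮⇒≥ ¬k)))))))

  -- The list then has exactly r - 1 real parts. By `unit` each adds 1 to the mass, either as the
  -- plain part η or by its overline, so the mass is r - 1; here the r of (5) meets the r of (4).
  small-window-even : ∀ xs → W (xs ++ Z) → All Free xs → All Pos xs → at 0 xs (λ e → size e + ov e ≤ η) →
                      suc q ≤ length (xs ++ Z) → par (mass (xs ++ Z)) ≡ par (suc r)
  small-window-even xs w fs ps h long =
      trans (cong par mass≡) (trans (sym (par-double 1 (length xs)))
      (cong par (trans (solve 1 (λ n → n :+ con 2 := con 1 :+ (con 1 :+ n)) refl (length xs))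
      (cong suc (sym r≡)))))
    where
    cnt< : suc (length xs) ≤ r
    cnt< = go xs w ps h
      where
      go : ∀ xs → W (xs ++ Z) → All Pos xs → at 0 xs (λ e → size e + ov e ≤ η) → suc (length xs) ≤ r
      go []       w ps       h = 1≤r
      go (e ∷ xs) w (_ ∷ ps) h = small-count e xs w ps h
    r≤ : r ≤ suc (length xs)
    r≤ = +-cancelˡ-≤ (suc q) _ _ (≤-trans (+-monoˡ-≤ r (≤-trans long (≤-reflexive (length-++ xs))))
      (≤-reflexive (trans (+-assoc (length xs) _ r)
          (trans (cong (length xs +_) |Z|)
          (solve 2 (λ n q → n :+ (con 2 :+ q) := con 1 :+ q :+ (con 1 :+ n)) refl (length xs) q)))))
    r≡ : r ≡ suc (length xs)
    r≡ = ≤-antisym r≤ cnt<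
    tot : length (xs ++ Z) ≡ suc q
    tot = +-cancelʳ-≡ r _ _ (trans (cong (_+ r) (length-++ xs))
        (trans (+-assoc (length xs) _ r) (trans (cong (length xs +_) |Z|)
      (trans (solve 2 (λ n q → n :+ (con 2 :+ q) := con 1 :+ q :+ (con 1 :+ n)) refl (length xs) q)
          (cong (suc q +_) (sym r≡))))))
    small : All (λ u → size u ≤ η) xs
    small = go xs w h
      where
      go : ∀ xs → W (xs ++ Z) → at 0 xs (λ e → size e + ov e ≤ η) → All (λ u → size u ≤ η) xs
      go []       w h = []
      go (e ∷ xs) w h = All.map (λ k → ≤-trans k (m+n≤o⇒m≤o (size e) h))
          (All.++⁻ˡ (e ∷ xs) (W⇒≤head e (xs ++ Z) w))
    mass≡ : mass (xs ++ Z) ≡ length xs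
    mass≡ = trans (cong₂ _+_ (trans (cong sumF (take-all (suc q) (xs ++ Z) (≤-reflexive tot)))
        (trans (sumF-++ xs Z) (trans (cong (sumF xs +_) (sumF-Z (suc (suc q) ∸ r))) (+-identityʳ _))))
        (trans (#ov-++ xs Z) (trans (cong (#ov xs +_) (#ov-Z (suc (suc q) ∸ r))) (+-identityʳ _))))
      (units xs fs ps small)

  -- Why an odd block can be moved back.

  leading : ∀ i S → (∃[ cs ] ∃[ b ] ∃[ as ] ∃[ R ] (S ≡ map one cs ++ blk b as ∷ R × length cs ≤ i))
                  ⊎ (∀ (P : Part → Set) → atS i S P → at i (rotT S []) P)
  leading i       []             = inj₂ (λ P _ → tt)
  leading i       (blk b as ∷ S) = inj₁ ([] , b , as , S , refl , z≤n)
  leading zero    (one x ∷ S)    = inj₂ (λ P p → p)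
  leading (suc i) (one x ∷ S) with leading i S
  ... | inj₁ (cs , b , as , R , refl , h) = inj₁ (x ∷ cs , b , as , R , refl , s≤s h)
  ... | inj₂ f = inj₂ f

  nth-++ʳ : {B : Set} → ∀ (xs ys : List B) i → length xs ≤ i → nth (xs ++ ys) i ≡ nth ys (i ∸ length xs)
  nth-++ʳ []       ys i       h       = refl
  nth-++ʳ (x ∷ xs) ys (suc i) (s≤s h) = nth-++ʳ xs ys i h

  short⇒T≡0 : ∀ xs → length xs ≤ q → T 0 xs ≡ 0
  short⇒T≡0 xs h with T 0 xs in e
  ... | zero  = refl
  ... | suc n = ⊥-elim (<-irrefl refl (≤-trans (T-pos⇒len 0 xs (subst (1 ≤_) (sym e) (s≤s z≤n))) h))

  snoc-cons : ∀ {B : Set} (as : List B) y → ∃[ c ] ∃[ cs ] (as ++ y ∷ [] ≡ c ∷ cs × length cs ≡ length as)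
  snoc-cons []       y = y , [] , refl , refl
  snoc-cons (a ∷ as) y = a , as ++ y ∷ [] , refl , trans (length-++ as) (+-comm (length as) 1)

  last-snoc : ∀ as y c cs → as ++ y ∷ [] ≡ c ∷ cs → last c cs ≡ y
  last-snoc []            y c cs refl = refl
  last-snoc (a ∷ [])      y c cs refl = refl
  last-snoc (a ∷ a′ ∷ as) y c cs refl = last-snoc (a′ ∷ as) y a′ (as ++ y ∷ []) refl

  -- Bands that touch have equal parity, so an odd block can move back without
  -- running into the even bands below it.
  module OddBlock (b : Part) (as : List Part) (S : List Seg) (len : length as ≡ q) (bd : up (last b as) ≽ b)
                  (inn : Inner as S) (bg : BG S) (w : W (b ∷ as ++ rotT S [] ++ Z))
                  (fs : All Free (b ∷ as ++ rotT S [])) (ps : All Pos (b ∷ as ++ rotT S []))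
                  (odd : ¬ Ev (b ∷ as ++ rotT S [])) (ae : AE (rotT S [])) where
    L LZ : List Part
    L = rotT S []
    LZ = L ++ Z

    fL : All Free L
    fL = All.++⁻ʳ (b ∷ as) fs

    pL : All Pos L
    pL = All.++⁻ʳ (b ∷ as) ps

    wLZ : W LZ
    wLZ = W-++ʳ (b ∷ as) w

    assocZ : (b ∷ as ++ L) ++ Z ≡ b ∷ as ++ LZ
    assocZ = ++-assoc (b ∷ as) L Z

    long : suc q ≤ length (b ∷ as ++ L)
    long = s≤s (≤-trans (≤-reflexive (sym len)) (≤-trans (m≤m+n _ _) (≤-reflexive (sym (length-++ as)))))

    oddZ : ¬ par (mass (b ∷ as ++ LZ)) ≡ par (suc r)
    oddZ e = odd (trans (cong par (sym (trans (cong mass (sym assocZ)) (mass-Z (b ∷ as ++ L) long)))) e)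

    -- Otherwise the block would be a small window and hence even. Strictness makes `down b`
    -- positive.
    η<b : η < size b
    η<b with size b + ov b ≤? η
    ... | yes h = ⊥-elim (oddZ (trans (cong (par ∘ mass) (sym assocZ))
          (small-window-even (b ∷ as ++ L) (subst W (sym assocZ) w) fs ps h
              (≤-trans long (≤-trans (m≤m+n _ _) (≤-reflexive (sym (length-++ (b ∷ as ++ L)))))))))
    ... | no ¬h = go (over b) refl (≰⇒> ¬h)
      where
      go : ∀ o → over b ≡ o → η < size b + (if o then 1 else 0) → η < size b
      go false e k = subst (η <_) (+-identityʳ _) k
      go true  e k = ≤∧≢⇒< (s≤s⁻¹ (subst (η <_) (+-comm (size b) 1) k))
        (λ s → proj₂ (Free.over⇒ (All.head fs) e) (trans (cong (_% η) (sym s)) (n%n≡0 η)))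

    η≤b : η ≤ size b
    η≤b = <⇒≤ η<b

    -- A band from a would overlap the odd block and so be odd. But it is even: if it reaches a
    -- zero, by `small-window-even`; if not, bottom-greediness puts the start of a lower block
    -- within its reach, which is even by `ae` and passes its parity on.
    no-overlap : ∀ P a Qs → as ≡ P ++ a ∷ Qs → at (length P) LZ (Gap a)
    no-overlap P a Qs refl = at-nth (length P) LZ λ {y} e → go y e (gap? a y)
      where
      lenE : length P + suc (length Qs) ≡ q
      lenE = trans (sym (length-++ P)) len
      go : ∀ y → nth LZ (length P) ≡ just y → Dec (Gap a y) → Gap a y
      go y e (yes g) = g
      go y e (no ¬g) with nth-split (length P) LZ e
      ... | ys , R , eq , ly with snoc-cons ys y
      ...   | c , cs , eq′ , lc = ⊥-elim
          (evenE (λ ev → oddZ (trans (trans (cong (λ l → par (mass (b ∷ l))) eqL) same-par) ev)))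
        where
        LZ≡ : LZ ≡ c ∷ cs ++ R
        LZ≡ = trans eq (trans (sym (++-assoc ys (y ∷ []) R)) (cong (_++ R) eq′))
        eqL : (P ++ a ∷ Qs) ++ LZ ≡ P ++ a ∷ Qs ++ c ∷ cs ++ R
        eqL = trans (++-assoc P (a ∷ Qs) LZ) (cong (λ l → P ++ a ∷ Qs ++ l) LZ≡)
        fLZ : All Free (c ∷ cs ++ R)
        fLZ = subst (All Free) LZ≡ (All.++⁺ fL (all-Z free-zero))
        fas : All Free (P ++ a ∷ Qs)
        fas = All.++⁻ˡ (P ++ a ∷ Qs) (All.tail fs)
        same-par : par (mass (b ∷ P ++ a ∷ Qs ++ c ∷ cs ++ R)) ≡ par (mass (a ∷ Qs ++ c ∷ cs ++ R))
        same-par = overlap-parity b P a Qs c cs R (sym (trans lc ly)) lenE (subst W (cong (b ∷_) eqL) w)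
          (subst (λ l → up l ≽ b) (last-++ b P a Qs) bd)
          (subst (λ l → up l ≽ a) (sym (last-snoc ys y c cs eq′)) (¬gap⇒up a y ¬g))
          (All.head fs ∷ All.++⁻ˡ P fas) (All.++⁻ʳ P fas) (All.++⁻ˡ (c ∷ cs) fLZ)
        evenE : ¬ ¬ par (mass (a ∷ Qs ++ c ∷ cs ++ R)) ≡ par (suc r)
        evenE with length P <? length L
        ... | no ¬real = λ k → k (trans (cong (λ l → par (mass (a ∷ Qs ++ l))) (sym LZ≡))
            (trans (cong (par ∘ mass) (sym (++-assoc (a ∷ Qs) L Z)))
              (small-window-even (a ∷ Qs ++ L) (subst W (sym (++-assoc (a ∷ Qs) L Z)) waZ)
                  (All.++⁺ (All.++⁻ʳ P fas) fL) (All.++⁺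
                  (All.++⁻ʳ P (All.++⁻ˡ (P ++ a ∷ Qs) (All.tail ps))) pL)
                (≤-trans (¬gap⇒up a y ¬g) (≤-reflexive (cong (λ z → size z + η) y≡0)))
                (≤-trans (≤-reflexive (cong suc (sym lenE))) longE))))
          where
          waZ : W ((a ∷ Qs) ++ L ++ Z)
          waZ = W-++ʳ (b ∷ P) (subst W (cong (b ∷_) (++-assoc P (a ∷ Qs) LZ)) w)
          y≡0 : y ≡ zero₀
          y≡0 = nth-replicate (length P ∸ length L) (suc (suc q) ∸ r)
              (trans (sym (nth-++ʳ L Z (length P) (≮⇒≥ ¬real))) e)
          longE : suc (length P + suc (length Qs)) ≤ length ((a ∷ Qs ++ L) ++ Z)
          longE = ≤-trans (s≤s (≤-trans (≤-reflexive
              (trans (+-suc (length P) (length Qs)) (trans (+-comm (suc (length P)) (length Qs)) refl)))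
            (≤-trans (+-monoʳ-≤ (length Qs) (nth-just⇒< (length P) LZ e))
                (≤-reflexive (sym (length-++ Qs))))))
                (≤-reflexive (sym (cong length (++-assoc (a ∷ Qs) L Z))))
        ... | yes real with leading (length P) S
        ...   | inj₂ f = λ _ → ¬g (nth-at (length P) L (f (Gap a) (atS-inner P inn))
            (trans (sym (nth-++ (length P) L Z real)) e))
          where
          atS-inner : ∀ P′ → Inner (P′ ++ a ∷ Qs) S → atS (length P) S (Gap a)
          atS-inner []       (g , _) = atS→ Qs (length P) refl
              (subst (λ n → atS n (one a ∷ map one Qs ++ S) (Gap a))
              (trans (sym lenE) (trans (+-suc (length P) (length Qs))
              (cong suc (+-comm (length P) (length Qs))))) g)
          atS-inner (p ∷ P′) (_ , i) = atS-inner P′ i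
        ...   | inj₁ (xs , b₂ , as₂ , S₃ , S≡ , h) =
            λ k → k (trans (trans (cong (λ l → par (mass (a ∷ Qs ++ l))) (sym LZ≡))
              (cong par (trans (cong mass (sym (++-assoc (a ∷ Qs) L Z)))
                  (mass-Z (a ∷ Qs ++ L) longR)))) evR)
          where
          bg₂ : BG (blk b₂ as₂ ∷ S₃)
          bg₂ = proj₂ (BG-split xs (subst BG S≡ bg))
          L≡ : L ≡ xs ++ b₂ ∷ as₂ ++ rotT S₃ []
          L≡ = trans (cong (λ S → rotT S []) S≡) (rotT-map xs (blk b₂ as₂ ∷ S₃) [])
          longR : suc q ≤ length (a ∷ Qs ++ L)
          longR = s≤s (≤-trans (≤-reflexive
              (trans (sym lenE) (trans (+-suc (length P) (length Qs))
              (+-comm (suc (length P)) (length Qs)))))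
              (≤-trans (+-monoʳ-≤ (length Qs) real) (≤-reflexive (sym (length-++ Qs)))))
          bandE : BandAt a (Qs ++ L)
          bandE = bandAt-restrict a (Qs ++ L) Z (s≤s⁻¹ longR)
              (subst (BandAt a) (trans (++-assoc Qs (c ∷ cs) R)
              (trans (cong (Qs ++_) (sym LZ≡)) (sym (++-assoc Qs L Z))))
            (rotBand a (Qs ++ c ∷ cs) R (trans (length-++ Qs)
                (trans (cong (λ n → length Qs + suc n) (trans lc ly))
                (trans (+-comm (length Qs) (suc (length P)))
                (trans (sym (+-suc (length P) (length Qs))) lenE))))
              (subst (λ l → up l ≽ a) (sym (trans (last-++ a Qs c cs) (last-snoc ys y c cs eq′)))
                  (¬gap⇒up a y ¬g))))
          ae₂ : AE (b₂ ∷ as₂ ++ rotT S₃ [])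
          ae₂ = AE-suf xs _ (subst AE L≡ ae)
          aQL : a ∷ Qs ++ L ≡ (a ∷ Qs ++ xs) ++ b₂ ∷ as₂ ++ rotT S₃ []
          aQL = trans (cong (λ l → a ∷ Qs ++ l) L≡) (sym (++-assoc (a ∷ Qs) xs _))
          wR : W ((a ∷ Qs) ++ L)
          wR = W-front ((a ∷ Qs) ++ L) Z
              (subst W (sym (++-assoc (a ∷ Qs) L Z))
              (W-++ʳ (b ∷ P) (subst W (cong (b ∷_) (++-assoc P (a ∷ Qs) LZ)) w)))
          evR : Ev (a ∷ Qs ++ L)
          evR = proj₁ (subst AE (sym aQL) (AE-before-block (a ∷ Qs ++ xs) b₂ as₂ (rotT S₃ [])
            (short⇒T≡0 (a ∷ Qs ++ xs) (≤-trans
                (s≤s (≤-trans (≤-reflexive (length-++ Qs)) (+-monoʳ-≤ (length Qs) h)))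
                (≤-reflexive (trans (+-comm (suc (length Qs)) (length P)) lenE))))
            (proj₁ bg₂) (proj₁ (proj₂ bg₂)) (subst W aQL wR)
                (subst (All Free) aQL (All.++⁺ (All.++⁻ʳ P fas) fL))
            (proj₁ ae₂ (rotBand b₂ as₂ (rotT S₃ []) (proj₁ bg₂) (proj₁ (proj₂ bg₂)))) ae₂)) bandE

    innerGap : InnerGap as (down b ∷ LZ)
    innerGap = go [] as refl
      where
      go : ∀ P Qs → as ≡ P ++ Qs → InnerGap Qs (down b ∷ LZ)
      go P []       e = tt
      go P (a ∷ Qs) e = at← Qs {down b ∷ LZ} (suc (length P)) lenE (no-overlap P a Qs e) ,
                        go (P ++ a ∷ []) Qs (trans e (sym (++-assoc P (a ∷ []) Qs)))
        where
        lenE : length Qs + suc (length P) ≡ q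
        lenE = trans (+-suc (length Qs) (length P)) (trans (cong suc (+-comm (length Qs) (length P)))
          (trans (sym (+-suc (length P) (length Qs)))
              (trans (sym (length-++ P)) (trans (cong length (sym e)) len))))

    -- If the gap failed at y, then y + 2η would still reach b. The q + 1 parts after the block
    -- would form a band, even like all bands there, and `adjacent-parity` would make the block
    -- even.
    clear-below : at q LZ (Gap (down b))
    clear-below = at-nth q LZ λ {y} e → go y e (gap? (down b) y)
      where
      go : ∀ y → nth LZ q ≡ just y → Dec (Gap (down b) y) → Gap (down b) y
      go y e (yes g) = g
      go y e (no ¬g) with nth-split q LZ e
      ... | ys , R , eq , ly with snoc-cons ys y
      ...   | c , cs , eq′ , lc = ⊥-elim
          (oddZ (trans (cong (λ l → par (mass (b ∷ as ++ l))) LZ≡)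
          (trans same-par (trans (cong (par ∘ mass) (sym LZ≡)) evenE))))
        where
        LZ≡ : LZ ≡ c ∷ cs ++ R
        LZ≡ = trans eq (trans (sym (++-assoc ys (y ∷ []) R)) (cong (_++ R) eq′))
        fLZ : All Free (c ∷ cs ++ R)
        fLZ = subst (All Free) LZ≡ (All.++⁺ fL (all-Z free-zero))
        up²y : up² y ≽ b
        up²y = ≤-trans (≤-reflexive (trans (cong (_+ ov b) (sym (down+η b η≤b)))
            (solve 3 (λ a b c → a :+ b :+ c := a :+ c :+ b) refl (size (down b)) η (ov b))))
          (+-monoˡ-≤ η (¬gap⇒up (down b) y ¬g))
        lcs : length cs ≡ q
        lcs = trans lc ly
        last≡ : last c cs ≡ y
        last≡ = last-snoc ys y c cs eq′
        same-par : par (mass (b ∷ as ++ c ∷ cs ++ R)) ≡ par (mass (c ∷ cs ++ R))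
        same-par = adjacent-parity b as c cs R len lcs (subst (λ l → W (b ∷ as ++ l)) LZ≡ w)
          (subst (λ l → up² l ≽ b) (sym last≡) up²y) (All.++⁻ˡ (b ∷ as) fs) (All.++⁻ˡ (c ∷ cs) fLZ)
        up-c : up y ≽ c
        up-c = ≤-trans (+-monoʳ-≤ (size c) (ov≤1 c)) (≤-trans (≤-reflexive (+-comm (size c) 1))
          (gap-squeeze b {size c} {size y + η}
              (at→ as {c ∷ cs ++ R} 0 (trans (+-identityʳ _) len)
              (subst (λ l → at q (as ++ l) (Gap b)) LZ≡ (proj₁ (proj₂ w)))) up²y))
        q<LZ : q < length LZ
        q<LZ = nth-just⇒< q LZ e
        evenE : par (mass LZ) ≡ par (suc r)
        evenE with q <? length L
        ... | no ¬real = small-window-even L wLZ fL pL (hd L LZ≡) q<LZ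
          where
          y≡0 : y ≡ zero₀
          y≡0 = nth-replicate (q ∸ length L) (suc (suc q) ∸ r) (trans (sym (nth-++ʳ L Z q (≮⇒≥ ¬real))) e)
          hd : ∀ L → L ++ Z ≡ c ∷ cs ++ R → at 0 L (λ u → size u + ov u ≤ η)
          hd []      e = tt
          hd (u ∷ _) e = subst (λ u → size u + ov u ≤ η) (sym (proj₁ (∷-injective e)))
              (≤-trans up-c (≤-reflexive (cong (λ z → size z + η) y≡0)))
        ... | yes real = trans (cong par (mass-Z L real)) (hd L real LZ≡ ae)
          where
          hd : ∀ L → q < length L → L ++ Z ≡ c ∷ cs ++ R → AE L → Ev L
          hd (u ∷ L′) real e ae with ∷-injective e
          ... | refl , e′ = proj₁ ae (bandAt-restrict c L′ Z (s≤s⁻¹ real)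
            (subst (BandAt c) (sym e′) (rotBand c cs R lcs (subst (λ l → up l ≽ c) (sym last≡) up-c))))

    head-below : at 0 LZ (down b ≽_)
    head-below = go as len innerGap (topBand b as η≤b w)
      where
      go : ∀ as → length as ≡ q → InnerGap as (down b ∷ LZ) → TopBand as b → at 0 LZ (down b ≽_)
      go [] refl ig tb = at-map 0 LZ (λ {y} g →
          ≤-trans (+-monoʳ-≤ (size y) (≤-trans (ov≤1 y) 1≤η)) (gap⇒+η≤ (down b) y g)) clear-below
      go (a ∷ as) refl (g , _) tb = at-map 0 LZ
        (λ {y} g → ≤-trans (+-monoʳ-≤ (size y) (ov≤1 y))
            (≤-trans (≤-reflexive (+-comm (size y) 1))
            (gap-squeeze a g (≤-trans tb (≤-reflexive (sym (down+η b η≤b)))))))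
        (at→ as {down b ∷ LZ} 1 (+-comm (length as) 1) g)

    tails : Tails b (as ++ LZ) (as ++ down b ∷ LZ)
    tails = tails-blk b as LZ len η≤b bd w innerGap clear-below head-below

  -- TS N xs S M L: scanning xs from the top with N still to be inserted, the
  -- segments S are moved and the rest L is left alone; M is then the size (over η)
  -- of the overlined multiple of η put in between, and M = 0 means that none is.
  data TS : ℕ → List Part → List Seg → ℕ → List Part → Set where
    done  : ∀ {xs} → TS 0 xs [] 0 xs
    end   : ∀ {N} → TS (suc N) [] [] (suc N) []
    stop₁ : ∀ {N x xs} → at q (x ∷ xs) (Gap x) → size x ≤ suc N * η →
        TS (suc N) (x ∷ xs) [] (suc N) (x ∷ xs)
    stopᵇ : ∀ {N x xs} (bd : BandAt x xs) → size (BandAt.end bd) ≤ N * η →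
        TS (suc N) (x ∷ xs) [] (suc N) (x ∷ xs)
    one   : ∀ {N x xs S M L} → at q (x ∷ xs) (Gap x) → suc N * η < size x → TS (suc N) xs S M L →
            TS (suc N) (x ∷ xs) (one x ∷ S) M L
    blk   : ∀ {N x xs S M L} (bd : BandAt x xs) → N * η < size (BandAt.end bd) →
        TS N (BandAt.rest bd) S M L →
            TS (suc N) (x ∷ xs) (blk (up (BandAt.end bd)) (BandAt.front bd) ∷ S) M L

  -- The scan that performs an insertion.

  gap∧band : ∀ {x xs} → at q (x ∷ xs) (Gap x) → ¬ BandAt x xs
  gap∧band {x} {xs} g bd with trans (sym (gap⇒noband x xs g)) (bandAt⇒band x xs bd)
  ... | ()

  split-unique : ∀ {B : Set} (as as′ : List B) {z z′ R R′} → as ++ z ∷ R ≡ as′ ++ z′ ∷ R′ →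
      length as ≡ length as′ →
                 as ≡ as′ × z ≡ z′ × R ≡ R′
  split-unique []       []         refl l = refl , refl , refl
  split-unique (a ∷ as) (a′ ∷ as′) e    l with ∷-injective e
  ... | refl , e′ with split-unique as as′ e′ (suc-injective l)
  ...   | refl , z , R = refl , z , R

  bandAt-unique : ∀ {x xs} (bd bd′ : BandAt x xs) → BandAt.front bd ≡ BandAt.front bd′ ×
      BandAt.end bd ≡ BandAt.end bd′ × BandAt.rest bd ≡ BandAt.rest bd′
  bandAt-unique (mkBand as z R e l _) (mkBand as′ z′ R′ e′ l′ _) =
      split-unique as as′ (trans (sym e) e′) (trans l (sym l′))

  TS-det : ∀ {N xs S M L S′ M′ L′} → TS N xs S M L → TS N xs S′ M′ L′ → (S , M , L) ≡ (S′ , M′ , L′)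
  TS-det done done = refl
  TS-det end end = refl
  TS-det (stop₁ g h) (stop₁ _ _) = refl
  TS-det (stop₁ g h) (stopᵇ _ _) = refl
  TS-det (stop₁ g h) (one _ k _) = ⊥-elim (<-irrefl refl (≤-trans k h))
  TS-det (stop₁ g h) (blk bd _ _) = ⊥-elim (gap∧band g bd)
  TS-det (stopᵇ _ _) (stop₁ _ _) = refl
  TS-det (stopᵇ _ _) (stopᵇ _ _) = refl
  TS-det (stopᵇ bd _) (one g _ _) = ⊥-elim (gap∧band g bd)
  TS-det {N = suc N} (stopᵇ bd h) (blk bd′ k _) =
      ⊥-elim (<-irrefl refl (≤-trans k
      (subst (λ z → size z ≤ N * η) (proj₁ (proj₂ (bandAt-unique bd bd′))) h)))
  TS-det (one g k _) (stop₁ _ h) = ⊥-elim (<-irrefl refl (≤-trans k h))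
  TS-det (one g _ _) (stopᵇ bd _) = ⊥-elim (gap∧band g bd)
  TS-det (one g k t) (one _ _ t′) with TS-det t t′
  ... | refl = refl
  TS-det (one g _ _) (blk bd _ _) = ⊥-elim (gap∧band g bd)
  TS-det (blk bd _ _) (stop₁ g _) = ⊥-elim (gap∧band g bd)
  TS-det {N = suc N} (blk bd k _) (stopᵇ bd′ h) =
      ⊥-elim (<-irrefl refl (≤-trans k
      (subst (λ z → size z ≤ N * η) (proj₁ (proj₂ (bandAt-unique bd′ bd))) h)))
  TS-det (blk bd _ _) (one g _ _) = ⊥-elim (gap∧band g bd)
  TS-det (blk bd k t) (blk bd′ k′ t′) with bandAt-unique bd bd′
  TS-det (blk (mkBand as z R e l g) k t) (blk (mkBand .as .z .R e′ l′ g′) k′ t′) | refl , refl ,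
      refl with TS-det t t′
  ... | refl = refl

  TS-exists : ∀ f N xs → length xs ≤ f → ∃[ S ] ∃[ M ] ∃[ L ] TS N xs S M L
  TS-exists f zero xs h = [] , 0 , xs , done
  TS-exists f (suc N) [] h = [] , suc N , [] , end
  TS-exists (suc f) (suc N) (x ∷ xs) (s≤s h) with bandᵇ x xs | bview x xs
  ... | .false | noband g with size x ≤? suc N * η
  ...   | yes k = [] , suc N , x ∷ xs , stop₁ g k
  ...   | no ¬k with TS-exists f (suc N) xs h
  ...     | S , M , L , t = one x ∷ S , M , L , one g (≰⇒> ¬k) t
  TS-exists (suc f) (suc N) (x ∷ xs) (s≤s h) | .true | band bd with size (BandAt.end bd) ≤? N * η
  ...   | yes k = [] , suc N , x ∷ xs , stopᵇ bd k
  ...   | no ¬k with TS-exists f N (BandAt.rest bd) (≤-trans (rest≤ bd) h)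
    where
    rest≤ : ∀ {x xs} (bd : BandAt x xs) → length (BandAt.rest bd) ≤ length xs
    rest≤ (mkBand [] z R refl l _) = ≤-refl
    rest≤ (mkBand (a ∷ as) z R refl l _) =
        ≤-trans (n≤1+n _) (≤-trans (m≤n+m _ (length as)) (≤-reflexive (sym (length-++ as))))
  ...     | S , M , L , t = blk _ _ ∷ S , M , L , blk bd (≰⇒> ¬k) t

  down-up : ∀ z → down (up z) ≡ z
  down-up z = cong (λ s → part s (over z)) (m+n∸n≡m (size z) η)

  TS-flat : ∀ {N xs S M L} → TS N xs S M L → xs ≡ flatT S L
  TS-flat done = refl
  TS-flat end = refl
  TS-flat (stop₁ _ _) = refl
  TS-flat (stopᵇ _ _) = refl
  TS-flat (one {x = x} _ _ t) = cong (x ∷_) (TS-flat t)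
  TS-flat (blk (mkBand as z R e _ _) _ t) =
      trans e (cong₂ (λ y l → as ++ y ∷ l) (sym (down-up z)) (TS-flat t))

  TS-count : ∀ {N xs S M L} → TS N xs S M L → #blk S + M ≡ N
  TS-count done = refl
  TS-count end = refl
  TS-count (stop₁ _ _) = refl
  TS-count (stopᵇ _ _) = refl
  TS-count (one _ _ t) = TS-count t
  TS-count (blk _ _ t) = cong suc (TS-count t)

  TS-M≤N : ∀ {N xs S M L} → TS N xs S M L → M ≤ N
  TS-M≤N {S = S} t = subst (_ ≤_) (TS-count t) (m≤n+m _ (#blk S))

  TS-top : ∀ {N xs S M L} → TS N xs S M L → Top S L
  TS-top done = tt
  TS-top end = tt
  TS-top (stop₁ _ _) = tt
  TS-top (stopᵇ _ _) = tt
  TS-top (one {x = x} g _ t) = subst (λ l → at q (x ∷ l) (Gap x)) (TS-flat t) g , TS-top t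
  TS-top (blk {x = x} (mkBand as z R e l ¬g) _ t) = l , m≤n+m η (size z) , tb as e , TS-top t
    where
    tb : ∀ as {xs} → x ∷ xs ≡ as ++ z ∷ R → TopBand as (up z)
    tb []       refl = subst (λ y → up z ≽ y) (sym (down-up z)) (¬gap⇒up x z ¬g)
    tb (a ∷ as) refl = ¬gap⇒up x z ¬g

  TS-big : ∀ {N xs S M L} → TS N xs S M L → Big (M * η) S
  TS-big done = tt
  TS-big end = tt
  TS-big (stop₁ _ _) = tt
  TS-big (stopᵇ _ _) = tt
  TS-big (one _ k t) = ≤-trans (s≤s (*-monoˡ-≤ η (TS-M≤N t))) k , TS-big t
  TS-big (blk (mkBand as z R e l ¬g) k t) =
      subst (λ y → _ < size y) (sym (down-up z)) (≤-trans (s≤s (*-monoˡ-≤ η (TS-M≤N t))) k) , TS-big t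

  at-replicate⁺ : {P : Part → Set} → ∀ i n → P zero₀ → at i (replicate n zero₀) P
  at-replicate⁺ i       zero    p = tt
  at-replicate⁺ zero    (suc n) p = p
  at-replicate⁺ (suc i) (suc n) p = at-replicate⁺ i n p

  at-++Z : {P : Part → Set} → ∀ i xs → P zero₀ → at i xs P → at i (xs ++ Z) P
  at-++Z i       []       z p = at-replicate⁺ i (suc (suc q) ∸ r) z
  at-++Z zero    (x ∷ xs) z p = p
  at-++Z (suc i) (x ∷ xs) z p = at-++Z i xs z p

  flatT-++ : ∀ S L R → flatT S (L ++ R) ≡ flatT S L ++ R
  flatT-++ [] L R = refl
  flatT-++ (one x ∷ S) L R = cong (x ∷_) (flatT-++ S L R)
  flatT-++ (blk b as ∷ S) L R = trans (cong (λ l → as ++ down b ∷ l) (flatT-++ S L R))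
      (sym (++-assoc as (down b ∷ flatT S L) R))

  rotT-++ : ∀ S L R → rotT S (L ++ R) ≡ rotT S L ++ R
  rotT-++ [] L R = refl
  rotT-++ (one x ∷ S) L R = cong (x ∷_) (rotT-++ S L R)
  rotT-++ (blk b as ∷ S) L R = cong (b ∷_)
      (trans (cong (as ++_) (rotT-++ S L R)) (sym (++-assoc as (rotT S L) R)))

  gap-zero : ∀ x → η < size x → Gap x zero₀
  gap-zero x h = ≤-trans (+-monoʳ-≤ η (pl≤1 x)) (≤-trans (≤-reflexive (+-comm η 1)) h)

  -- A single is passed only if it exceeds (N + 1)η ≥ η, so it has a gap to 0 and the zeros create
  -- no band at it.
  TS-topZ : ∀ {N xs S M L} → TS N xs S M L → Top S (L ++ Z)
  TS-topZ done = tt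
  TS-topZ end = tt
  TS-topZ (stop₁ _ _) = tt
  TS-topZ (stopᵇ _ _) = tt
  TS-topZ (one {N} {x} {S = S} {L = L} g k t) =
    subst (λ l → at q (x ∷ l) (Gap x)) (trans (cong (_++ Z) (TS-flat t)) (sym (flatT-++ S L Z)))
      (at-++Z q (x ∷ _) (gap-zero x (≤-trans (s≤s (m≤m+n η (N * η))) k)) g) , TS-topZ t
  TS-topZ t@(blk _ _ t′) with TS-top t
  ... | l , η≤ , tb , _ = l , η≤ , tb , TS-topZ t′

  Top-++⁻ : ∀ S V R → Top S (V ++ R) → Top S V
  Top-++⁻ [] V R top = tt
  Top-++⁻ (one x ∷ S) V R (g , top) =
      at-++⁻ q (x ∷ flatT S V) R (subst (λ l → at q (x ∷ l) (Gap x)) (flatT-++ S V R) g) , Top-++⁻ S V R top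
  Top-++⁻ (blk b as ∷ S) V R (l , h , tb , top) = l , h , tb , Top-++⁻ S V R top

  ≽down⇒up≽ : ∀ x b → η ≤ size b → x ≽ down b → up x ≽ b
  ≽down⇒up≽ x b η≤b h = ≤-trans (≤-reflexive
      (trans (cong (_+ ov b) (sym (down+η b η≤b)))
      (solve 3 (λ a b c → a :+ b :+ c := a :+ c :+ b) refl (size (down b)) η (ov b)))) (+-monoˡ-≤ η h)

  at⇒atS-++ : {P : Part → Set} → ∀ S {L} R → (∀ i → at i L P → atS i R P) → ∀ i → at i (flatT S L) P →
      atS i (S ++ R) P
  at⇒atS-++ []            R h i       p = h i p
  at⇒atS-++ (blk _ _ ∷ S) R h zero    p = tt
  at⇒atS-++ (blk _ _ ∷ S) R h (suc i) p = tt
  at⇒atS-++ (one x ∷ S)   R h zero    p = p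
  at⇒atS-++ (one x ∷ S)   R h (suc i) p = at⇒atS-++ S R h i p

  -- A top-greedy segmentation before the move is bottom-greedy after it.
  Top⇒BG : ∀ S L R → (∀ (P : Part → Set) i → at i L P → atS i R P) → BG R → Top S L → W (flatT S L) →
      BG (S ++ R)
  Top⇒BG [] L R h bg top w = bg
  Top⇒BG (one x ∷ S) L R h bg (g , top) w =
      at⇒atS-++ (one x ∷ S) R (h (Gap x)) q g , Top⇒BG S L R h bg top (proj₂ (proj₂ w))
  Top⇒BG (blk b as ∷ S) L R h bg (len , η≤b , tb , top) w =
    len , bd as w , inner as 0 (trans (+-identityʳ _) len) w ,
        Top⇒BG S L R h bg top (proj₂ (proj₂ (W-++ʳ as w)))
    where
    bd : ∀ as → W (as ++ down b ∷ flatT S L) → up (last b as) ≽ b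
    bd []       w = +-monoʳ-≤ (size b) (≤-trans (ov≤1 b) 1≤η)
    bd (a ∷ as) w = ≽down⇒up≽ (last a as) b η≤b (W-last a as w)
    inner : ∀ as j → length as + j ≡ q → W (as ++ down b ∷ flatT S L) → Inner as (S ++ R)
    inner []       j e w = tt
    -- The departure of `down b` brings the part at distance q + 1 to distance q, so condition (3)
    -- for a says that no run of singles from a is a band.
    inner (a ∷ as) j e w = subst (λ n → atS n (one a ∷ map one as ++ S ++ R) (Gap a)) e (atS← as j refl
        (at⇒atS-++ S R (h (Gap a)) j (at→ as {down b ∷ flatT S L} (suc j) e′ (proj₁ (proj₂ w))))) ,
      inner as (suc j) e′ (proj₂ (proj₂ w))
      where
      e′ : length as + suc j ≡ q
      e′ = trans (+-suc (length as) j) e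

  at-rot⇒atS : {P : Part → Set} → ∀ i S → at i (rotT S []) P → atS i S P
  at-rot⇒atS i       []            p = tt
  at-rot⇒atS zero    (blk _ _ ∷ S) p = tt
  at-rot⇒atS (suc i) (blk _ _ ∷ S) p = tt
  at-rot⇒atS zero    (one x ∷ S)   p = p
  at-rot⇒atS (suc i) (one x ∷ S)   p = at-rot⇒atS i S p

  -- The sizes that make the scan pass S when N is still to be inserted after it.
  Sz : ℕ → List Seg → Set
  Sz N []             = ⊤
  Sz N (one x ∷ S)    = (#blk S + N) * η < size x × Sz N S
  Sz N (blk b as ∷ S) = (#blk S + N) * η < size (down b) × Sz N S

  -- For the deletion: segments recovered from the bottom are the ones the scan chooses from the
  -- top, once their sizes force it to go on.
  TS-build : ∀ S {φ N S′ M L} → Top S φ → Sz (suc N) S → TS (suc N) φ S′ M L →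
      TS (#blk S + suc N) (flatT S φ) (S ++ S′) M L
  TS-build [] top sz t = t
  TS-build (one x ∷ S) {φ} {N} {S′} {M} {L} (g , top) (k , sz) t =
      subst (λ n → TS n (x ∷ flatT S φ) (one x ∷ S ++ S′) M L) (sym (+-suc (#blk S) N))
    (one g (subst (λ n → n * η < size x) (+-suc (#blk S) N) k)
        (subst (λ n → TS n (flatT S φ) (S ++ S′) M L) (+-suc (#blk S) N) (TS-build S top sz t)))
  TS-build (blk b as ∷ S) {φ} {N} {S′} {M} {L} (len , η≤b , tb , top) (k , sz) t =
      mk as refl (topBand⇒headBand as b η≤b tb)
    where
    up-down : up (down b) ≡ b
    up-down = cong (λ s → part s (over b)) (down+η b η≤b)
    mk : ∀ as′ → as ≡ as′ → HeadBand as′ (down b) →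
        TS (suc (#blk S + suc N)) (as′ ++ down b ∷ flatT S φ) (blk b as′ ∷ S ++ S′) M L
    mk [] refl hb = subst (λ y → TS _ (down b ∷ flatT S φ) (blk y [] ∷ S ++ S′) M L) up-down
        (blk (mkBand [] (down b) (flatT S φ) refl len hb) k (TS-build S top sz t))
    mk (a ∷ as′) refl hb = subst (λ y → TS _ (a ∷ as′ ++ down b ∷ flatT S φ) (blk y (a ∷ as′) ∷ S ++ S′) M
        L) up-down (blk (mkBand (a ∷ as′) (down b) (flatT S φ) refl len hb) k (TS-build S top sz t))

  -- Overlined multiples of η and the filtration.

  isO : Part → Set
  isO x = over x ≡ true × size x % η ≡ 0

  isO? : ∀ x → Dec (isO x)
  isO? x = (over x ≟ᵇ true) ×-dec (size x % η ≟ 0)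

  ¬O : Part → Set
  ¬O x = ¬ isO x

  record Adm (x : Part) : Set where
    constructor mkAdm
    field
      over⇒  : over x ≡ true → size x % η ≡ 0 ⊎ size x % η ∈ A
      plain⇒ : over x ≡ false → size x % η ≡ 0

  adm⇒free : ∀ {x} → Adm x → ¬O x → Free x
  adm⇒free {x} (mkAdm o p) ¬o = mkFree ov⇒ p
    where
    ov⇒ : over x ≡ true → size x % η ∈ A × size x % η ≢ 0
    ov⇒ e with o e
    ... | inj₁ z = ⊥-elim (¬o (e , z))
    ... | inj₂ a = a , λ z → ¬o (e , z)

  findO : List Part → Maybe (List Part × Part × List Part)
  findO [] = nothing
  findO (x ∷ xs) with isO? x
  ... | yes _ = just ([] , x , xs)
  ... | no  _ with findO xs
  ...   | nothing          = nothing
  ...   | just (U , o , L) = just (x ∷ U , o , L)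

  findO-just : ∀ xs {U o L} → findO xs ≡ just (U , o , L) → xs ≡ U ++ o ∷ L × All ¬O U × isO o
  findO-just (x ∷ xs) e with isO? x
  findO-just (x ∷ xs) refl | yes p = refl , [] , p
  ... | no ¬p with findO xs in e′
  findO-just (x ∷ xs) refl | no ¬p | just (U , o , L) with findO-just xs e′
  ... | refl , a , p = refl , ¬p ∷ a , p

  findO-nothing : ∀ xs → findO xs ≡ nothing → All ¬O xs
  findO-nothing [] e = []
  findO-nothing (x ∷ xs) e with isO? x
  ... | no ¬p with findO xs in e′
  ...   | nothing = ¬p ∷ findO-nothing xs e′

  findO-at : ∀ U o L → All ¬O U → isO o → findO (U ++ o ∷ L) ≡ just (U , o , L)
  findO-at [] o L a p with isO? o
  ... | yes _ = refl
  ... | no ¬p = ⊥-elim (¬p p)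
  findO-at (x ∷ U) o L (¬x ∷ a) p with isO? x
  ... | yes px = ⊥-elim (¬x px)
  ... | no _ rewrite findO-at U o L a p = refl

  findO-none : ∀ xs → All ¬O xs → findO xs ≡ nothing
  findO-none [] a = refl
  findO-none (x ∷ xs) (¬x ∷ a) with isO? x
  ... | yes px = ⊥-elim (¬x px)
  ... | no _ rewrite findO-none xs a = refl

  -- The filtration X_N.  The first overlined multiple o of η found by findO is the largest.
  InX′ : ℕ → List Part → Maybe (List Part × Part × List Part) → Set
  InX′ N xs nothing            = AE (tl N 0 xs)
  InX′ N xs (just (U , o , _)) = F o + T 0 U ≤ N

  InX : ℕ → List Part → Set
  InX N xs = InX′ N xs (findO xs)

  record H (xs : List Part) : Set where
    constructor mkH
    field
      windows : W (xs ++ Z)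
      adm     : All Adm xs
      pos     : All Pos xs

  wt : List Part → ℕ
  wt xs = sum (map size xs)

  O : ℕ → Part
  O M = part (M * η) true

  F-O : ∀ M → F (O M) ≡ M
  F-O M = m*n/n≡m M η

  isO-O : ∀ M → isO (O M)
  isO-O M = refl , m*n%n≡0 M η

  size-O : ∀ o → isO o → size o ≡ F o * η
  size-O o (_ , z) = trans (m≡m%n+[m/n]*n (size o) η) (cong (_+ F o * η) z)

  isO⇒O : ∀ o → isO o → o ≡ O (F o)
  isO⇒O o p = cong₂ part (size-O o p) (proj₁ p)

  -- Insertion.

  out : List Seg → ℕ → List Part → List Part
  out S zero    L = rotT S L
  out S (suc M) L = rotT S (O (suc M) ∷ L)

  Ins : ℕ → List Part → List Part → Set
  Ins N π σ = ∃[ S ] ∃[ M ] ∃[ L ] (TS N π S M L × σ ≡ out S M L)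

  ins-fun : ∀ {N π σ σ′} → Ins N π σ → Ins N π σ′ → σ ≡ σ′
  ins-fun (S , M , L , t , refl) (S′ , M′ , L′ , t′ , refl) with TS-det t t′
  ... | refl = refl

  down-% : ∀ b → η ≤ size b → size (down b) % η ≡ size b % η
  down-% b h = trans (sym ([m+n]%n≡m%n (size (down b)) η)) (cong (_% η) (down+η b h))

  adm-down⇒ : ∀ b → η ≤ size b → Adm (down b) → Adm b
  adm-down⇒ b h (mkAdm o p) = mkAdm (λ e → subst (λ m → m ≡ 0 ⊎ m ∈ A) (down-% b h) (o e)) (λ e →
      trans (sym (down-% b h)) (p e))

  adm-⇒down : ∀ b → η ≤ size b → Adm b → Adm (down b)
  adm-⇒down b h (mkAdm o p) = mkAdm (λ e → subst (λ m → m ≡ 0 ⊎ m ∈ A) (sym (down-% b h)) (o e)) (λ e →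
      trans (down-% b h) (p e))

  ¬O-down⇒ : ∀ b → η ≤ size b → ¬O (down b) → ¬O b
  ¬O-down⇒ b h ¬o (o , z) = ¬o (o , trans (down-% b h) z)

  ¬O-⇒down : ∀ b → η ≤ size b → ¬O b → ¬O (down b)
  ¬O-⇒down b h ¬o (o , z) = ¬o (o , trans (sym (down-% b h)) z)

  pos-down⇒ : ∀ b → η ≤ size b → Pos (down b) → Pos b
  pos-down⇒ b h p = ≤-trans p (m∸n≤m (size b) η)

  all-rot : {P : Part → Set} → (∀ b → η ≤ size b → P (down b) → P b) → ∀ S {φ ψ τ} → Top S ψ →
      All P (flatT S φ) → All P τ → All P (rotT S τ)
  all-rot f [] top a t = t
  all-rot f (one x ∷ S) (_ , top) (p ∷ a) t = p ∷ all-rot f S top a t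
  all-rot f (blk b as ∷ S) (_ , h , _ , top) a t with All.++⁻ʳ as a
  ... | z ∷ a′ = f b h z ∷ All.++⁺ (All.++⁻ˡ as a) (all-rot f S top a′ t)

  all-flat : {P : Part → Set} → (∀ b → η ≤ size b → P b → P (down b)) → ∀ S {φ ψ τ} → Top S ψ →
      All P (rotT S τ) → All P φ → All P (flatT S φ)
  all-flat f [] top a t = t
  all-flat f (one x ∷ S) (_ , top) (p ∷ a) t = p ∷ all-flat f S top a t
  all-flat f (blk b as ∷ S) (_ , h , _ , top) (p ∷ a) t =
      All.++⁺ (All.++⁻ˡ as a) (f b h p ∷ all-flat f S top (All.++⁻ʳ as a) t)

  flat-tail : {P : Part → Set} → ∀ S {φ} → All P (flatT S φ) → All P φ
  flat-tail [] a = a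
  flat-tail (one x ∷ S) (_ ∷ a) = flat-tail S a
  flat-tail (blk b as ∷ S) a = flat-tail S (All.tail (All.++⁻ʳ as a))

  flat-front : {P : Part → Set} → ∀ S {φ} → All P (flatT S φ) → All P (flatT S [])
  flat-front S {φ} a = All.++⁻ˡ (flatT S []) (subst (All _) (flatT-++ S [] φ) a)

  wt-++ : ∀ xs ys → wt (xs ++ ys) ≡ wt xs + wt ys
  wt-++ []       ys = refl
  wt-++ (x ∷ xs) ys = trans (cong (size x +_) (wt-++ xs ys)) (sym (+-assoc (size x) _ _))

  wt-rot : ∀ S {ψ} L → Top S ψ → wt (rotT S L) ≡ wt (flatT S L) + #blk S * η
  wt-rot [] L top = sym (+-identityʳ _)
  wt-rot (one x ∷ S) L (_ , top) = trans (cong (size x +_) (wt-rot S L top)) (sym (+-assoc (size x) _ _))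
  wt-rot (blk b as ∷ S) L (_ , h , _ , top) = begin
    size b + wt (as ++ rotT S L)                              ≡⟨ cong₂ _+_ (sym (down+η b h))
        (trans (wt-++ as _) (cong (wt as +_) (wt-rot S L top))) ⟩
    size (down b) + η + (wt as + (wt (flatT S L) + #blk S * η))
        ≡⟨ solve 5 (λ d n a f k → d :+ n :+ (a :+ (f :+ k)) := a :+ (d :+ f) :+ (n :+ k)) refl
        (size (down b)) η (wt as) (wt (flatT S L)) (#blk S * η) ⟩
    wt as + wt (down b ∷ flatT S L) +
        (η + #blk S * η)        ≡⟨ cong (_+ (η + #blk S * η)) (sym (wt-++ as (down b ∷ flatT S L))) ⟩
    wt (as ++ down b ∷ flatT S L) + (η + #blk S * η)          ∎
    where open ≡-Reasoning

  wt-out : ∀ S {ψ} M L → Top S ψ → wt (out S M L) ≡ wt (flatT S L) + (#blk S + M) * η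
  wt-out S zero L top = trans (wt-rot S L top)
      (cong (λ n → wt (flatT S L) + n * η) (sym (+-identityʳ (#blk S))))
  wt-out S (suc M) L top = begin
    wt (rotT S (O (suc M) ∷ L))                       ≡⟨ wt-rot S (O (suc M) ∷ L) top ⟩
    wt (flatT S (O (suc M) ∷ L)) + #blk S * η         ≡⟨ cong (_+ #blk S * η) (wt-mid S) ⟩
    wt (flatT S L) + suc M * η + #blk S *
        η           ≡⟨ trans (+-assoc (wt (flatT S L)) _ _)
        (cong (wt (flatT S L) +_) (trans (+-comm (suc M * η) _) (sym (*-distribʳ-+ η (#blk S) (suc M))))) ⟩
    wt (flatT S L) + (#blk S + suc M) * η             ∎
    where
    open ≡-Reasoning
    o = O (suc M)
    wt-mid : ∀ S → wt (flatT S (o ∷ L)) ≡ wt (flatT S L) + size o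
    wt-mid S = begin
      wt (flatT S (o ∷ L))           ≡⟨ trans (cong wt (flatT-++ S [] (o ∷ L)))
          (wt-++ (flatT S []) (o ∷ L)) ⟩
      wt (flatT S []) + (size o + wt L)
          ≡⟨ solve 3 (λ a b c → a :+ (b :+ c) := a :+ c :+ b) refl (wt (flatT S [])) (size o) (wt L) ⟩
      wt (flatT S []) + wt L + size o
          ≡⟨ cong (_+ size o) (sym (trans (cong wt (flatT-++ S [] L)) (wt-++ (flatT S []) L))) ⟩
      wt (flatT S L) + size o         ∎

  end≤ : ∀ U o L as z R → as ++ z ∷ R ≡ U ++ o ∷ L → length U ≤ length as → W (U ++ o ∷ L) → size z ≤ size o
  end≤ []      o L as       z R e h       w = All.head (All.++⁻ʳ as (subst (All _) (sym e) (W⇒≤head o L w)))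
  end≤ (u ∷ U) o L (a ∷ as) z R e (s≤s h) w = end≤ U o L as z R (∷-injectiveʳ e) h (proj₂ (proj₂ w))

  block-in : ∀ (U : List Part) o L as z R → as ++ z ∷ R ≡ U ++ o ∷ L → length as < length U →
      ∃[ U′ ] (U ≡ as ++ z ∷ U′ × R ≡ U′ ++ o ∷ L)
  block-in (u ∷ U) o L []       z R e    h = U , cong (_∷ U) (sym (∷-injectiveˡ e)) , ∷-injectiveʳ e
  block-in (u ∷ U) o L (a ∷ as) z R e (s≤s h) with block-in U o L as z R (∷-injectiveʳ e) h
  ... | U′ , refl , e′ = U′ , cong (_∷ as ++ z ∷ U′) (sym (∷-injectiveˡ e)) , e′

  bandAt⇒headBand : ∀ {x xs} (bd : BandAt x xs) → HeadBand (BandAt.front bd) (BandAt.end bd)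
  bandAt⇒headBand (mkBand []       z R refl _ ¬g) = ¬g
  bandAt⇒headBand (mkBand (a ∷ as) z R refl _ ¬g) = ¬g

  -- The scan passes only parts larger than the multiple of η that remains to be inserted, and o is
  -- no larger than this multiple; each band above o lowers both sides by one. So the scan stops
  -- above o.
  TS-before-O : ∀ {N xs S M L} → TS N xs S M L → ∀ U o L′ → xs ≡ U ++ o ∷ L′ → W xs → isO o →
      F o + T 0 U < N →
                ∃[ V ] (U ≡ flatT S V × L ≡ V ++ o ∷ L′ × F o + T 0 V < M)
  TS-before-O done U o L′ e w p ()
  TS-before-O end [] o L′ () w p h
  TS-before-O (stop₁ _ _) U o L′ e w p h = U , refl , e , h
  TS-before-O (stopᵇ _ _) U o L′ e w p h = U , refl , e , h
  TS-before-O {N = N} (one {x = x} g k t) [] .x L′ refl w p h = ⊥-elim (<-irrefl refl (begin-strict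
    size x       ≡⟨ size-O x p ⟩
    F x * η      ≤⟨ *-monoˡ-≤ η (<⇒≤ (≤-trans (s≤s (m≤m+n (F x) 0)) h)) ⟩
    N * η        <⟨ k ⟩
    size x       ∎))
    where open ≤-Reasoning
  TS-before-O (one {x = x} g k t) (.x ∷ U) o L′ refl w p h
    with TS-before-O t U o L′ refl (proj₂ (proj₂ w)) p
        (subst (λ n → F o + n < _) (T-noband x U (at-++⁻ q (x ∷ U) (o ∷ L′) g)) h)
  ... | V , refl , e , h′ = V , refl , e , h′
  TS-before-O {N = suc N} (blk {S = S} bd@(mkBand as z R eq l ¬g) k t) U o L′ e w p h with q <? length U
  ... | no ¬q = ⊥-elim (<-irrefl refl (begin-strict
    size z       ≤⟨ end≤ U o L′ as z R (trans (sym eq) e) (≤-trans (≮⇒≥ ¬q) (≤-reflexive (sym l)))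
        (subst W e w) ⟩
    size o       ≡⟨ size-O o p ⟩
    F o * η      ≤⟨ *-monoˡ-≤ η (s≤s⁻¹ (≤-trans (s≤s (m≤m+n (F o) (T 0 U))) h)) ⟩
    N * η        <⟨ k ⟩
    size z       ∎))
    where open ≤-Reasoning
  ... | yes q< with block-in U o L′ as z R (trans (sym eq) e) (subst (_< length U) (sym l) q<)
  ...   | U′ , refl , refl with TS-before-O t U′ o L′ refl (proj₂ (proj₂ (W-++ʳ as (subst W eq w)))) p
            (s≤s⁻¹ (subst (_< suc N) (+-suc (F o) (T 0 U′))
                (subst (λ n → F o + n < suc N) (T-band as z U′ l (bandAt⇒headBand bd)) h)))
  ...     | V , refl , e′ , h′ = V , cong (λ y → as ++ y ∷ flatT S V) (sym (down-up z)) , e′ , h′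

  record Src (S : List Seg) (M : ℕ) (L : List Part) : Set where
    field
      front-¬O : All ¬O (flatT S [])
      head-O   : at 0 L (λ x → isO x → F x < M)
      moved-¬O : M ≡ 0 → All ¬O L

  source : ∀ {n π S M L} → W π → InX n π → TS (suc n) π S M L → Src S M L
  source {n} {π} {S} {M} {L} w inx t with findO π in e
  ... | nothing = record { front-¬O = flat-front S a ; head-O = hd L (flat-tail S a) ; moved-¬O =
      λ _ → flat-tail S a }
    where
    a : All ¬O (flatT S L)
    a = subst (All ¬O) (TS-flat t) (findO-nothing π e)
    hd : ∀ L → All ¬O L → at 0 L (λ x → isO x → F x < M)
    hd []      a       = tt
    hd (x ∷ L) (¬x ∷ _) = λ p → ⊥-elim (¬x p)
  ... | just (U , o , L′) with findO-just π e
  ...   | refl , aU , p with TS-before-O t U o L′ refl w p (s≤s inx)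
  ...     | V , refl , refl , h =
      record { front-¬O = flat-front S aU ; head-O = hd V (flat-tail S aU) h ; moved-¬O =
      λ m → ⊥-elim (n≮0 (subst (_ <_) m h)) }
    where
    hd : ∀ V → All ¬O V → F o + T 0 V < M → at 0 (V ++ o ∷ L′) (λ x → isO x → F x < M)
    hd []      a        h = λ _ → ≤-trans (s≤s (m≤m+n (F o) 0)) h
    hd (v ∷ V) (¬v ∷ _) h = λ p → ⊥-elim (¬v p)

  TS-stop : ∀ {N xs S M L} → TS N xs S (suc M) L → TS (suc M) L [] (suc M) L
  TS-stop end = end
  TS-stop (stop₁ g h) = stop₁ g h
  TS-stop (stopᵇ bd h) = stopᵇ bd h
  TS-stop (one _ _ t) = TS-stop t
  TS-stop (blk _ _ t) = TS-stop t

  size+ov≤ : ∀ M x → size x ≤ suc M * η → (isO x → F x < suc M) → size x + ov x ≤ suc M * η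
  size+ov≤ M x h k = go (over x) refl
    where
    go : ∀ b → over x ≡ b → size x + (if b then 1 else 0) ≤ suc M * η
    go false e = subst (_≤ suc M * η) (sym (+-identityʳ _)) h
    go true  e with m≤n⇒m<n∨m≡n h
    ... | inj₁ lt = subst (_≤ suc M * η) (+-comm 1 (size x)) lt
    ... | inj₂ eq = ⊥-elim (<-irrefl F≡ (k (e , trans (cong (_% η) eq) (proj₂ (isO-O (suc M))))))
      where
      F≡ : F x ≡ suc M
      F≡ = trans (cong (_/ η) eq) (F-O (suc M))

  -- At a single x ≤ (M + 1)η the gap of x at distance q passes on to the inserted part. At a band
  -- with end z ≤ Mη, both z + η ≽ x and the gap to z follow. `head-O` excludes a second copy of the
  -- same overlined part.
  W-O : ∀ M L → TS (suc M) L [] (suc M) L → at 0 L (λ x → isO x → F x < suc M) → W (L ++ Z) →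
      W (O (suc M) ∷ L ++ Z)
  W-O M L t h w = hd , gp , w
    where
    o : Part
    o = O (suc M)
    hd0 : ∀ {L} → TS (suc M) L [] (suc M) L → at 0 L (λ x → isO x → F x < suc M) → at 0 L (o ≽_)
    hd0 end h = tt
    hd0 (stop₁ {x = x} g k) h = size+ov≤ M x k h
    hd0 (stopᵇ {x = x} (mkBand as z R e l ¬g) k) h =
      ≤-trans (¬gap⇒up x z ¬g) (≤-trans (+-monoˡ-≤ η k) (≤-reflexive (+-comm (M * η) η)))
    hd : at 0 (L ++ Z) (o ≽_)
    hd = at-++Z 0 L z≤n (hd0 t h)
    gapO : ∀ {y} → size y + η ≤ suc M * η → Gap o y
    gapO {y} k = ≤-trans (≤-reflexive (+-identityʳ _)) k
    gp0 : ∀ {L} → TS (suc M) L [] (suc M) L → at q L (Gap o)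
    gp0 end = tt
    gp0 (stop₁ {x = x} {xs} g k) = at-map q (x ∷ xs) (λ {y} j → gapO {y} (≤-trans (gap⇒+η≤ x y j) k)) g
    gp0 (stopᵇ {x = x} {xs} (mkBand as z R e l ¬g) k) = subst (λ l → at q l (Gap o)) (sym e)
      (at← as {z ∷ R} 0 (trans (+-identityʳ _) l)
          (gapO {z} (≤-trans (+-monoˡ-≤ η k) (≤-reflexive (+-comm (M * η) η)))))
    gp : at q (L ++ Z) (Gap o)
    gp = at-++Z q L (gapO {zero₀} (m≤m+n η (M * η))) (gp0 t)

  BG-front : ∀ {N π S M L} → TS N π S M L → W π → BG S
  BG-front {π = π} {S} {M} {L} t w = subst BG (++-identityʳ S)
    (Top⇒BG S L [] (λ P i _ → tt) tt (TS-top t) (subst W (TS-flat t) w))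

  BG-all : ∀ {N π S M L} → TS N π S M L → W π → BG (S ++ bseg L)
  BG-all {S = S} {L = L} t w = Top⇒BG S L (bseg L) (λ P i p →
      at-rot⇒atS i (bseg L) (subst (λ l → at i l P) (sym (trans (bseg-rot L []) (++-identityʳ L))) p))
    (bseg-BG L) (TS-top t) (subst W (TS-flat t) w)

  -- Only the quotient of the moved part changes, by 1, so the parity flips.
  mass-move : ∀ b as L → length as ≡ q → η ≤ size b → mass (b ∷ as ++ L) ≡ suc (mass (as ++ down b ∷ L))
  mass-move b as L len h = begin
    mass (b ∷ as ++ L)                                     ≡⟨ mass-++ (b ∷ as) L (cong suc len) ⟩
    F b + sumF as + (ov b + #ov as + #ov L)                ≡⟨ cong (λ n →
        n + sumF as + (ov b + #ov as + #ov L)) Fb ⟩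
    suc (F (down b) + sumF as + (ov b + #ov as + #ov L))   ≡⟨ cong suc
        (solve 5 (λ f s o a l → f :+ s :+ (o :+ a :+ l) := s :+ (f :+ con 0) :+ (a :+ (o :+ con 0) :+ l))
        refl (F (down b)) (sumF as) (ov b) (#ov as) (#ov L)) ⟩
    suc (sumF as + sumF (down b ∷ []) + (#ov as + #ov (down b ∷ []) + #ov L))
        ≡⟨ cong suc (cong₂ (λ u v → u + (v + #ov L)) (sym (sumF-++ as (down b ∷ [])))
        (sym (#ov-++ as (down b ∷ [])))) ⟩
    suc (sumF (as ++ down b ∷ []) + (#ov (as ++ down b ∷ []) + #ov L))
        ≡⟨ cong suc (sym (mass-++ (as ++ down b ∷ []) L
        (trans (length-++ as) (trans (+-comm (length as) 1) (cong suc len))))) ⟩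
    suc (mass ((as ++ down b ∷ []) ++ L))                  ≡⟨ cong (suc ∘ mass)
        (++-assoc as (down b ∷ []) L) ⟩
    suc (mass (as ++ down b ∷ L))                          ∎
    where
    open ≡-Reasoning
    Fb : F b ≡ suc (F (down b))
    Fb = trans (cong (_/ η) (sym (down+η b h))) (F-up (down b))

  not-≢ : ∀ {a c : Bool} → a ≡ c → ¬ not a ≡ c
  not-≢ {false} {false} refl ()
  not-≢ {true}  {true}  refl ()

  ≢-not : ∀ {a c : Bool} → ¬ not a ≡ c → a ≡ c
  ≢-not {false} {false} h = refl
  ≢-not {false} {true}  h = ⊥-elim (h refl)
  ≢-not {true}  {false} h = ⊥-elim (h refl)
  ≢-not {true}  {true}  h = refl

  ends-in-block : ∀ {N π S L} → TS (suc N) π S 0 L → ∃[ S₀ ] ∃[ b ] ∃[ as ] (S ≡ S₀ ++ blk b as ∷ [])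
  ends-in-block (one _ _ t) with ends-in-block t
  ... | S₀ , b , as , refl = one _ ∷ S₀ , b , as , refl
  ends-in-block (blk {N = zero} bd k done) = [] , _ , _ , refl
  ends-in-block (blk {N = suc N} bd k t) with ends-in-block t
  ... | S₀ , b , as , refl = blk _ _ ∷ S₀ , b , as , refl

  flatT-snoc : ∀ S b as L → flatT (S ++ blk b as ∷ []) L ≡ flatT S (as ++ down b ∷ L)
  flatT-snoc [] b as L = refl
  flatT-snoc (one x ∷ S) b as L = cong (x ∷_) (flatT-snoc S b as L)
  flatT-snoc (blk c cs ∷ S) b as L = cong (λ l → cs ++ down c ∷ l) (flatT-snoc S b as L)

  rotT-snoc : ∀ S b as L → rotT (S ++ blk b as ∷ []) L ≡ rotT S [] ++ b ∷ as ++ L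
  rotT-snoc [] b as L = refl
  rotT-snoc (one x ∷ S) b as L = cong (x ∷_) (rotT-snoc S b as L)
  rotT-snoc (blk c cs ∷ S) b as L =
      cong (c ∷_) (trans (cong (cs ++_) (rotT-snoc S b as L)) (sym (++-assoc cs (rotT S []) _)))

  #blk-snoc : ∀ S b as → #blk (S ++ blk b as ∷ []) ≡ suc (#blk S)
  #blk-snoc [] b as = refl
  #blk-snoc (one x ∷ S) b as = #blk-snoc S b as
  #blk-snoc (blk c cs ∷ S) b as = cong suc (#blk-snoc S b as)

  Top-snoc : ∀ S b as L → Top (S ++ blk b as ∷ []) L → Top S (as ++ down b ∷ L) × length as ≡ q ×
      η ≤ size b × TopBand as b
  Top-snoc [] b as L (l , h , tb , _) = tt , l , h , tb
  Top-snoc (one x ∷ S) b as L (g , top) with Top-snoc S b as L top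
  ... | t , rest = (subst (λ l → at q (x ∷ l) (Gap x)) (flatT-snoc S b as L) g , t) , rest
  Top-snoc (blk c cs ∷ S) b as L (l , h , tb , top) with Top-snoc S b as L top
  ... | t , rest = (l , h , tb , t) , rest

  atS-++ˡ : {P : Part → Set} → ∀ i S {R} → atS i (S ++ R) P → atS i S P
  atS-++ˡ i       []            p = tt
  atS-++ˡ zero    (blk _ _ ∷ S) p = tt
  atS-++ˡ (suc i) (blk _ _ ∷ S) p = tt
  atS-++ˡ zero    (one _ ∷ S)   p = p
  atS-++ˡ (suc i) (one _ ∷ S)   p = atS-++ˡ i S p

  BG-++ˡ : ∀ S R → BG (S ++ R) → BG S
  BG-++ˡ [] R bg = tt
  BG-++ˡ (one x ∷ S) R (g , bg) = atS-++ˡ q (one x ∷ S) g , BG-++ˡ S R bg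
  BG-++ˡ (blk b as ∷ S) R (l , bd , inn , bg) = l , bd , inner as inn , BG-++ˡ S R bg
    where
    inner : ∀ as → Inner as (S ++ R) → Inner as S
    inner []       i = tt
    inner (a ∷ as) (g , i) = atS-++ˡ q (one a ∷ map one as ++ S)
        (subst (λ l → atS q (one a ∷ l) (Gap a)) (sym (++-assoc (map one as) S R)) g) , inner as i

  BG-++ʳ : ∀ S R → BG (S ++ R) → BG R
  BG-++ʳ [] R bg = bg
  BG-++ʳ (one x ∷ S) R (_ , bg) = BG-++ʳ S R bg
  BG-++ʳ (blk _ _ ∷ S) R (_ , _ , _ , bg) = BG-++ʳ S R bg

  adm-O : ∀ M → Adm (O M)
  adm-O M = mkAdm (λ _ → inj₁ (proj₂ (isO-O M))) (λ ())

  rot-¬O : ∀ S {M L} → Top S L → Src S M L → All ¬O (rotT S [])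
  rot-¬O S top src = all-rot ¬O-down⇒ S top (Src.front-¬O src) []

  rotT-[] : ∀ S τ → rotT S τ ≡ rotT S [] ++ τ
  rotT-[] S τ = rotT-++ S [] τ

  out-O : ∀ {n π S M L} → TS (suc n) π S (suc M) L → Src S (suc M) L →
      findO (out S (suc M) L) ≡ just (rotT S [] , O (suc M) , L)
  out-O {S = S} {M} {L} t src = trans (cong findO (rotT-[] S (O (suc M) ∷ L)))
    (findO-at (rotT S []) (O (suc M)) L (rot-¬O S (TS-top t) src) (isO-O (suc M)))

  out-¬O : ∀ {n π S L} → TS (suc n) π S 0 L → Src S 0 L → All ¬O (rotT S L)
  out-¬O {S = S} {L} t src = subst (All ¬O) (sym (rotT-[] S L))
      (All.++⁺ (rot-¬O S (TS-top t) src) (Src.moved-¬O src refl))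

  out-H : ∀ {n π S} M {L} → H π → TS (suc n) π S M L → Src S M L → H (out S M L)
  out-H {π = π} {S} zero {L} (mkH w ad ps) t src = mkH
    (subst W (rotT-++ S L Z) (proj₁ (fwd S {φ =
        L ++ Z} same (TS-topZ t) (TS-big t) (W-suf S (L ++ Z) w′) w′)))
    (all-rot adm-down⇒ S (TS-top t) ad′ (flat-tail S ad′))
        (all-rot pos-down⇒ S (TS-top t) ps′ (flat-tail S ps′))
    where
    ad′ : All Adm (flatT S L)
    ad′ = subst (All Adm) (TS-flat t) ad
    ps′ : All Pos (flatT S L)
    ps′ = subst (All Pos) (TS-flat t) ps
    w′ : W (flatT S (L ++ Z))
    w′ = subst W (trans (cong (_++ Z) (TS-flat t)) (sym (flatT-++ S L Z))) w
    W-suf : ∀ S φ → W (flatT S φ) → W φ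
    W-suf S φ w = W-++ʳ (flatT S []) (subst W (flatT-++ S [] φ) w)
  out-H {π = π} {S} (suc M) {L} (mkH w ad ps) t src = mkH
    (subst W (rotT-++ S (O (suc M) ∷ L) Z) (proj₁ (fwd S {φ = L ++ Z} (ins ≤-refl) (TS-topZ t) (TS-big t)
      (W-O M L (TS-stop t) (Src.head-O src)
          (W-++ʳ (flatT S []) (subst W (flatT-++ S [] (L ++ Z)) w′))) w′)))
    (all-rot adm-down⇒ S (TS-top t) ad′ (adm-O (suc M) ∷ flat-tail S ad′))
    (all-rot pos-down⇒ S (TS-top t) ps′ (≤-trans 1≤η (m≤m+n η (M * η)) ∷ flat-tail S ps′))
    where
    ad′ : All Adm (flatT S L)
    ad′ = subst (All Adm) (TS-flat t) ad
    ps′ : All Pos (flatT S L)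
    ps′ = subst (All Pos) (TS-flat t) ps
    w′ : W (flatT S (L ++ Z))
    w′ = subst W (trans (cong (_++ Z) (TS-flat t)) (sym (flatT-++ S L Z))) w

  W-real : ∀ {π} → H π → W π
  W-real {π} h = W-front π Z (H.windows h)

  H-free : ∀ {π} → H π → All ¬O π → All Free π
  H-free h a = All.map (λ { (x , y) → adm⇒free x y }) (All.zip (H.adm h , a))

  -- Without z the part at distance k - 1 comes one place nearer, so no band starts in the front of
  -- a moved block.
  AE-inner : ∀ as z L → W (as ++ z ∷ L) → ∀ j → length as + j ≡ q → AE L → AE (as ++ L)
  AE-inner []       z L w j e ae = ae
  AE-inner (a ∷ as) z L w j e ae =
      (λ bd → ⊥-elim (gap∧band gp bd)) , AE-inner as z L (proj₂ (proj₂ w)) (suc j) e′ ae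
    where
    e′ : length as + suc j ≡ q
    e′ = trans (+-suc (length as) j) e
    gp : at q (a ∷ as ++ L) (Gap a)
    gp = at← (a ∷ as) {L} j e (at→ as {z ∷ L} (suc j) e′ (proj₁ (proj₂ w)))

  bandAt-block : ∀ b as L → length as ≡ q → η ≤ size b → TopBand as b → ∀ {P : List Part → Set} →
                 (∀ x xs → x ∷ xs ≡ as ++ down b ∷ L → BandAt x xs → P (x ∷ xs)) → P (as ++ down b ∷ L)
  bandAt-block b []       L len h tb f =
      f (down b) L refl (mkBand [] (down b) L refl len (topBand⇒headBand [] b h tb))
  bandAt-block b (a ∷ as) L len h tb f =
      f a (as ++ down b ∷ L) refl (mkBand (a ∷ as) (down b) L refl len (topBand⇒headBand (a ∷ as) b h tb))

  module Move {n π S₀ b as L} (hπ : H π) (inx : InX n π) (t : TS (suc n) π (S₀ ++ blk b as ∷ []) 0 L)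
              (src : Src (S₀ ++ blk b as ∷ []) 0 L) where
    S : List Seg
    S = S₀ ++ blk b as ∷ []

    tops : Top S₀ (as ++ down b ∷ L) × length as ≡ q × η ≤ size b × TopBand as b
    tops = Top-snoc S₀ b as L (TS-top t)
    len : length as ≡ q
    len = proj₁ (proj₂ tops)
    η≤b : η ≤ size b
    η≤b = proj₁ (proj₂ (proj₂ tops))
    tb : TopBand as b
    tb = proj₂ (proj₂ (proj₂ tops))

    π≡ : π ≡ flatT S₀ (as ++ down b ∷ L)
    π≡ = trans (TS-flat t) (flatT-snoc S₀ b as L)

    #S₀ : #blk S₀ ≡ n
    #S₀ = suc-injective (trans (sym (#blk-snoc S₀ b as)) (trans (sym (+-identityʳ _)) (TS-count t)))

    bg : BG S
    bg = BG-front t (W-real hπ)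
    bg₀ : BG S₀
    bg₀ = BG-++ˡ S₀ (blk b as ∷ []) bg
    bd : up (last b as) ≽ b
    bd = proj₁ (proj₂ (BG-++ʳ S₀ (blk b as ∷ []) bg))

    T₀ : T 0 (rotT S₀ []) ≡ n
    T₀ = trans (T-rot S₀ bg₀) #S₀

    π-¬O : All ¬O π
    π-¬O = subst (All ¬O) (sym (trans (TS-flat t) (flatT-++ S [] L)))
        (All.++⁺ (Src.front-¬O src) (Src.moved-¬O src refl))

    ae : AE (as ++ down b ∷ L)
    ae = Suf-AE (tl-top-suf S₀ (as ++ down b ∷ L) (proj₁ tops))
      (subst AE (cong₂ (λ m l → tl m 0 l) (sym #S₀) π≡) (subst (InX′ n π) (findO-none π π-¬O) inx))

    wB : W (as ++ down b ∷ L)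
    wB = W-++ʳ (flatT S₀ []) (subst W (trans π≡ (flatT-++ S₀ [] (as ++ down b ∷ L))) (W-real hπ))

    ev : Ev (as ++ down b ∷ L)
    ev = bandAt-block b as L len η≤b tb {λ l → AE l → Ev l} (λ x xs e bd ae → proj₁ ae bd) ae

    odd : ¬ Ev (b ∷ as ++ L)
    odd e = not-≢ ev (trans (cong par (sym (mass-move b as L len η≤b))) e)

    σ≡ : rotT S L ≡ rotT S₀ [] ++ b ∷ as ++ L
    σ≡ = rotT-snoc S₀ b as L

    -- By `T₀` the first n bands from the top lie before b, so the odd band is among those below
    -- them.
    not-in : ¬ AE (tl n 0 (rotT S L))
    not-in a = odd (proj₁ (AE-suf (tl n 0 (rotT S₀ [])) _ (subst AE (trans (cong (tl n 0) σ≡)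
      (tl-++ n 0 (rotT S₀ []) (b ∷ as ++ L) (≤-reflexive (sym T₀)) z≤n)) a)) (rotBand b as L len bd))

    is-in : AE (tl (suc n) 0 (rotT S L))
    is-in = Suf-AE (subst (λ l → Suf (tl (suc n) 0 l) (as ++ L)) (sym σ≡)
        (tl-past (suc n) 0 (rotT S₀ []) (s≤s (≤-reflexive T₀))))
      (AE-inner as (down b) L wB 0 (trans (+-identityʳ _) len)
          (AE-suf (as ++ down b ∷ []) L (subst AE (sym (++-assoc as (down b ∷ []) L)) ae)))

  ins-step : ∀ n π → H π → InX n π →
      ∃[ σ ] (Ins (suc n) π σ × H σ × InX (suc n) σ × ¬ InX n σ × wt σ ≡ wt π + suc n * η)
  ins-step n π hπ inx with TS-exists (length π) (suc n) π ≤-refl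
  ... | S , suc M , L , t = out S (suc M) L , (S , suc M , L , t , refl) , out-H (suc M) hπ t src ,
        subst (InX′ (suc n) _) (sym fo) (≤-reflexive lv) ,
        (λ h → <-irrefl lv (s≤s (subst (InX′ n (out S (suc M) L)) fo h))) ,
        trans (wt-out S (suc M) L (TS-top t)) (cong₂ (λ l k → wt l + k * η) (sym (TS-flat t)) (TS-count t))
    where
    src : Src S (suc M) L
    src = source (W-real hπ) inx t
    fo : findO (out S (suc M) L) ≡ just (rotT S [] , O (suc M) , L)
    fo = out-O t src
    -- The level of the result: the inserted multiple plus the moved blocks, recounted from the top
    -- by `T-rot`.
    lv : F (O (suc M)) + T 0 (rotT S []) ≡ suc n
    lv = trans (cong₂ _+_ (F-O (suc M)) (T-rot S (BG-front t (W-real hπ))))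
        (trans (+-comm (suc M) (#blk S)) (TS-count t))
  ... | S , zero , L , t with ends-in-block t
  ...   | S₀ , b , as , refl = rotT S L , (S , 0 , L , t , refl) , out-H 0 hπ t src ,
          subst (InX′ (suc n) _) (sym none) (Move.is-in hπ inx t src) ,
          (λ h → Move.not-in hπ inx t src (subst (InX′ n (rotT S L)) none h)) ,
          trans (wt-out S 0 L (TS-top t)) (cong₂ (λ l k → wt l + k * η) (sym (TS-flat t)) (TS-count t))
    where
    src : Src S 0 L
    src = source (W-real hπ) inx t
    none : findO (rotT S L) ≡ nothing
    none = findO-none (rotT S L) (out-¬O t src)

  -- Injectivity of insertion.

  rot-injective : ∀ S S′ → BG S → BG S′ → rotT S [] ≡ rotT S′ [] → S ≡ S′
  rot-injective S S′ bg bg′ e = trans (sym (canon S bg)) (trans (cong bseg e) (canon S′ bg′))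
    where
    canon : ∀ S → BG S → bseg (rotT S []) ≡ S
    canon S bg = trans (BG-bseg S [] [] (subst BG (sym (++-identityʳ S)) bg) refl) (++-identityʳ S)

  rotT-cancel : ∀ S {L L′} → rotT S L ≡ rotT S L′ → L ≡ L′
  rotT-cancel S {L} {L′} e = ++-cancelˡ (rotT S []) L L′
      (trans (sym (rotT-[] S L)) (trans e (rotT-[] S L′)))

  prefix-unique : ∀ S S′ {b as b′ as′ R R′} → (S ++ blk b as ∷ []) ++ R ≡ (S′ ++ blk b′ as′ ∷ []) ++ R′ →
      #blk S ≡ #blk S′ →
                  S ++ blk b as ∷ [] ≡ S′ ++ blk b′ as′ ∷ []
  prefix-unique [] [] e l = cong (_∷ []) (∷-injectiveˡ e)
  prefix-unique [] (one _ ∷ S′) () l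
  prefix-unique (one _ ∷ S) [] () l
  prefix-unique (one x ∷ S) (one x′ ∷ S′) e l =
      cong₂ _∷_ (∷-injectiveˡ e) (prefix-unique S S′ (∷-injectiveʳ e) l)
  prefix-unique (one x ∷ S) (blk _ _ ∷ S′) () l
  prefix-unique (blk _ _ ∷ S) (one x ∷ S′) () l
  prefix-unique (blk _ _ ∷ S) (blk _ _ ∷ S′) e l =
      cong₂ _∷_ (∷-injectiveˡ e) (prefix-unique S S′ (∷-injectiveʳ e) (suc-injective l))

  -- `findO` tells whether a part was inserted, and if so which one and where. If none was, the cut
  -- is after block n + 1 of the bottom-greedy segmentation of the result.
  ins-inj : ∀ n {π π′ σ} → H π → InX n π → H π′ → InX n π′ → Ins (suc n) π σ → Ins (suc n) π′ σ → π ≡ π′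
  ins-inj n hπ ix hπ′ ix′ (S , suc M , L , t , refl) (S′ , suc M′ , L′ , t′ , e)
    with just-injective (trans (sym (out-O t (source (W-real hπ) ix t)))
        (trans (cong findO e) (out-O t′ (source (W-real hπ′) ix′ t′))))
  ... | eq = trans (TS-flat t) (trans
      (cong₂ flatT (rot-injective S S′ (BG-front t (W-real hπ)) (BG-front t′ (W-real hπ′)) (cong proj₁ eq))
      (cong (proj₂ ∘ proj₂) eq)) (sym (TS-flat t′)))
  ins-inj n hπ ix hπ′ ix′ (S , suc M , L , t , refl) (S′ , zero , L′ , t′ , e)
    with trans (sym (out-O t (source (W-real hπ) ix t)))
        (trans (cong findO e) (findO-none _ (out-¬O t′ (source (W-real hπ′) ix′ t′))))
  ... | ()
  ins-inj n hπ ix hπ′ ix′ (S , zero , L , t , refl) (S′ , suc M′ , L′ , t′ , e)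
    with trans (sym (out-O t′ (source (W-real hπ′) ix′ t′)))
        (trans (cong findO (sym e)) (findO-none _ (out-¬O t (source (W-real hπ) ix t))))
  ... | ()
  ins-inj n hπ ix hπ′ ix′ (S , zero , L , t , refl) (S′ , zero , L′ , t′ , e) with ends-in-block
      t | ends-in-block t′
  ... | S₀ , b , as , refl | S₀′ , b′ , as′ , refl with prefix-unique S₀ S₀′ segs cnt≡
    where
    segs : S ++ bseg L ≡ S′ ++ bseg L′
    segs = trans (sym (BG-bseg S (bseg L) L (BG-all t (W-real hπ)) refl))
        (trans (cong bseg e) (BG-bseg S′ (bseg L′) L′ (BG-all t′ (W-real hπ′)) refl))
    cnt≡ : #blk S₀ ≡ #blk S₀′
    cnt≡ = suc-injective (trans (sym (#blk-snoc S₀ b as))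
        (trans (+-cancelʳ-≡ 0 (#blk S) (#blk S′) (trans (TS-count t) (sym (TS-count t′))))
        (#blk-snoc S₀′ b′ as′)))
  ...   | eqS = trans (TS-flat t)
      (trans (cong₂ flatT eqS (rotT-cancel S (trans e (cong (λ s → rotT s L′) (sym eqS)))))
      (sym (TS-flat t′)))

  -- Deletion.

  All>-++ : ∀ c xs {ys} → All> c xs → All> c ys → All> c (xs ++ ys)
  All>-++ c []       a b = b
  All>-++ c (x ∷ xs) (h , a) b = h , All>-++ c xs a b

  All>-++ˡ : ∀ c xs {ys} → All> c (xs ++ ys) → All> c xs
  All>-++ˡ c []       a = tt
  All>-++ˡ c (x ∷ xs) (h , a) = h , All>-++ˡ c xs a

  All>-++ʳ : ∀ c xs {ys} → All> c (xs ++ ys) → All> c ys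
  All>-++ʳ c []       a = a
  All>-++ʳ c (x ∷ xs) (h , a) = All>-++ʳ c xs a

  pos⇒All> : ∀ {xs} → All Pos xs → All> 0 xs
  pos⇒All> []       = tt
  pos⇒All> (p ∷ ps) = p , pos⇒All> ps

  All>⇒pos : ∀ {c} xs → All> c xs → All Pos xs
  All>⇒pos []       a = []
  All>⇒pos (x ∷ xs) (h , a) = ≤-trans (s≤s z≤n) h ∷ All>⇒pos xs a

  above-over : ∀ U o {R} → W (U ++ o ∷ R) → over o ≡ true → All> (size o) U
  above-over []      o w e = tt
  above-over (u ∷ []) o w e = ≤-trans
      (≤-reflexive (trans (+-comm 1 (size o)) (cong (λ b → size o + (if b then 1 else 0)) (sym e))))
      (proj₁ w) , tt
  above-over (u ∷ u′ ∷ U) o w e with above-over (u′ ∷ U) o (proj₂ (proj₂ w)) e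
  ... | h , a = ≤-trans h (≽⇒≥ u u′ (proj₁ w)) , h , a

  -- Only a block directly above o is in doubt. Its gap gives size o ≤ size (down b), strictly if b
  -- is plain; if b is overlined, equality would make b an overlined multiple of η.
  flat-above : ∀ S o {R ψ} → Top S ψ → W (rotT S (o ∷ R)) → isO o → All ¬O (rotT S []) →
      All> (size o) (flatT S [])
  flat-above [] o top w p a = tt
  flat-above (one x ∷ S) o {R} (_ , top) w p (_ ∷ a) =
    proj₁ (above-over (x ∷ rotT S []) o (subst W (cong (x ∷_) (rotT-[] S (o ∷ R))) w) (proj₁ p)) ,
        flat-above S o top (proj₂ (proj₂ w)) p a
  flat-above (blk b as ∷ S) o {R} (len , h , _ , top) w p (¬b ∷ a) =
    All>-++ (size o) as (All>-++ˡ (size o) as up-as) (dn ,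
        flat-above S o top (W-++ʳ as (proj₂ (proj₂ w))) p (All.++⁻ʳ as a))
    where
    up-as : All> (size o) (as ++ rotT S [])
    up-as = above-over (as ++ rotT S []) o
        (subst W (trans (cong (as ++_) (rotT-[] S (o ∷ R))) (sym (++-assoc as (rotT S []) (o ∷ R))))
        (proj₂ (proj₂ w))) (proj₁ p)
    gp : at 0 (rotT S [] ++ o ∷ R) (Gap b)
    gp = subst (λ l → at 0 l (Gap b)) (rotT-[] S (o ∷ R))
        (at→ as {rotT S (o ∷ R)} 0 (trans (+-identityʳ _) len) (proj₁ (proj₂ w)))
    dn : size o < size (down b)
    dn = go (rotT S []) gp (All>-++ʳ (size o) as up-as)
      where
      go : ∀ U → at 0 (U ++ o ∷ R) (Gap b) → All> (size o) U → size o < size (down b)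
      go (u ∷ U) g (k , _) = ≤-trans k (m+n≤o⇒m≤o (size u) (gap⇒κ b u g))
      go []      g _ with m≤n⇒m<n∨m≡n (m+n≤o⇒m≤o (size o) (gap⇒κ b o g))
      ... | inj₁ lt = lt
      ... | inj₂ eq = ⊥-elim (bad (over b) refl (gap⇒κ b o g))
        where
        bad : ∀ c → over b ≡ c → size o + (if c then 0 else 1) ≤ size (down b) → ⊥
        bad false e k = <-irrefl eq (≤-trans (≤-reflexive (+-comm 1 (size o))) k)
        bad true  e k = ¬O-⇒down b h ¬b (e , trans (cong (_% η) (sym eq)) (proj₂ p))

  -- By `size-bound` a segment exceeds η times the number of bands below it, plus c, and `T-top`
  -- identifies these bands with the remaining blocks and those of V.
  sz-build : ∀ c S V R K → Top S V → W (flatT S (V ++ R)) → All> c (flatT S V) →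
      T 0 V * η + c ≡ K * η → Sz K S
  sz-build c [] V R K top w a e = tt
  sz-build c (one x ∷ S) V R K (g , top) w a e =
    subst (_< size x) (trans (cong (λ n → n * η + c) (T-top S V top)) (arith (#blk S)))
        (size-bound c x (flatT S V) R (subst W (cong (x ∷_) (flatT-++ S V R)) w) a) ,
    sz-build c S V R K top (proj₂ (proj₂ w)) (proj₂ a) e
    where
    arith : ∀ m → (m + T 0 V) * η + c ≡ (m + K) * η
    arith m = trans (cong (_+ c) (*-distribʳ-+ η m (T 0 V)))
        (trans (+-assoc (m * η) _ c) (trans (cong (m * η +_) e) (sym (*-distribʳ-+ η m K))))
  sz-build c (blk b as ∷ S) V R K (_ , _ , _ , top) w a e =
    subst (_< size (down b)) (trans (cong (λ n → n * η + c) (T-top S V top)) (arith (#blk S)))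
      (size-bound c (down b) (flatT S V) R (subst W (cong (down b ∷_) (flatT-++ S V R)) (W-++ʳ as w))
          (All>-++ʳ c as a)) ,
    sz-build c S V R K top (proj₂ (proj₂ (W-++ʳ as w))) (proj₂ (All>-++ʳ c as a)) e
    where
    arith : ∀ m → (m + T 0 V) * η + c ≡ (m + K) * η
    arith m = trans (cong (_+ c) (*-distribʳ-+ η m (T 0 V)))
        (trans (+-assoc (m * η) _ c) (trans (cong (m * η +_) e) (sym (*-distribʳ-+ η m K))))

  -- Converse to `W-O`: what may stand below the inserted part makes the scan stop.
  stop-at-O : ∀ M L → W (O (suc M) ∷ L) → TS (suc M) L [] (suc M) L
  stop-at-O M [] w = end
  stop-at-O M (x ∷ L) w with bandᵇ x L | bview x L
  ... | .false | noband g = stop₁ g (≽⇒≥ (O (suc M)) x (proj₁ w))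
  ... | .true  | band bd@(mkBand as z R e l ¬g) =
      stopᵇ bd (+-cancelˡ-≤ η _ _ (≤-trans (≤-reflexive (+-comm η (size z)))
    (gap⇒+η≤ (O (suc M)) z (at→ as {z ∷ R} 0 (trans (+-identityʳ _) l)
        (subst (λ l → at q l (Gap (O (suc M)))) e (proj₁ (proj₂ w)))))))

  DelResult : ℕ → List Part → Set
  DelResult n σ = ∃[ π ] (Ins (suc n) π σ × H π × InX n π × wt σ ≡ wt π + suc n * η)

  module DelO (n M : ℕ) (U L : List Part) (hσ : H (U ++ O (suc M) ∷ L)) (aU : All ¬O U)
      (lv : suc M + T 0 U ≡ suc n) where
    o : Part
    o = O (suc M)
    S : List Seg
    S = bseg U
    bg : BG S
    bg = bseg-BG U
    rotS : ∀ τ → rotT S τ ≡ U ++ τ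
    rotS = bseg-rot U
    rotS[] : rotT S [] ≡ U
    rotS[] = trans (rotS []) (++-identityʳ U)
    wσ : W (rotT S (o ∷ L ++ Z))
    wσ = subst W (trans (++-assoc U (o ∷ L) Z) (sym (rotS (o ∷ L ++ Z)))) (H.windows hσ)
    wo : W (o ∷ L ++ Z)
    wo = W-++ʳ U (subst W (rotS (o ∷ L ++ Z)) wσ)
    bk : Back S o (L ++ Z) (L ++ Z)
    bk = bwd (tails-ins o (L ++ Z) wo) S bg wσ
    topL : Top S L
    topL = Top-++⁻ S L Z (Back.top bk)
    top[] : Top S []
    top[] = Top-++⁻ S [] (L ++ Z) (Back.top bk)
    π : List Part
    π = flatT S L
    #S : #blk S ≡ T 0 U
    #S = trans (sym (T-rot S bg)) (cong (T 0) rotS[])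
    big : All> (suc M * η) (flatT S [])
    big = flat-above S o top[] wσ (isO-O (suc M)) (subst (All ¬O) (sym rotS[]) aU)
    sz : Sz (suc M) S
    sz = sz-build (suc M * η) S [] (L ++ Z) (suc M) top[] (Back.valid bk) big refl
    ts : TS (suc n) π S (suc M) L
    ts = subst₂ (λ N s → TS N π s (suc M) L)
        (trans (cong (_+ suc M) #S) (trans (+-comm (T 0 U) (suc M)) lv)) (++-identityʳ S)
      (TS-build S topL sz (stop-at-O M L (W-front (o ∷ L) Z wo)))
    σ≡ : U ++ o ∷ L ≡ out S (suc M) L
    σ≡ = sym (rotS (o ∷ L))
    hπ : H π
    hπ = mkH (subst W (flatT-++ S L Z) (Back.valid bk))
      (all-flat adm-⇒down S topL (subst (All Adm) σ≡ (H.adm hσ)) (All.tail (All.++⁻ʳ U (H.adm hσ))))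
      (subst (All Pos) (sym (flatT-++ S [] L))
          (All.++⁺ (All>⇒pos _ big) (All.tail (All.++⁻ʳ U (H.pos hσ)))))
    front-¬O : All ¬O (flatT S [])
    front-¬O = all-flat ¬O-⇒down S top[] (subst (All ¬O) (sym rotS[]) aU) []
    posL : All Pos (o ∷ L)
    posL = All.++⁻ʳ U (H.pos hσ)
    lvl : ∀ m → m < suc M → #blk S + m ≤ n
    lvl m h = s≤s⁻¹ (subst (suc (#blk S + m) ≤_)
        (trans (cong (_+ suc M) #S) (trans (+-comm (T 0 U) (suc M)) lv))
        (≤-trans (≤-reflexive (sym (+-suc (#blk S) m))) (+-monoʳ-≤ (#blk S) h)))
    inX : InX n π
    inX with findO L in e
    -- `size-bound` below o leaves at most M bands in L, so π has at most n bands and nothing below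
    -- the first n needs checking.
    ... | nothing = subst (InX′ n π)
        (sym (findO-none π (subst (All ¬O) (sym (flatT-++ S [] L)) (All.++⁺ front-¬O (findO-nothing L e)))))
      (T≡0⇒AE (tl n 0 π) (T-tl n 0 π
          (≤-trans (≤-reflexive (T-top S L topL)) (lvl (T 0 L) (*-cancelʳ-< η (T 0 L) (suc M)
        (subst (_< suc M * η) (+-identityʳ _) (size-bound 0 o L Z wo (pos⇒All> posL))))))))
    -- With c the size of o′, `size-bound` gives T 0 V + F o′ ≤ M, which is the level bound after
    -- adding the blocks of S.
    ... | just (V , o′ , L′) with findO-just L e
    ...   | refl , aV , p′ = subst (InX′ n π) (sym fo) (≤-trans (≤-reflexive eqn) (lvl (T 0 V + F o′) lt))
      where
      fo : findO π ≡ just (flatT S V , o′ , L′)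
      fo = trans (cong findO (flatT-++ S V (o′ ∷ L′)))
          (findO-at (flatT S V) o′ L′ (subst (All ¬O) (sym (flatT-++ S [] V)) (All.++⁺ front-¬O aV)) p′)
      eqn : F o′ + T 0 (flatT S V) ≡ #blk S + (T 0 V + F o′)
      eqn = trans (cong (F o′ +_) (T-top S V (Top-++⁻ S V (o′ ∷ L′) topL)))
          (solve 3 (λ a b c → a :+ (b :+ c) := b :+ (c :+ a)) refl (F o′) (#blk S) (T 0 V))
      wV : W ((o ∷ V) ++ o′ ∷ L′ ++ Z)
      wV = subst W (cong (o ∷_) (++-assoc V (o′ ∷ L′) Z)) wo
      lt : T 0 V + F o′ < suc M
      lt = *-cancelʳ-< η (T 0 V + F o′) (suc M)
          (subst (_< suc M * η) (trans (cong (T 0 V * η +_) (size-O o′ p′))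
          (sym (*-distribʳ-+ η (T 0 V) (F o′))))
        (size-bound (size o′) o V (o′ ∷ L′ ++ Z) wV (above-over (o ∷ V) o′ wV (proj₁ p′))))
    result : DelResult n (U ++ o ∷ L)
    result = π , (S , suc M , L , ts , σ≡) , hπ , inX ,
      trans (cong wt σ≡) (trans (wt-out S (suc M) L topL) (cong (λ k → wt π + k * η) (TS-count ts)))

  flatT-cons : ∀ S as z L → ∃[ y ] ∃[ ys ] (flatT S (as ++ z ∷ L) ≡ y ∷ ys)
  flatT-cons []                 []       z L = _ , _ , refl
  flatT-cons []                 (a ∷ as) z L = _ , _ , refl
  flatT-cons (one x ∷ S)        as       z L = _ , _ , refl
  flatT-cons (blk b [] ∷ S)     as       z L = _ , _ , refl
  flatT-cons (blk b (c ∷ _) ∷ S) as      z L = _ , _ , refl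

  pos-above : ∀ z xs R → ∃[ y ] ∃[ ys ] (xs ≡ y ∷ ys) → W (z ∷ xs ++ R) → All Pos xs → Pos z
  pos-above z xs R (y , ys , refl) w (p ∷ _) = ≤-trans p (≽⇒≥ z y (proj₁ w))

  nth-block : ∀ n S → n < #blk S → ∃[ S₀ ] ∃[ b ] ∃[ as ] ∃[ R ] (S ≡ S₀ ++ blk b as ∷ R × #blk S₀ ≡ n)
  nth-block n (one x ∷ S) h with nth-block n S h
  ... | S₀ , b , as , R , refl , e = one x ∷ S₀ , b , as , R , refl , e
  nth-block zero (blk b as ∷ S) h = [] , b , as , S , refl , refl
  nth-block (suc n) (blk b as ∷ S) (s≤s h) with nth-block n S h
  ... | S₀ , b′ , as′ , R , refl , e = blk b as ∷ S₀ , b′ , as′ , R , refl , cong suc e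

  rotT-app : ∀ S R τ → rotT (S ++ R) τ ≡ rotT S (rotT R τ)
  rotT-app [] R τ = refl
  rotT-app (one x ∷ S) R τ = cong (x ∷_) (rotT-app S R τ)
  rotT-app (blk b as ∷ S) R τ = cong (λ l → b ∷ as ++ l) (rotT-app S R τ)

  Ev? : ∀ xs → Dec (Ev xs)
  Ev? xs = par (mass xs) ≟ᵇ par (suc r)

  module DelMove (n : ℕ) (σ : List Part) (hσ : H σ) (aσ : All ¬O σ) (isin : AE (tl (suc n) 0 σ))
      (notin : ¬ AE (tl n 0 σ))
                 (S₀ : List Seg) (b : Part) (as : List Part) (S₂ : List Seg)
                     (S≡ : bseg σ ≡ S₀ ++ blk b as ∷ S₂) (#S₀ : #blk S₀ ≡ n) where
    L U₀ : List Part
    L = rotT S₂ []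
    U₀ = rotT S₀ []
    bgAll : BG (S₀ ++ blk b as ∷ S₂)
    bgAll = subst BG S≡ (bseg-BG σ)
    bg₀ : BG S₀
    bg₀ = BG-++ˡ S₀ _ bgAll
    bgB : BG (blk b as ∷ S₂)
    bgB = BG-++ʳ S₀ _ bgAll
    len : length as ≡ q
    len = proj₁ bgB
    bd : up (last b as) ≽ b
    bd = proj₁ (proj₂ bgB)
    σ≡ : σ ≡ U₀ ++ b ∷ as ++ L
    σ≡ = trans (sym (trans (bseg-rot σ []) (++-identityʳ σ)))
        (trans (cong (λ S → rotT S []) S≡) (trans (rotT-app S₀ (blk b as ∷ S₂) []) (rotT-[] S₀ _)))
    T₀ : T 0 U₀ ≡ n
    T₀ = trans (T-rot S₀ bg₀) #S₀
    fs : All Free (U₀ ++ b ∷ as ++ L)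
    fs = subst (All Free) σ≡ (H-free hσ aσ)
    fB : All Free (b ∷ as ++ L)
    fB = All.++⁻ʳ U₀ fs
    wσ : W (U₀ ++ b ∷ as ++ L)
    wσ = subst W σ≡ (W-real hσ)
    wB : W (b ∷ as ++ L)
    wB = W-++ʳ U₀ wσ
    wσZ : W (rotT S₀ (b ∷ as ++ L ++ Z))
    wσZ = subst W (trans (cong (_++ Z) σ≡)
        (trans (++-assoc U₀ (b ∷ as ++ L) Z)
        (trans (cong (λ l → U₀ ++ b ∷ l) (++-assoc as L Z)) (sym (rotT-[] S₀ _))))) (H.windows hσ)
    wBZ : W (b ∷ as ++ L ++ Z)
    wBZ = W-++ʳ U₀ (subst W (rotT-[] S₀ _) wσZ)

    T₁ : T 0 (U₀ ++ b ∷ as) ≡ suc n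
    T₁ = trans (cong (T 0) (sym (trans (rotT-snoc S₀ b as [])
        (cong (λ l → U₀ ++ b ∷ l) (++-identityʳ as)))))
      (trans (T-rot (S₀ ++ blk b as ∷ [])
          (BG-++ˡ (S₀ ++ blk b as ∷ []) S₂ (subst BG (sym (++-assoc S₀ (blk b as ∷ []) S₂)) bgAll)))
        (trans (#blk-snoc S₀ b as) (cong suc #S₀)))

    -- By `T₁` the first n + 1 bands lie above L, so `isin` covers all bands of L.
    aeL : AE L
    aeL = AE-suf (tl (suc n) 0 (U₀ ++ b ∷ as)) L
        (subst AE (trans (cong (tl (suc n) 0) (trans σ≡ (sym (++-assoc U₀ (b ∷ as) L))))
      (tl-++ (suc n) 0 (U₀ ++ b ∷ as) L (≤-reflexive (sym T₁)) z≤n)) isin)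

    -- If this block were even, its parity would spread to every band that overlaps it, and all
    -- bands below the first n would be even, against `notin`.
    odd : ¬ Ev (b ∷ as ++ L)
    odd ev = notin (subst AE (sym (trans (cong (tl n 0) σ≡)
        (tl-++ n 0 U₀ (b ∷ as ++ L) (≤-reflexive (sym T₀)) z≤n)))
      (AE-before-block Y b as L (T-tl n 0 U₀ (≤-reflexive T₀)) len bd (W-++ʳ pre (subst W eqY wσ))
          (All.++⁻ʳ pre (subst (All Free) eqY fs)) ev
        ((λ _ → ev) , AE-block b as L len bd wB fB ev aeL)))
      where
      Y pre : List Part
      Y = tl n 0 U₀
      pre = proj₁ (tl-suf n 0 U₀)
      eqY : U₀ ++ b ∷ as ++ L ≡ pre ++ Y ++ b ∷ as ++ L
      eqY = trans (cong (_++ b ∷ as ++ L) (proj₂ (tl-suf n 0 U₀))) (++-assoc pre Y _)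

    pB : All Pos (b ∷ as ++ L)
    pB = All.++⁻ʳ U₀ (subst (All Pos) σ≡ (H.pos hσ))

    open OddBlock b as S₂ len bd (proj₁ (proj₂ (proj₂ bgB))) (proj₂ (proj₂ (proj₂ bgB))) wBZ fB pB odd aeL
        using (η<b; η≤b; tails)

    φ : List Part
    φ = as ++ down b ∷ L
    φZ : φ ++ Z ≡ as ++ down b ∷ L ++ Z
    φZ = ++-assoc as (down b ∷ L) Z
    bk : Back S₀ b (as ++ L ++ Z) (as ++ down b ∷ L ++ Z)
    bk = bwd tails S₀ bg₀ wσZ
    topφ : Top S₀ φ
    topφ = Top-++⁻ S₀ φ Z (subst (Top S₀) (sym φZ) (Back.top bk))
    π : List Part
    π = flatT S₀ φ
    wπ : W (π ++ Z)
    wπ = subst W (trans (cong (flatT S₀) (sym φZ)) (flatT-++ S₀ φ Z)) (Back.valid bk)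
    tb : TopBand as b
    tb = topBand b as η≤b wBZ
    pos-z : Pos (down b)
    pos-z = m<n⇒0<n∸m η<b

    S₁ : List Seg
    S₁ = S₀ ++ blk b as ∷ []
    -- A part moved down stays positive because there is a part below it.
    posπ : All Pos π
    posπ = go S₀ topφ (Back.valid bk) (subst (All Pos) (trans σ≡ (sym (rotT-[] S₀ _))) (H.pos hσ))
      where
      pφ : All Pos φ
      pφ = All.++⁺ (All.++⁻ˡ as (All.tail pB)) (pos-z ∷ All.++⁻ʳ (b ∷ as) pB)
      go : ∀ S → Top S φ → W (flatT S (as ++ down b ∷ L ++ Z)) → All Pos (rotT S (b ∷ as ++ L)) →
          All Pos (flatT S φ)
      go [] top w ps = pφ
      go (one x ∷ S) (_ , top) w (p ∷ ps) = p ∷ go S top (proj₂ (proj₂ w)) ps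
      go (blk c cs ∷ S) (_ , _ , _ , top) w (p ∷ ps) with go S top (proj₂ (proj₂ (W-++ʳ cs w)))
          (All.++⁻ʳ cs ps)
      ... | ih = All.++⁺ (All.++⁻ˡ cs ps) (pos-above (down c) (flatT S φ) Z (flatT-cons S as (down b) L)
        (subst W (cong (down c ∷_) (trans (cong (flatT S) (sym φZ)) (flatT-++ S φ Z))) (W-++ʳ cs w))
            ih ∷ ih)

    admπ : All Adm π
    admπ = all-flat adm-⇒down S₀ topφ (subst (All Adm) (trans σ≡ (sym (rotT-[] S₀ _))) (H.adm hσ))
      (All.++⁺ (All.++⁻ˡ as (All.tail aB)) (adm-⇒down b η≤b (All.head aB) ∷ All.++⁻ʳ (b ∷ as) aB))
      where
      aB : All Adm (b ∷ as ++ L)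
      aB = All.++⁻ʳ U₀ (subst (All Adm) σ≡ (H.adm hσ))

    ¬Oπ : All ¬O π
    ¬Oπ = all-flat ¬O-⇒down S₀ topφ (subst (All ¬O) (trans σ≡ (sym (rotT-[] S₀ _))) aσ)
      (All.++⁺ (All.++⁻ˡ as (All.tail aB)) (¬O-⇒down b η≤b (All.head aB) ∷ All.++⁻ʳ (b ∷ as) aB))
      where
      aB : All ¬O (b ∷ as ++ L)
      aB = All.++⁻ʳ U₀ (subst (All ¬O) σ≡ aσ)

    hπ : H π
    hπ = mkH wπ admπ posπ

    -- V is the block moved back, a single band, so c = 0 and K = 1.
    sz : Sz 1 S₀
    sz = sz-build 0 S₀ (as ++ down b ∷ []) (L ++ Z) 1
        (Top-++⁻ S₀ (as ++ down b ∷ []) L (subst (Top S₀) (sym (++-assoc as (down b ∷ []) L)) topφ))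
      (subst (W ∘ flatT S₀) (sym (++-assoc as (down b ∷ []) (L ++ Z))) (Back.valid bk))
      (All>-++ˡ 0 (flatT S₀ (as ++ down b ∷ []))
          (subst (All> 0) (trans (cong (flatT S₀) (sym (++-assoc as (down b ∷ []) L)))
          (flatT-++ S₀ (as ++ down b ∷ []) L)) (pos⇒All> posπ)))
      (trans (+-identityʳ _) (cong (_* η) (T-band as (down b) [] len (topBand⇒headBand as b η≤b tb))))

    ts : TS (suc n) π S₁ 0 L
    ts = subst (λ N → TS N π S₁ 0 L) (trans (+-comm (#blk S₀) 1) (cong suc #S₀)) (TS-build S₀ topφ sz base)
      where
      base : TS 1 φ (blk b as ∷ []) 0 L
      base = mk as refl (topBand⇒headBand as b η≤b tb)
        where
        up-down : up (down b) ≡ b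
        up-down = cong (λ s → part s (over b)) (down+η b η≤b)
        mk : ∀ as′ → as ≡ as′ → HeadBand as′ (down b) → TS 1 (as′ ++ down b ∷ L) (blk b as′ ∷ []) 0 L
        mk [] refl hb = subst (λ y → TS 1 (down b ∷ L) (blk y [] ∷ []) 0 L) up-down
            (blk (mkBand [] (down b) L refl len hb) pos-z done)
        mk (a ∷ as′) refl hb = subst (λ y → TS 1 (a ∷ as′ ++ down b ∷ L) (blk y (a ∷ as′) ∷ []) 0 L)
            up-down (blk (mkBand (a ∷ as′) (down b) L refl len hb) pos-z done)

    evφ : Ev φ
    evφ = ≢-not (λ e → odd (trans (cong par (mass-move b as L len η≤b)) e))

    fφ : All Free φ
    fφ = flat-tail S₀ (H-free hπ ¬Oπ)

    wφ : W φ
    wφ = W-++ʳ (flatT S₀ []) (subst W (flatT-++ S₀ [] φ) (W-front π Z wπ))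

    -- The block is even again once moved back, and `AE-block` spreads this over its front.
    aeφ : AE φ
    aeφ = go as refl len tb
      where
      go : ∀ as′ → as ≡ as′ → length as′ ≡ q → TopBand as′ b → AE (as′ ++ down b ∷ L)
      go [] refl l tb = (λ _ → evφ) , aeL
      go (a ∷ as′) refl l tb = (λ _ → evφ) , subst AE (++-assoc as′ (down b ∷ []) L)
        (AE-block a (as′ ++ down b ∷ []) L (trans (length-++ as′) (trans (+-comm (length as′) 1) l))
          (subst (λ z → up z ≽ a) (sym (last-++ a as′ (down b) []))
              (subst (_≽ a) (sym (cong (λ s → part s (over b)) (down+η b η≤b))) tb))
          (subst W (cong (a ∷_) (sym (++-assoc as′ (down b ∷ []) L))) wφ)
              (subst (All Free) (cong (a ∷_) (sym (++-assoc as′ (down b ∷ []) L))) fφ)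
          (subst Ev (cong (a ∷_) (sym (++-assoc as′ (down b ∷ []) L))) evφ) aeL)

    inX : InX n π
    inX = subst (InX′ n π) (sym (findO-none π ¬Oπ))
        (subst (λ m → AE (tl m 0 π)) #S₀ (AE-tl-top S₀ φ topφ aeφ))

    result : DelResult n σ
    result = π , (S₁ , 0 , L , ts , σ-out) , hπ , inX ,
      trans (cong wt σ-out) (trans (wt-out S₁ 0 L (TS-top ts))
          (cong₂ (λ l k → wt l + k * η) (sym (TS-flat ts)) (TS-count ts)))
      where
      σ-out : σ ≡ out S₁ 0 L
      σ-out = trans σ≡ (sym (rotT-snoc S₀ b as L))

  del-step : ∀ n σ → H σ → InX (suc n) σ → ¬ InX n σ → DelResult n σ
  del-step n σ hσ isin notin with findO σ in e
  ... | just (U , o , L) with findO-just σ e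
  ...   | refl , aU , p = go (F o) refl (≤-antisym isin (≰⇒> notin))
    where
    go : ∀ M → F o ≡ M → F o + T 0 U ≡ suc n → DelResult n (U ++ o ∷ L)
    go zero e′ lv = ⊥-elim (n≮0 (subst (1 ≤_) (trans (size-O o p) (cong (_* η) e′))
        (All.head (All.++⁻ʳ U (H.pos hσ)))))
    go (suc M) e′ lv = subst (λ y → DelResult n (U ++ y ∷ L)) (sym o≡)
        (DelO.result n M U L (subst (λ y → H (U ++ y ∷ L)) o≡ hσ) aU (trans (cong (_+ T 0 U) (sym e′)) lv))
      where
      o≡ : o ≡ O (suc M)
      o≡ = trans (isO⇒O o p) (cong O e′)
  del-step n σ hσ isin notin | nothing with n <? #blk (bseg σ)
  -- With at most n bands nothing is left to be odd below the first n.
  ... | no ¬h = ⊥-elim (notin (T≡0⇒AE (tl n 0 σ) (T-tl n 0 σ (≤-trans (≤-reflexive Tσ) (≮⇒≥ ¬h)))))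
    where
    Tσ : T 0 σ ≡ #blk (bseg σ)
    Tσ = trans (cong (T 0) (sym (trans (bseg-rot σ []) (++-identityʳ σ)))) (T-rot (bseg σ) (bseg-BG σ))
  ... | yes h with nth-block n (bseg σ) h
  ...   | S₀ , b , as , S₂ , S≡ , #S₀ =
      DelMove.result n σ hσ (findO-nothing σ e) isin notin S₀ b as S₂ S≡ #S₀

-- From the bijection to the recurrence for the counts.

module Counting {l : ℕ} (α : Vec ℕ l) (η : ℕ) .{{η≢0 : NonZero η}} (q r : ℕ)
                (|A|≤ : length (toList α) ≤ suc q) (1≤r : 1 ≤ r) (r≤k : r ≤ suc (suc q)) where

  A : List ℕ
  A = toList α

  open Blocks η q
  open Bijection η q A |A|≤ r 1≤r r≤k

  k : ℕ
  k = suc (suc q)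

  at-long : {P : Part → Set} → ∀ i xs → length xs ≤ i → at i xs P
  at-long i       []       h       = tt
  at-long (suc i) (x ∷ xs) (s≤s h) = at-long i xs h

  -- As r ≥ 1 there are at most q + 1 = k - 1 zeros, too few for two of them to be at distance k -
  -- 1.
  W-zeros : ∀ n → n ≤ suc q → W (replicate n zero₀)
  W-zeros zero          h       = tt
  W-zeros (suc zero)    h       = tt , tt , tt
  W-zeros (suc (suc n)) (s≤s h) =
      z≤n , at-long q (replicate (suc n) zero₀) (≤-trans (≤-reflexive (length-replicate (suc n))) h) ,
      W-zeros (suc n) (≤-trans h (n≤1+n q))

  smalls : List Part → ℕ
  smalls = countᵇ (λ x → x ≤ₚ plain η)

  smalls≤length : ∀ xs → smalls xs ≤ length xs
  smalls≤length []       = z≤n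
  smalls≤length (x ∷ xs) with x ≤ₚ plain η
  ... | true  = s≤s (smalls≤length xs)
  ... | false = ≤-trans (smalls≤length xs) (n≤1+n _)

  W⇒smalls : ∀ xs → W (xs ++ Z) → All Pos xs → smalls xs < r
  W⇒smalls []       w ps       = 1≤r
  W⇒smalls (x ∷ xs) w (_ ∷ ps) with x ≤ₚ plain η in e
  ... | true  = ≤-trans (s≤s (s≤s (smalls≤length xs))) (small-count x xs w ps (small⁻ x e))
  ... | false = W⇒smalls xs (proj₂ (proj₂ w)) ps

  all-small : ∀ xs → All (λ u → size u + ov u ≤ η) xs → smalls xs ≡ length xs
  all-small []       []      = refl
  all-small (x ∷ xs) (h ∷ a) rewrite small⁺ x h = cong suc (all-small xs a)

  -- If x has no gap to 0, then x and all parts below it count as small. They number at most r - 1,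
  -- and with the k - r zeros the list is too short to reach distance k - 1.
  smalls⇒W : ∀ xs → W xs → smalls xs < r → W (xs ++ Z)
  smalls⇒W [] w h = W-zeros (k ∸ r) (≤-trans (∸-monoʳ-≤ k 1≤r) ≤-refl)
  smalls⇒W (x ∷ xs) w h = at-++Z 0 xs z≤n (proj₁ w) , far (gap? x zero₀) ,
      smalls⇒W xs (proj₂ (proj₂ w)) (≤-trans (s≤s (m≤n+m _ _)) h)
    where
    far : Dec (Gap x zero₀) → at q (xs ++ Z) (Gap x)
    far (yes g) = at-++Z q xs g (proj₁ (proj₂ w))
    far (no ¬g) = at-long q (xs ++ Z) (s≤s⁻¹ (s≤s⁻¹ (begin
      suc (suc (length (xs ++ Z)))       ≡⟨ cong (suc ∘ suc) (length-++ xs) ⟩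
      suc (suc (length xs)) + length Z   ≤⟨ +-monoˡ-≤ (length Z) (subst (_< r) cnt≡ h) ⟩
      r + length Z                       ≡⟨ trans (+-comm r (length Z)) |Z| ⟩
      k                                  ∎)))
      where
      open ≤-Reasoning
      sx : size x + ov x ≤ η
      sx = ¬gap⇒up x zero₀ ¬g
      cnt≡ : smalls (x ∷ xs) ≡ suc (length xs)
      cnt≡ = all-small (x ∷ xs) (sx ∷ All.map (λ {u} p → ≤-trans p (m+n≤o⇒m≤o (size x) sx))
          (chain⇒below x xs (W⇒chain (x ∷ xs) w)))

  wt≥length : ∀ xs → All Pos xs → length xs ≤ wt xs
  wt≥length []       []       = z≤n
  wt≥length (x ∷ xs) (p ∷ ps) = +-mono-≤ p (wt≥length xs ps)

  size≤wt : ∀ xs → All (λ x → size x ≤ wt xs) xs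
  size≤wt []       = []
  size≤wt (x ∷ xs) = m≤m+n (size x) (wt xs) ∷ All.map (λ h → ≤-trans h (m≤n+m (wt xs) (size x)))
      (size≤wt xs)

  H⇒∈ : ∀ n xs → All Pos xs → wt xs ≡ n → xs ∈ allOverpartitions n
  H⇒∈ n xs ps refl = ∈-listsUpTo (partAlphabet n) n xs (wt≥length xs ps)
    (All.map (λ { {x} (p , s) → ∈-partAlphabet n x p s }) (All.zip (ps , size≤wt xs)))

  valid : ℕ → List Part → Bool
  valid = validBbarᵇ (fsuc fzero) α η k r

  adm⁻ : ∀ x → residueOK {l} (fsuc fzero) α η k r (size x) ≡ true →
      (over x ∨ (size x % η ≡ᵇ 0)) ≡ true → Adm x
  adm⁻ x e e′ = mkAdm ov⇒ pl⇒
    where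
    ov⇒ : over x ≡ true → size x % η ≡ 0 ⊎ size x % η ∈ A
    ov⇒ _ with ∨-true⁻ (size x % η ≡ᵇ 0) e
    ... | inj₁ h = inj₁ (≡ᵇ⁻ _ 0 h)
    ... | inj₂ h = inj₂ (any-≡⁻ _ A h)
    pl⇒ : over x ≡ false → size x % η ≡ 0
    pl⇒ o = ≡ᵇ⁻ _ 0 (subst (λ b → (b ∨ (size x % η ≡ᵇ 0)) ≡ true) o e′)

  adm⁺ : ∀ x → Adm x → residueOK {l} (fsuc fzero) α η k r (size x) ≡ true ×
      (over x ∨ (size x % η ≡ᵇ 0)) ≡ true
  adm⁺ x (mkAdm o p) = go (over x) refl
    where
    go : ∀ b → over x ≡ b → residueOK {l} (fsuc fzero) α η k r (size x) ≡ true ×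
        (b ∨ (size x % η ≡ᵇ 0)) ≡ true
    go false e rewrite ≡ᵇ⁺ (p e) = refl , refl
    go true  e with o e
    ... | inj₁ h rewrite ≡ᵇ⁺ h = refl , refl
    ... | inj₂ h = ∨-true⁺ʳ (size x % η ≡ᵇ 0) (any-≡⁺ _ A h) , refl

  cond3⁻ : ∀ π → cond3ᵇ (fsuc fzero) α η k r π ≡ true → Windows π
  cond3⁻ π c i e e′ = check i (nth-just⇒< i π e) e e′
    where
    check : ∀ i {x y} → i < length π → nth π i ≡ just x → nth π (i + suc q) ≡ just y → Gap x y
    check i i< e e′ with nth π i | nth π (i + suc q) | All.lookup (all⁻ _ (upTo (length π)) c) (∈-upTo⁺ i<)
    check i i< refl refl | just x | just y | h = gapᵇ⁻ x y h

  -- The anonymous checks inside the conditions, captured by unification.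
  check3 : Σ (List Part → ℕ → Bool) λ f → ∀ π → cond3ᵇ (fsuc fzero) α η k r π ≡ all (f π) (upTo (length π))
  check3 = _ , λ π → refl

  check5 : Σ (List Part → ℕ → Bool) λ f → ∀ π → cond5ᵇ (fsuc fzero) α η k r π ≡ all (f π) (upTo (length π))
  check5 = _ , λ π → refl

  cond3⁺ : ∀ π → Windows π → cond3ᵇ (fsuc fzero) α η k r π ≡ true
  cond3⁺ π g = all⁺ _ (upTo (length π)) (All.tabulate (λ {i} _ → go i))
    where
    go : ∀ i → proj₁ check3 π i ≡ true
    go i with nth π i | nth π (i + suc q) | g i
    ... | nothing | _       | _ = refl
    ... | just x  | nothing | _ = refl
    ... | just x  | just y  | f = gapᵇ⁺ x y (f refl refl)

  if-true : ∀ c {b} → b ≡ true → (if c then b else true) ≡ true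
  if-true true  e = e
  if-true false e = refl

  -- For j = 1 the modulus 2 - j is 1.
  cond5-trivial : ∀ π → cond5ᵇ (fsuc fzero) α η k r π ≡ true
  cond5-trivial π = all⁺ _ (upTo (length π)) (All.tabulate (λ {i} _ → go i))
    where
    go : ∀ i → proj₁ check5 π i ≡ true
    go i with nth π i | nth π (i + q)
    ... | nothing | _       = refl
    ... | just x  | nothing = refl
    ... | just x  | just y  = if-true (if over x then x <ₚ (y +ₚ η) else x ≤ₚ (y +ₚ η))
      (≡ᵇ⁺ (trans (n%1≡0 (sum (map (flr (fsuc fzero) α η k r) (take (suc q) (drop i π))) + 1))
          (sym (n%1≡0 (r + Vbar π x)))))

  valid⁻ : ∀ n π → valid n π ≡ true → H π × wt π ≡ n
  valid⁻ n π v with ∧-true⁻ (isOverpartitionᵇ n π) v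
  ... | v0 , v1 with ∧-true⁻ (cond1ᵇ (fsuc fzero) α η k r π) v1
  ... | c1 , v2 with ∧-true⁻ (cond2ᵇ (fsuc fzero) α η k r π) v2
  ... | c2 , v3 with ∧-true⁻ (cond3ᵇ (fsuc fzero) α η k r π) v3
  ... | c3 , v4 with ∧-true⁻ (cond4ᵇ (fsuc fzero) α η k r π) v4
  ... | c4 , _ with ∧-true⁻ (all (λ x → 1 ≤ᵇ size x) π) (trans (sym (overpartition≡ n π)) v0)
  ... | o1 , v5 with ∧-true⁻ (adjacentᵇ (λ x y → y ≤ₚ x) π) v5
  ... | o2 , v6 with ∧-true⁻ (distinctᵇ (map size (overs π))) v6
  ... | o3 , o4 = mkH (smalls⇒W π (windows⇒W π (adjacent⇒chain π (key-adjacent⁻ π o2) o3) (cond3⁻ π c3))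
      (<ᵇ⁻ _ r c4))
      (All.map (λ { {x} (a , b) → adm⁻ x a b }) (All.zip (all⁻ _ π c1 , all⁻ _ π c2)))
      (All.map (λ {x} → ≤ᵇ⁻ 1 (size x)) (all⁻ _ π o1)) , ≡ᵇ⁻ _ n o4

  valid⁺ : ∀ n π → H π → wt π ≡ n → valid n π ≡ true
  valid⁺ n π h@(mkH w ad ps) e =
      ∧-true⁺ (trans (overpartition≡ n π) (∧-true⁺ (all⁺ _ π (All.map (λ {x} → ≤ᵇ-true) ps))
      (∧-true⁺ (key-adjacent⁺ π ch) (∧-true⁺ (chain⇒distinct π ch) (≡ᵇ⁺ e)))))
    (∧-true⁺ (all⁺ _ π (All.map (λ {x} a → proj₁ (adm⁺ x a)) ad))
        (∧-true⁺ (all⁺ _ π (All.map (λ {x} a → proj₂ (adm⁺ x a)) ad))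
      (∧-true⁺ (cond3⁺ π (W⇒windows π (W-real h))) (∧-true⁺ (<ᵇ⁺ (W⇒smalls π w ps)) (cond5-trivial π)))))
    where
    ch : Chain π
    ch = W⇒chain π (W-real h)

  tl-suc-suf : ∀ N s xs → Suf (tl (suc N) s xs) (tl N s xs)
  tl-suc-suf N       s       []       = suf-refl []
  tl-suc-suf N       (suc s) (x ∷ xs) = tl-suc-suf N s xs
  tl-suc-suf zero    zero    (x ∷ xs) = tl-suf 1 0 (x ∷ xs)
  tl-suc-suf (suc N) zero    (x ∷ xs) with bandᵇ x xs
  ... | true  = tl-suc-suf N q xs
  ... | false = tl-suc-suf (suc N) 0 xs

  InX-suc : ∀ N xs → InX N xs → InX (suc N) xs
  InX-suc N xs h with findO xs
  ... | nothing = Suf-AE (tl-suc-suf N 0 xs) h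
  ... | just _  = ≤-trans h (n≤1+n N)

  AE? : ∀ xs → Dec (AE xs)
  AE? [] = yes tt
  AE? (x ∷ xs) with AE? xs
  ... | no ¬a = no (λ a → ¬a (proj₂ a))
  ... | yes a with bandᵇ x xs | bview x xs
  ...   | .false | noband g = yes ((λ bd → ⊥-elim (gap∧band g bd)) , a)
  ...   | .true  | band bd with Ev? (x ∷ xs)
  ...     | yes ev = yes ((λ _ → ev) , a)
  ...     | no ¬ev = no (λ ae → ¬ev (proj₁ ae bd))

  InX? : ∀ N xs → Dec (InX N xs)
  InX? N xs with findO xs
  ... | nothing          = AE? (tl N 0 xs)
  ... | just (U , o , _) = F o + T 0 U ≤? N

  -- The weight bounds both the number of parts, hence of bands, and o/η plus the number of parts
  -- above o.
  InX-large : ∀ N xs → All Pos xs → wt xs ≤ N → InX N xs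
  InX-large N xs ps h with findO xs in e
  ... | nothing = subst AE (sym (tl-long N 0 xs (≤-trans (wt≥length xs ps) h))) tt
  ... | just (U , o , L) with findO-just xs e
  ...   | refl , _ , p = ≤-trans (begin
      F o + T 0 U                ≤⟨ +-mono-≤ (m/n≤m (size o) η)
          (≤-trans (T≤length 0 U) (wt≥length U (All.++⁻ˡ U ps))) ⟩
      size o + wt U              ≤⟨ m≤m+n _ (wt L) ⟩
      size o + wt U + wt L       ≡⟨ solve 3 (λ a b c → a :+ b :+ c := b :+ (a :+ c)) refl (size o) (wt U)
          (wt L) ⟩
      wt U + wt (o ∷ L)          ≡⟨ sym (wt-++ U (o ∷ L)) ⟩
      wt (U ++ o ∷ L)            ∎) h
    where
    open ≤-Reasoning

  does⁻ : {P : Set} (d : Dec P) → does d ≡ true → P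
  does⁻ (yes p) _ = p

  does⁺ : {P : Set} (d : Dec P) → P → does d ≡ true
  does⁺ (yes _) p = refl
  does⁺ (no ¬p) p = ⊥-elim (¬p p)

  does⁻¬ : {P : Set} (d : Dec P) → not (does d) ≡ true → ¬ P
  does⁻¬ (no ¬p) _ = ¬p

  does⁺¬ : {P : Set} (d : Dec P) → ¬ P → not (does d) ≡ true
  does⁺¬ (yes p) ¬p = ⊥-elim (¬p p)
  does⁺¬ (no _)  ¬p = refl

  C : ℕ → ℕ → ℕ
  C N n = countᵇ (λ xs → valid n xs ∧ does (InX? N xs)) (allOverpartitions n)

  newᵇ : ℕ → ℕ → List Part → Bool
  newᵇ N n xs = valid n xs ∧ does (InX? (suc N) xs) ∧ not (does (InX? N xs))

  new⁻ : ∀ N n {xs} → newᵇ N n xs ≡ true → (H xs × wt xs ≡ n) × InX (suc N) xs × ¬ InX N xs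
  new⁻ N n {xs} e with ∧-true⁻ (valid n xs) e
  ... | v , e′ with ∧-true⁻ (does (InX? (suc N) xs)) e′
  ... | a , b = valid⁻ n xs v , does⁻ (InX? (suc N) xs) a , does⁻¬ (InX? N xs) b

  old⁻ : ∀ N n {xs} → (valid n xs ∧ does (InX? N xs)) ≡ true → (H xs × wt xs ≡ n) × InX N xs
  old⁻ N n {xs} e with ∧-true⁻ (valid n xs) e
  ... | v , a = valid⁻ n xs v , does⁻ (InX? N xs) a

  unique-E : ∀ n → Unique (allOverpartitions n)
  unique-E n = unique-listsUpTo (partAlphabet n) (unique-partAlphabet n) n

  -- For n < η(N + 1) there is no new list, since deletion would have to take away more than the
  -- whole weight.
  new-count : ∀ N n → countᵇ (newᵇ N n) (allOverpartitions n) ≡ shift (η * suc N) (C N) n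
  new-count N n with η * suc N ≤? n
  ... | no ¬h rewrite ≤ᵇ-false (≰⇒> ¬h) = count-none none (allOverpartitions n)
    where
    none : ∀ xs → newᵇ N n xs ≡ false
    none xs with newᵇ N n xs in e
    ... | false = refl
    ... | true with new⁻ N n {xs} e
    ...   | (h , w) , i , ¬i with del-step N xs h i ¬i
    ...     | π , _ , _ , _ , w′ =
        ⊥-elim (¬h (≤-trans (≤-reflexive (*-comm η (suc N)))
        (≤-trans (m≤n+m _ (wt π)) (≤-reflexive (trans (sym w′) w)))))
  ... | yes h rewrite ≤ᵇ-true h =
      sym (count-bijection (Ins (suc N)) _ _ (allOverpartitions (n ∸ η * suc N)) (allOverpartitions n)
      (unique-E (n ∸ η * suc N)) (unique-E n) fwd′ bwd′ inj ins-fun)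
    where
    fwd′ : ∀ {π} → (valid (n ∸ η * suc N) π ∧ does (InX? N π)) ≡ true →
        ∃[ σ ] ((σ ∈ allOverpartitions n × newᵇ N n σ ≡ true) × Ins (suc N) π σ)
    fwd′ {π} e with old⁻ N (n ∸ η * suc N) e
    ... | (hπ , w) , i with ins-step N π hπ i
    ...   | σ , πσ , hσ , i′ , ¬i , w′ =
        σ , (H⇒∈ n σ (H.pos hσ) wσ , ∧-true⁺ (valid⁺ n σ hσ wσ)
        (∧-true⁺ (does⁺ (InX? (suc N) σ) i′) (does⁺¬ (InX? N σ) ¬i))) , πσ
      where
      wσ : wt σ ≡ n
      wσ = trans w′ (trans (cong₂ _+_ w (*-comm (suc N) η)) (m∸n+n≡m h))
    bwd′ : ∀ {σ} → newᵇ N n σ ≡ true →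
        ∃[ π ] ((π ∈ allOverpartitions (n ∸ η * suc N) ×
        (valid (n ∸ η * suc N) π ∧ does (InX? N π)) ≡ true) × Ins (suc N) π σ)
    bwd′ {σ} e with new⁻ N n {σ} e
    ... | (hσ , w) , i , ¬i with del-step N σ hσ i ¬i
    ...   | π , πσ , hπ , i′ , w′ =
        π , (H⇒∈ _ π (H.pos hπ) wπ , ∧-true⁺ (valid⁺ _ π hπ wπ) (does⁺ (InX? N π) i′)) , πσ
      where
      wπ : wt π ≡ n ∸ η * suc N
      wπ = trans (sym (m+n∸n≡m (wt π) (suc N * η))) (cong₂ _∸_ (trans (sym w′) w) (*-comm (suc N) η))
    inj : ∀ {π π′ σ} → (valid (n ∸ η * suc N) π ∧ does (InX? N π)) ≡ true →
        (valid (n ∸ η * suc N) π′ ∧ does (InX? N π′)) ≡ true →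
          Ins (suc N) π σ → Ins (suc N) π′ σ → π ≡ π′
    inj {π} {π′} e e′ a b with old⁻ N _ {π} e | old⁻ N _ {π′} e′
    ... | (hπ , _) , i | (hπ′ , _) , i′ = ins-inj N hπ i hπ′ i′ a b

  C-rec : ∀ N n → C (suc N) n ≡ C N n + shift (η * suc N) (C N) n
  C-rec N n = trans (count-split {p′ = λ xs → valid n xs ∧ does (InX? N xs)} {p″ =
      newᵇ N n} split (allOverpartitions n)) (cong (C N n +_) (new-count N n))
    where
    split : ∀ xs → (if valid n xs ∧ does (InX? (suc N) xs) then 1 else 0) ≡
        (if valid n xs ∧ does (InX? N xs) then 1 else 0) + (if newᵇ N n xs then 1 else 0)
    split xs with valid n xs | InX? (suc N) xs | InX? N xs
    ... | false | _     | _     = refl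
    ... | true  | yes _ | yes _ = refl
    ... | true  | yes _ | no _  = refl
    ... | true  | no ¬a | yes a = ⊥-elim (¬a (InX-suc N xs a))
    ... | true  | no _  | no _  = refl

  C-large : ∀ n → Bbar (fsuc fzero) α η k r n ≡ C n n
  C-large n = count-cong same-test (allOverpartitions n)
    where
    same-test : ∀ xs → valid n xs ≡ (valid n xs ∧ does (InX? n xs))
    same-test xs with valid n xs in e
    ... | false = refl
    ... | true with valid⁻ n xs e
    ...   | h , w = sym (does⁺ (InX? n xs) (InX-large n xs (H.pos h) (≤-reflexive w)))

  -- Bressoud's partitions as the bottom X₀ of the filtration.

  dv : ℕ → Bool
  dv = divη {l} fzero α η k r

  -- Overlining the nonmultiples turns their distinctness into that of overlined parts, and the
  -- count V into the count of overlined parts.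
  tag : ℕ → Part
  tag x = part x (not (dv x))

  dv⁻ : ∀ x → dv x ≡ true → x % η ≡ 0
  dv⁻ x e = ≡ᵇ⁻ (x % η) 0 e

  dv⁻¬ : ∀ x → dv x ≡ false → x % η ≢ 0
  dv⁻¬ x e z with trans (sym e) (≡ᵇ⁺ z)
  ... | ()

  not-true : ∀ {b} → not b ≡ true → b ≡ false
  not-true {false} _ = refl

  not-false : ∀ {b} → not b ≡ false → b ≡ true
  not-false {true} _ = refl

  tag-¬O : ∀ x → ¬O (tag x)
  tag-¬O x (o , z) = dv⁻¬ x (not-true o) z

  size-tag : ∀ ys → map size (map tag ys) ≡ ys
  size-tag []       = refl
  size-tag (y ∷ ys) = cong (y ∷_) (size-tag ys)

  tag-size : ∀ xs → All Adm xs → All ¬O xs → map tag (map size xs) ≡ xs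
  tag-size []       []       []        = refl
  tag-size (x ∷ xs) (a ∷ as) (¬o ∷ os) =
      cong₂ _∷_ (cong (part (size x)) (go (over x) refl)) (tag-size xs as os)
    where
    go : ∀ b → over x ≡ b → not (dv (size x)) ≡ b
    go false e = cong not (≡ᵇ⁺ (Adm.plain⇒ a e))
    go true  e with dv (size x) in d
    ... | false = refl
    ... | true  = ⊥-elim (¬o (e , dv⁻ (size x) d))

  -- The local helper of `pcond2ᵇ` cannot be named; unification finds it from these equations.
  partition-spec : Σ (ℕ → List ℕ → List ℕ) λ f →
    (∀ x xs → pcond2ᵇ fzero α η k r (x ∷ xs) ≡ distinctᵇ (if dv x then f x xs else x ∷ f x xs))
    × (∀ x → f x [] ≡ [])
    × (∀ x y ys → f x (y ∷ ys) ≡ (if dv y then f x ys else y ∷ f x ys))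
  partition-spec = _ , (λ x xs → refl) , (λ _ → refl) , λ x y ys → refl

  overs-tag : ∀ x xs → map size (overs (tag x ∷ xs)) ≡
      (if dv x then map size (overs xs) else x ∷ map size (overs xs))
  overs-tag x xs with dv x
  ... | false = refl
  ... | true  = refl

  pcond2≡ : ∀ ys → pcond2ᵇ fzero α η k r ys ≡ distinctᵇ (map size (overs (map tag ys)))
  pcond2≡ []       = refl
  pcond2≡ (x ∷ xs) with partition-spec
  ... | f , e , e[] , e∷ = trans (e x xs)
      (trans (cong (λ l → distinctᵇ (if dv x then l else x ∷ l)) (go xs))
      (cong distinctᵇ (sym (overs-tag x (map tag xs)))))
    where
    go : ∀ ys → f x ys ≡ map size (overs (map tag ys))
    go []       = e[] x
    go (y ∷ ys) = trans (e∷ x y ys)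
        (trans (cong (λ l → if dv y then l else y ∷ l) (go ys)) (sym (overs-tag y (map tag ys))))

  adjacent-tag⁻ : ∀ ys → adjacentᵇ (λ x y → y ≤ᵇ x) ys ≡ true → Adjacent (map tag ys)
  adjacent-tag⁻ []           e = tt
  adjacent-tag⁻ (x ∷ [])     e = tt , tt
  adjacent-tag⁻ (x ∷ y ∷ ys) e =
    (≤ᵇ⁻ y x (proj₁ (∧-true⁻ (y ≤ᵇ x) e)) , λ eq o → subst (λ z → not (dv z) ≡ true) eq o) ,
        adjacent-tag⁻ (y ∷ ys) (proj₂ (∧-true⁻ (y ≤ᵇ x) e))

  adjacent-tag⁺ : ∀ ys → Chain (map tag ys) → adjacentᵇ (λ x y → y ≤ᵇ x) ys ≡ true
  adjacent-tag⁺ []           c = refl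
  adjacent-tag⁺ (x ∷ [])     c = refl
  adjacent-tag⁺ (x ∷ y ∷ ys) (h , c) = ∧-true⁺ (≤ᵇ-true (≽⇒≥ (tag x) (tag y) h)) (adjacent-tag⁺ (y ∷ ys) c)

  adm-tag⁻ : ∀ x → (dv x ∨ any (λ a → x % η ≡ᵇ a) A) ≡ true → Adm (tag x)
  adm-tag⁻ x e = mkAdm (λ o → inj₂
      (any-≡⁻ (x % η) A (subst (λ b → (b ∨ any (λ a → x % η ≡ᵇ a) A) ≡ true) (not-true o) e))) (λ o →
      dv⁻ x (not-false o))

  adm-tag⁺ : ∀ x → Adm (tag x) → (dv x ∨ any (λ a → x % η ≡ᵇ a) A) ≡ true
  adm-tag⁺ x a = go (dv x) refl
    where
    go : ∀ b → dv x ≡ b → (b ∨ any (λ a → x % η ≡ᵇ a) A) ≡ true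
    go true  e = refl
    go false e with Adm.over⇒ a (cong not e)
    ... | inj₁ z = ⊥-elim (dv⁻¬ x e z)
    ... | inj₂ h = any-≡⁺ (x % η) A h

  gapT : ℕ → ℕ → Bool
  gapT x y = if dv x then y + η <ᵇ x else y + η ≤ᵇ x

  gapT⁻ : ∀ x y → gapT x y ≡ true → Gap (tag x) (tag y)
  gapT⁻ x y e with dv x
  ... | true  = subst (_≤ x) (+-comm 1 (y + η)) (<ᵇ⁻ (y + η) x e)
  ... | false = subst (_≤ x) (sym (+-identityʳ (y + η))) (≤ᵇ⁻ (y + η) x e)

  gapT⁺ : ∀ x y → Gap (tag x) (tag y) → gapT x y ≡ true
  gapT⁺ x y g with dv x
  ... | true  = <ᵇ⁺ (subst (_≤ x) (+-comm (y + η) 1) g)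
  ... | false = ≤ᵇ-true (subst (_≤ x) (+-identityʳ (y + η)) g)

  closeT : ℕ → ℕ → Bool
  closeT x y = if dv x then x ≤ᵇ y + η else x <ᵇ y + η

  closeT⁻ : ∀ x y → closeT x y ≡ true → ¬ Gap (tag x) (tag y)
  closeT⁻ x y e g with dv x
  ... | true  = <-irrefl refl (≤-trans (≤-reflexive (+-comm 1 (y + η))) (≤-trans g (≤ᵇ⁻ x (y + η) e)))
  ... | false = <-irrefl refl (≤-trans (<ᵇ⁻ x (y + η) e)
      (≤-trans (≤-reflexive (sym (+-identityʳ (y + η)))) g))

  closeT⁺ : ∀ x y → ¬ Gap (tag x) (tag y) → closeT x y ≡ true
  closeT⁺ x y ¬g with dv x
  ... | true  = ≤ᵇ-true (s≤s⁻¹ (≤-trans (≰⇒> ¬g) (≤-reflexive (+-comm (y + η) 1))))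
  ... | false = <ᵇ⁺ (≤-trans (≰⇒> ¬g) (≤-reflexive (+-identityʳ (y + η))))

  nth-map⁺ : ∀ ys i {x} → nth ys i ≡ just x → nth (map tag ys) i ≡ just (tag x)
  nth-map⁺ (y ∷ ys) zero    refl = refl
  nth-map⁺ (y ∷ ys) (suc i) e    = nth-map⁺ ys i e

  nth-map⁻ : ∀ ys i {u} → nth (map tag ys) i ≡ just u → ∃[ x ] (nth ys i ≡ just x × u ≡ tag x)
  nth-map⁻ (y ∷ ys) zero    refl = y , refl , refl
  nth-map⁻ (y ∷ ys) (suc i) e    = nth-map⁻ ys i e

  pcheck3 : Σ (List ℕ → ℕ → Bool) λ f → ∀ π → pcond3ᵇ fzero α η k r π ≡ all (f π) (upTo (length π))
  pcheck3 = _ , λ π → refl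

  pcheck5 : Σ (List ℕ → ℕ → Bool) λ f → ∀ π → pcond5ᵇ fzero α η k r π ≡ all (f π) (upTo (length π))
  pcheck5 = _ , λ π → refl

  pcond3⁻ : ∀ ys → pcond3ᵇ fzero α η k r ys ≡ true → Windows (map tag ys)
  pcond3⁻ ys c i e e′ with nth-map⁻ ys i e | nth-map⁻ ys (i + suc q) e′
  ... | x , ex , refl | y , ey , refl = check (nth-just⇒< i ys ex) ex ey
    where
    check : ∀ {x y} → i < length ys → nth ys i ≡ just x → nth ys (i + suc q) ≡ just y → Gap (tag x) (tag y)
    check i< e e′ with nth ys i | nth ys (i + suc q) | All.lookup
        (all⁻ (proj₁ pcheck3 ys) (upTo (length ys)) c) (∈-upTo⁺ i<)
    check i< refl refl | just x | just y | h = gapT⁻ x y h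

  pcond3⁺ : ∀ ys → Windows (map tag ys) → pcond3ᵇ fzero α η k r ys ≡ true
  pcond3⁺ ys g = all⁺ (proj₁ pcheck3 ys) (upTo (length ys)) (All.tabulate (λ {i} _ → go i))
    where
    go : ∀ i → proj₁ pcheck3 ys i ≡ true
    go i with nth ys i in e | nth ys (i + suc q) in e′
    ... | nothing | _       = refl
    ... | just x  | nothing = refl
    ... | just x  | just y  = gapT⁺ x y (g i (nth-map⁺ ys i e) (nth-map⁺ ys (i + suc q) e′))

  bool-ext : ∀ {a b} → (a ≡ true → b ≡ true) → (b ≡ true → a ≡ true) → a ≡ b
  bool-ext {false} {false} f g = refl
  bool-ext {false} {true}  f g = g refl
  bool-ext {true}  {b}     f g = sym (f refl)

  -- Only an overlined part of size η could tell the two tests apart, and `tag` never overlines a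
  -- multiple of η.
  small-tag : ∀ x → (x ≤ᵇ η) ≡ (tag x ≤ₚ plain η)
  small-tag x = bool-ext (λ e → small⁺ (tag x) (to (≤ᵇ⁻ x η e))) (λ e →
      ≤ᵇ-true (m+n≤o⇒m≤o x (small⁻ (tag x) e)))
    where
    to : x ≤ η → x + ov (tag x) ≤ η
    to h with dv x in d
    ... | true  = subst (_≤ η) (sym (+-identityʳ x)) h
    ... | false with m≤n⇒m<n∨m≡n h
    ...   | inj₁ lt = subst (_≤ η) (+-comm 1 x) lt
    ...   | inj₂ eq = ⊥-elim (dv⁻¬ x d (trans (cong (_% η) eq) (n%n≡0 η)))

  count-map : {X Y : Set} (f : X → Y) (p : Y → Bool) → ∀ xs → countᵇ p (map f xs) ≡ countᵇ (p ∘ f) xs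
  count-map f p []       = refl
  count-map f p (x ∷ xs) = cong ((if p (f x) then 1 else 0) +_) (count-map f p xs)

  smalls-tag : ∀ ys → countᵇ (λ x → x ≤ᵇ η) ys ≡ smalls (map tag ys)
  smalls-tag ys = trans (count-cong small-tag ys) (sym (count-map tag (λ x → x ≤ₚ plain η) ys))

  count-++ : {X : Set} (p : X → Bool) → ∀ xs ys → countᵇ p (xs ++ ys) ≡ countᵇ p xs + countᵇ p ys
  count-++ p []       ys = refl
  count-++ p (x ∷ xs) ys = trans (cong ((if p x then 1 else 0) +_) (count-++ p xs ys))
      (sym (+-assoc (if p x then 1 else 0) _ _))

  Vᵇ : ℕ → ℕ → Bool
  Vᵇ N x = (x ≤ᵇ N) ∧ not (dv x)

  V-suffix : ∀ x post → All (_≤ x) post → countᵇ (Vᵇ x) post ≡ #ov (map tag post)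
  V-suffix x []         []      = refl
  V-suffix x (y ∷ post) (h ∷ a) rewrite ≤ᵇ-true h =
      cong ((if not (dv y) then 1 else 0) +_) (V-suffix x post a)

  -- A nonmultiple above x and not larger than x would have the same size, hence be a second copy of
  -- the same overlined part.
  V-prefix : ∀ x pre {R} → Chain (map tag pre ++ tag x ∷ R) → countᵇ (Vᵇ x) pre ≡ 0
  V-prefix x []        c = refl
  V-prefix x (y ∷ pre) {R} c with dv y in d | y ≤ᵇ x in le
  ... | true  | true  = V-prefix x pre (proj₂ c)
  ... | true  | false = V-prefix x pre (proj₂ c)
  ... | false | false = V-prefix x pre (proj₂ c)
  ... | false | true  = ⊥-elim (bad (dv x) refl)
    where
    ty≽ : part y (not false) ≽ tag x
    ty≽ = All.head (All.++⁻ʳ (map tag pre) (chain⇒below (part y true) (map tag pre ++ tag x ∷ R) c))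
    y≤x : y ≤ x
    y≤x = ≤ᵇ⁻ y x le
    bad : ∀ b → dv x ≡ b → ⊥
    bad false e = <-irrefl refl (≤-trans
        (≤-trans (≤-reflexive (+-comm 1 x)) (subst (λ b → x + (if not b then 1 else 0) ≤ y) e ty≽)) y≤x)
    bad true  e = dv⁻¬ y d (trans (cong (_% η) (≤-antisym y≤x (m+n≤o⇒m≤o x ty≽))) (dv⁻ x e))

  V≡ : ∀ pre x post → Chain (map tag (pre ++ x ∷ post)) →
      V {l} fzero α η k r (pre ++ x ∷ post) x ≡ #ov (map tag (x ∷ post))
  V≡ pre x post c = trans (count-++ (Vᵇ x) pre (x ∷ post))
      (trans (cong (_+ countᵇ (Vᵇ x) (x ∷ post)) (V-prefix x pre c′))
    (V-suffix x (x ∷ post) (≤-refl ∷ All.map (λ {y} → ≽⇒≥ (tag x) (tag y))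
        (All.map⁻ (chain⇒below (tag x) (map tag post) (chain-drop (map tag pre) c′))))))
    where
    c′ : Chain (map tag pre ++ tag x ∷ map tag post)
    c′ = subst Chain (map-++ tag pre (x ∷ post)) c
    chain-drop : ∀ P {R} → Chain (P ++ R) → Chain R
    chain-drop []      c = c
    chain-drop (p ∷ P) c = chain-drop P (proj₂ c)

  par-%2 : ∀ n → n % 2 ≡ (if par n then 1 else 0)
  par-%2 zero          = refl
  par-%2 (suc zero)    = refl
  par-%2 (suc (suc n)) = trans (trans (cong (_% 2) (+-comm 2 n)) ([m+n]%n≡m%n n 2))
      (trans (par-%2 n) (cong (λ b → if b then 1 else 0) (sym (not-involutive (par n)))))

  par⇒%2 : ∀ {a b} → par a ≡ par b → a % 2 ≡ b % 2
  par⇒%2 {a} {b} e = trans (par-%2 a) (trans (cong (λ c → if c then 1 else 0) e) (sym (par-%2 b)))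

  %2⇒par : ∀ {a b} → a % 2 ≡ b % 2 → par a ≡ par b
  %2⇒par {a} {b} e = inj (par a) (par b) (trans (sym (par-%2 a)) (trans e (par-%2 b)))
    where
    inj : ∀ c d → (if c then 1 else 0) ≡ (if d then 1 else 0) → c ≡ d
    inj false false _ = refl
    inj true  true  _ = refl
    inj false true  ()
    inj true  false ()

  move-parity : ∀ s v → par (s + 1) ≡ par (r + v) → par (s + v) ≡ par (suc r)
  move-parity s v e rewrite par-+ s 1 | par-+ r v | par-+ s v = go (par s) (par v) (par r) e
    where
    go : ∀ a b c → a xor true ≡ c xor b → a xor b ≡ not c
    go false false true  e = refl
    go false false false ()
    go false true  false e = refl
    go false true  true  ()
    go true  false false e = refl
    go true  false true  ()
    go true  true  false ()
    go true  true  true  e = refl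

  move-parity′ : ∀ s v → par (s + v) ≡ par (suc r) → par (s + 1) ≡ par (r + v)
  move-parity′ s v e rewrite par-+ s 1 | par-+ r v | par-+ s v = go (par s) (par v) (par r) e
    where
    go : ∀ a b c → a xor b ≡ not c → a xor true ≡ c xor b
    go false false true  e = refl
    go false false false ()
    go false true  false e = refl
    go false true  true  ()
    go true  false false e = refl
    go true  false true  ()
    go true  true  true  e = refl
    go true  true  false ()

  sumF-tag : ∀ ys → sumF (map tag ys) ≡ sum (map (λ z → z / η) ys)
  sumF-tag []       = refl
  sumF-tag (y ∷ ys) = cong (y / η +_) (sumF-tag ys)

  take-map : ∀ n ys → take n (map tag ys) ≡ map tag (take n ys)
  take-map zero    ys       = refl
  take-map (suc n) []       = refl
  take-map (suc n) (y ∷ ys) = cong (tag y ∷_) (take-map n ys)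

  evenT : ℕ → List ℕ → ℕ → Bool
  evenT x ys i = (sum (map (λ z → z / η) (take (suc q) (drop i ys))) + 1) % 2 ≡ᵇ
      (r + V {l} fzero α η k r ys x) % 2

  drop-length : ∀ (pre : List ℕ) ys → drop (length pre) (pre ++ ys) ≡ ys
  drop-length []        ys = refl
  drop-length (p ∷ pre) ys = drop-length pre ys

  Ev-tag : ∀ pre x post → Chain (map tag (pre ++ x ∷ post)) →
           (evenT x (pre ++ x ∷ post) (length pre) ≡ true → Ev (map tag (x ∷ post)))
           × (Ev (map tag (x ∷ post)) → evenT x (pre ++ x ∷ post) (length pre) ≡ true)
  Ev-tag pre x post c = to , from
    where
    s v : ℕ
    s = sum (map (λ z → z / η) (take (suc q) (drop (length pre) (pre ++ x ∷ post))))
    v = V {l} fzero α η k r (pre ++ x ∷ post) x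
    mass≡ : mass (map tag (x ∷ post)) ≡ s + v
    mass≡ = cong₂ _+_ (trans (cong sumF (take-map (suc q) (x ∷ post)))
        (trans (sumF-tag (take (suc q) (x ∷ post)))
        (cong (λ l → sum (map (λ z → z / η) (take (suc q) l))) (sym (drop-length pre (x ∷ post))))))
            (sym (V≡ pre x post c))
    to : evenT x (pre ++ x ∷ post) (length pre) ≡ true → Ev (map tag (x ∷ post))
    to e = trans (cong par mass≡) (move-parity s v (%2⇒par {s + 1} {r + v} (≡ᵇ⁻ _ _ e)))
    from : Ev (map tag (x ∷ post)) → evenT x (pre ++ x ∷ post) (length pre) ≡ true
    from e = ≡ᵇ⁺ (par⇒%2 {s + 1} {r + v} (move-parity′ s v (trans (cong par (sym mass≡)) e)))

  nth-shift : {X : Set} → ∀ (pre ys : List X) j → nth (pre ++ ys) (length pre + j) ≡ nth ys j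
  nth-shift []        ys j = refl
  nth-shift (p ∷ pre) ys j = nth-shift pre ys j

  bandAt-nth : ∀ {x xs} (bd : BandAt x xs) → nth (x ∷ xs) q ≡ just (BandAt.end bd)
  bandAt-nth (mkBand as z R e refl ¬g) = trans (cong (λ l → nth l q) e) (nth-mid as)

  pcond5⁻ : ∀ ys → Chain (map tag ys) → pcond5ᵇ fzero α η k r ys ≡ true → AE (map tag ys)
  pcond5⁻ ys c h = loop [] ys refl
    where
    check : ∀ i {x y} → i < length ys → nth ys i ≡ just x → nth ys (i + q) ≡ just y → closeT x y ≡ true →
        evenT x ys i ≡ true
    check i i< e e′ cl with nth ys i | nth ys (i + q) | All.lookup
        (all⁻ (proj₁ pcheck5 ys) (upTo (length ys)) h) (∈-upTo⁺ i<)
    check i i< refl refl cl | just x | just y | k rewrite cl = k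
    loop : ∀ pre zs → ys ≡ pre ++ zs → AE (map tag zs)
    loop pre []         e = tt
    loop pre (x ∷ post) e = here′ , loop (pre ++ x ∷ []) post (trans e (sym (++-assoc pre (x ∷ []) post)))
      where
      here′ : BandAt (tag x) (map tag post) → Ev (tag x ∷ map tag post)
      here′ bd with nth-map⁻ (x ∷ post) q (bandAt-nth bd)
      ... | y , ey , eq = proj₁ (Ev-tag pre x post (subst (Chain ∘ map tag) e c))
          (subst (λ l → evenT x l (length pre) ≡ true) e
        (check (length pre) (nth-just⇒< (length pre) ys ex) ex
            (trans (cong (λ l → nth l (length pre + q)) e) (trans (nth-shift pre (x ∷ post) q) ey))
          (closeT⁺ x y (subst (λ u → ¬ Gap (tag x) u) eq (BandAt.¬gap bd)))))
        where
        ex : nth ys (length pre) ≡ just x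
        ex = trans (cong (λ l → nth l (length pre)) e) (nth-mid pre)

  pcond5⁺ : ∀ ys → Chain (map tag ys) → AE (map tag ys) → pcond5ᵇ fzero α η k r ys ≡ true
  pcond5⁺ ys c ae = all⁺ (proj₁ pcheck5 ys) (upTo (length ys)) (All.tabulate (λ {i} _ → go i))
    where
    even-at : ∀ i x y → nth ys i ≡ just x → nth ys (i + q) ≡ just y → closeT x y ≡ true →
        evenT x ys i ≡ true
    even-at i x y e e′ cl with nth-split i ys e
    ... | pre , post , refl , refl =
        proj₂ (Ev-tag pre x post c) (proj₁
        (AE-suf (map tag pre) (map tag (x ∷ post)) (subst AE (map-++ tag pre (x ∷ post)) ae)) bd)
      where
      bd : BandAt (tag x) (map tag post)
      bd with nth-split q (tag x ∷ map tag post)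
          (nth-map⁺ (x ∷ post) q (trans (sym (nth-shift pre (x ∷ post) q)) e′))
      ... | as , R , eq , len = mkBand as (tag y) R eq len (closeT⁻ x y cl)
    go : ∀ i → proj₁ pcheck5 ys i ≡ true
    go i with nth ys i in e | nth ys (i + q) in e′
    ... | nothing | _       = refl
    ... | just x  | nothing = refl
    ... | just x  | just y  with closeT x y in cl
    ...   | false = refl
    ...   | true  = even-at i x y e e′ cl

  validB : ℕ → List ℕ → Bool
  validB = validBᵇ fzero α η k r

  wt-tag : ∀ ys → wt (map tag ys) ≡ sum ys
  wt-tag ys = cong sum (size-tag ys)

  validB⁻ : ∀ n ys → validB n ys ≡ true → (H (map tag ys) × AE (map tag ys)) × sum ys ≡ n
  validB⁻ n ys v with ∧-true⁻ (isPartitionᵇ n ys) v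
  ... | v0 , v1 with ∧-true⁻ (pcond1ᵇ fzero α η k r ys) v1
  ... | c1 , v2 with ∧-true⁻ (pcond2ᵇ fzero α η k r ys) v2
  ... | c2 , v3 with ∧-true⁻ (pcond3ᵇ fzero α η k r ys) v3
  ... | c3 , v4 with ∧-true⁻ (pcond4ᵇ fzero α η k r ys) v4
  ... | c4 , c5 with ∧-true⁻ (all (λ x → 1 ≤ᵇ x) ys) v0
  ... | o1 , v5 with ∧-true⁻ (adjacentᵇ (λ x y → y ≤ᵇ x) ys) v5
  ... | o2 , o3 = (mkH (smalls⇒W (map tag ys) (windows⇒W (map tag ys) ch (pcond3⁻ ys c3))
      (subst (_< r) (smalls-tag ys) (<ᵇ⁻ _ r c4)))
      (All.map⁺ (All.map (λ {x} → adm-tag⁻ x) (all⁻ _ ys c1)))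
          (All.map⁺ (All.map (λ {x} → ≤ᵇ⁻ 1 x) (all⁻ _ ys o1))) , pcond5⁻ ys ch c5) , ≡ᵇ⁻ _ n o3
    where
    ch : Chain (map tag ys)
    ch = adjacent⇒chain (map tag ys) (adjacent-tag⁻ ys o2) (trans (sym (pcond2≡ ys)) c2)

  validB⁺ : ∀ n ys → H (map tag ys) → AE (map tag ys) → sum ys ≡ n → validB n ys ≡ true
  validB⁺ n ys h@(mkH w ad ps) ae e =
      ∧-true⁺ (∧-true⁺ (all⁺ _ ys (All.map (λ {x} → ≤ᵇ-true) (All.map⁻ ps)))
      (∧-true⁺ (adjacent-tag⁺ ys ch) (≡ᵇ⁺ e)))
    (∧-true⁺ (all⁺ _ ys (All.map (λ {x} → adm-tag⁺ x) (All.map⁻ ad)))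
        (∧-true⁺ (trans (pcond2≡ ys) (chain⇒distinct (map tag ys) ch))
      (∧-true⁺ (pcond3⁺ ys (W⇒windows (map tag ys) (W-real h)))
          (∧-true⁺ (<ᵇ⁺ (subst (_< r) (sym (smalls-tag ys)) (W⇒smalls (map tag ys) w ps)))
          (pcond5⁺ ys ch ae)))))
    where
    ch : Chain (map tag ys)
    ch = W⇒chain (map tag ys) (W-real h)

  InX0⁻ : ∀ xs → H xs → InX 0 xs → All ¬O xs × AE xs
  InX0⁻ xs h i with findO xs in e
  ... | nothing = findO-nothing xs e , subst AE (tl-zero xs) i
  ... | just (U , o , L) with findO-just xs e
  ...   | refl , _ , p = ⊥-elim (n≮0
      (subst (1 ≤_) (trans (size-O o p) (cong (_* η) (n≤0⇒n≡0 (m+n≤o⇒m≤o (F o) i))))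
      (All.head (All.++⁻ʳ U (H.pos h)))))

  InX0⁺ : ∀ xs → All ¬O xs → AE xs → InX 0 xs
  InX0⁺ xs a ae = subst (InX′ 0 xs) (sym (findO-none xs a)) (subst AE (sym (tl-zero xs)) ae)

  tags-¬O : ∀ ys → All ¬O (map tag ys)
  tags-¬O []       = []
  tags-¬O (y ∷ ys) = tag-¬O y ∷ tags-¬O ys

  ∈-partitions : ∀ n ys → All (1 ≤_) ys → sum ys ≡ n → ys ∈ allPartitions n
  ∈-partitions n ys ps refl = ∈-listsUpTo (map suc (upTo n)) n ys (len ys ps)
      (All.map (λ { {x} (p , h) → ∈-sucs n x p h }) (All.zip (ps , bnd ys)))
    where
    len : ∀ ys → All (1 ≤_) ys → length ys ≤ sum ys
    len []       []       = z≤n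
    len (y ∷ ys) (p ∷ ps) = +-mono-≤ p (len ys ps)
    bnd : ∀ ys → All (_≤ sum ys) ys
    bnd []       = []
    bnd (y ∷ ys) = m≤m+n y (sum ys) ∷ All.map (λ h → ≤-trans h (m≤n+m (sum ys) y)) (bnd ys)

  B≡C0 : ∀ n → B fzero α η k r n ≡ C 0 n
  B≡C0 n = count-bijection (λ ys xs → xs ≡ map tag ys) (validB n) (λ xs → valid n xs ∧ does (InX? 0 xs))
      (allPartitions n) (allOverpartitions n)
    (unique-listsUpTo (map suc (upTo n)) (unique-sucs n) n) (unique-E n) to from
    (λ {ys} {ys′} _ _ e e′ → trans (sym (size-tag ys))
        (trans (cong (map size) (trans (sym e) e′)) (size-tag ys′))) (λ e e′ → trans e (sym e′))
    where
    to : ∀ {ys} → validB n ys ≡ true →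
        ∃[ xs ] ((xs ∈ allOverpartitions n × (valid n xs ∧ does (InX? 0 xs)) ≡ true) × xs ≡ map tag ys)
    to {ys} v with validB⁻ n ys v
    ... | (h , ae) , e = map tag ys ,
        (H⇒∈ n (map tag ys) (H.pos h) w ,
        ∧-true⁺ (valid⁺ n (map tag ys) h w) (does⁺ (InX? 0 (map tag ys)) (InX0⁺ _ (tags-¬O ys) ae))) , refl
      where
      w : wt (map tag ys) ≡ n
      w = trans (wt-tag ys) e
    from : ∀ {xs} → (valid n xs ∧ does (InX? 0 xs)) ≡ true →
        ∃[ ys ] ((ys ∈ allPartitions n × validB n ys ≡ true) × xs ≡ map tag ys)
    from {xs} v with old⁻ 0 n {xs} v
    ... | (h , w) , i with InX0⁻ xs h i
    ...   | ¬o , ae = map size xs ,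
        (∈-partitions n (map size xs) (All.map⁺ (H.pos h)) w ,
        validB⁺ n (map size xs) (subst H (sym ts) h) (subst AE (sym ts) ae) w) , sym ts
      where
      ts : map tag (map size xs) ≡ xs
      ts = tag-size xs (H.adm h) ¬o

  main : ∀ n → Bbar (fsuc fzero) α η k r n ≡ (negqProd η ⊛ B fzero α η k r) n
  main n = trans (C-large n) (trans (product-series η C C-rec n) (trans (⊛-conv (negqProd η) (C 0) n)
    (trans (sums-cong (suc n) (λ i _ → cong (negqProd η i *_) (sym (B≡C0 (n ∸ i)))))
        (sym (⊛-conv (negqProd η) (B fzero α η k r) n)))))

-- The case r = 0 and the theorem.

-- For r = 0 condition (4) asks for a count below 0, so both series vanish.
no-parts-allowed : ∀ {l} (α : Vec ℕ l) η .{{_ : NonZero η}} k n →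
    Bbar (fsuc fzero) α η k 0 n ≡ (negqProd η ⊛ B fzero α η k 0) n
no-parts-allowed α η k n = trans
    (count-none (λ π → ∧-false (isOverpartitionᵇ n π) (∧-false (cond1ᵇ (fsuc fzero) α η k 0 π)
    (∧-false (cond2ᵇ (fsuc fzero) α η k 0 π) (∧-false (cond3ᵇ (fsuc fzero) α η k 0 π) refl))))
        (allOverpartitions n))
  (sym (trans (⊛-conv (negqProd η) (B fzero α η k 0) n)
      (sums-zero (suc n) (λ i _ → trans (cong (negqProd η i *_) (noB (n ∸ i))) (*-zeroʳ (negqProd η i))))))
  where
  ∧-false : ∀ a {b} → b ≡ false → a ∧ b ≡ false
  ∧-false false e = refl
  ∧-false true  e = e
  noB : ∀ n → B fzero α η k 0 n ≡ 0
  noB n = count-none (λ π → ∧-false (isPartitionᵇ n π) (∧-false (pcond1ᵇ fzero α η k 0 π)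
    (∧-false (pcond2ᵇ fzero α η k 0 π) (∧-false (pcond3ᵇ fzero α η k 0 π) refl)))) (allPartitions n)

theorem1p13 : (l : ℕ) (α : Vec ℕ l) (η : ℕ) .{{_ : NonZero η}} (k r : ℕ)
    → (∀ (i : Fin l) → 0 < lookup α i)
    → (∀ (i i′ : Fin l) → i <ᶠ i′ → lookup α i < lookup α i′)
    → (∀ (i : Fin l) → lookup α i < η)
    → (∀ (i : Fin l) → lookup α i ≡ η ∸ lookup α (opposite i))
    → r ≤ k → l ≤ r → l < k → 2 ≤ k
    → ∀ (n : ℕ) → Bbar (fsuc fzero) α η k r n ≡ (negqProd η ⊛ B fzero α η k r) n
theorem1p13 l α η k zero _ _ _ _ _ _ _ _ n = no-parts-allowed α η k n
theorem1p13 l α η (suc zero) (suc r) _ _ _ _ _ _ _ (s≤s ()) n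
theorem1p13 l α η (suc (suc q)) (suc r) _ _ _ _ r≤k _ l<k _ n =
  Counting.main α η q (suc r) (≤-trans (≤-reflexive (length-toList α)) (s≤s⁻¹ l<k)) (s≤s z≤n) r≤k n
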